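{- Let $k>1$ and let $G,H$ be simple undirected graphs with vertex set $V=\{1,\dots,n\}$. Then: (i) $\mathcal Q^{k+1}_G=\{\mathcal I_n\}$ (where $\mathcal I_n$ is the $n\times n$ identity matrix) if and only if the $k$-dimensional Weisfeiler-Lehman (W-L) algorithm determines that $G$ is asymmetric; (ii) $\mathcal Q^{k+1}_{G,H}=\emptyset$ if and only if the $k$-dimensional W-L algorithm determines that $G$ and $H$ are not isomorphic.
   Context: **The semi-algebraic set.** $E_G$ is the edge set of $G$ and $e$ the all-ones vector. $\mathcal Q_{G,H}$ is the set of $X\in[0,1]^{n\times n}$ with $Xe=X^Te=e$, $X_{u_1v_1}X_{u_2v_2}=0$ for all $\{u_1,u_2\}\in E_G,\{v_1,v_2\}\notin E_H$, and $X_{u_1v_1}X_{u_2v_2}=0$ for all $\{u_1,u_2\}\notin E_G$, $\{v_1,v_2\}\in E_H$ (here $u_1=u_2$ counts as $\{u_1,u_2\}\notin E_G$, and $v_1=v_2$ as $\{v_1,v_2\}\notin E_H$). $\mathcal Q_G=\mathcal Q_{G,G}$. **Sherali-Adams relaxations.** For $P=\{x\in[0,1]^N: f_j(x)=0\ (1\le j\le s),\ g_j(x)\ge 0\ (1\le j\le t)\}$ with polynomials $f_j,g_j$, the $k$th Sherali-Adams relaxation $P^k$ is obtained as follows. Form the constraints $\prod_{i\in I}x_i\, f_j(x)=0$ for all $I\subseteq\{1,\dots,N\}$, $|I|\le k-1$ and all $j$; $\prod_{i\in I}x_i\prod_{i\in J\setminus I}(1-x_i)\,g_j(x)\ge0$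 for all $I\subseteq J$, $|J|\le k-1$ and all $j$; and $\prod_{i\in I}x_i\prod_{i\in J\setminus I}(1-x_i)\ge 0$ for all $I\subseteq J$, $|J|\le k$. Expand, replace every $x_i^2$ by $x_i$ repeatedly until all monomials are square-free, and replace each monomial $\prod_{i\in I}x_i$ with $|I|\ge 1$ by a new variable $y_I$ (and the empty monomial by $1$). This gives a polyhedron $\hat P^k$ in $y$-space, and $P^k=\{x: x_i=y_{\{i\}}\ \forall i,\ y\in\hat P^k\}$. $\mathcal Q^k_{G,H}$, $\mathcal Q^k_G$ are the $k$th relaxations of $\mathcal Q_{G,H}$, $\mathcal Q_G$, where the $f_j$ are the row-sum and column-sum equations and the displayed quadratic equations, and there are no $g_j$. **Tuples.** For $u\in V^k$, $w\in V$, $1\le i\le k$, $\phi_i(u,w)$ is $u$ with its $i$th entry replaced by $w$. $\vec{\mathcal C}_G(u)$ is the $k\times k$ matrix with $(i,j)$ entry $0$ if $u_i=u_j$, $1$ if $\{u_i,u_j\}\in E_G$, and $-1$ otherwise. **$k$-dim W-L algorithm, automorphism version.** Start with the partition of $V^k$ in which $u,v$ are equivalent iff $\vec{\mathcal C}_G(u)=\vec{\mathcal C}_G(v)$. Given a partition $\pi$, refine it to the partition in which $u,v$ are equivalent iff $u\equiv_\pi v$ and there is a bijection $\psi:V\to V$ with $\phi_i(u,w)\equiv_\pi\phi_i(v,\psi(w))$ for all $1\le i\le k$ and all $w\in V$. Iterate until the partition stabilises. The algorithm determines that $G$ is asymmetric iff the final partition is complete (all cells are singletons). **Isomorphism version.**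 For an ordered partition $\vec\pi$ of $V^k$ write $[u]_{\vec\pi}=i$ if $u$ is in the $i$th cell. Put $\vec\omega_{\vec\pi}(u,w)=([\phi_1(u,w)]_{\vec\pi},\dots,[\phi_k(u,w)]_{\vec\pi})$, let $\vec\omega_{\vec\pi}(u)$ be the list of the $n$ tuples $\vec\omega_{\vec\pi}(u,w)$, $w\in V$, sorted lexicographically, and $D_{\vec\pi}(u)=([u]_{\vec\pi},\vec\omega_{\vec\pi}(u))$. For $G$: start with the ordered partition $\vec{\mathcal C}^k_G$ of $V^k$ into level sets of $u\mapsto\vec{\mathcal C}_G(u)$, ordered by a fixed lexicographic order on matrices; repeatedly replace $\vec\pi$ by the ordered partition into level sets of $D_{\vec\pi}$, ordered lexicographically by the value of $D_{\vec\pi}$, until it stabilises at $\vec\pi^*$. Likewise obtain $\vec\tau^*$ from $H$. The algorithm determines that $G$ and $H$ are not isomorphic iff it is not the case that both (a) there is a bijection $\gamma_0:V^k\to V^k$ with $\vec{\mathcal C}_G(u)=\vec{\mathcal C}_H(\gamma_0(u))$ for all $u$, and (b) there is a bijection $\gamma:V^k\to V^k$ with $D_{\vec\pi^*}(u)=D_{\vec\tau^*}(\gamma(u))$ for all $u$. -}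

module Defs where

open import Level using (0ℓ)
open import Data.Bool.Base using (if_then_else_)
open import Data.Empty using (⊥)
open import Data.Fin.Base using (Fin; combine; remQuot)
import Data.Fin.Properties as Fin
open import Data.Fin.Subset using (Subset; _⊆_; _─_; ∣_∣; ⁅_⁆)
open import Data.Fin.Subset.Properties using (_∈?_; nonempty?)
open import Data.Integer.Base using (ℤ; 0ℤ; 1ℤ; -1ℤ)
import Data.Integer.Properties as ℤ
open import Data.List.Base
  using (List; []; _∷_; _++_; map; foldr; filter; length; deduplicate; allFin; cartesianProductWith)
import Data.List.Sort
import Data.List.Relation.Binary.Lex.NonStrict as ListLex
open import Data.Nat.Base as ℕ using (ℕ; zero; suc; _⊔_; _<ᵇ_)
import Data.Nat.Properties as ℕ
open import Data.Product.Base using (∃; ∃₂; _×_; _,_; proj₁; proj₂; uncurry)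
import Data.Product.Relation.Binary.Lex.NonStrict as ProductLex
open import Data.Rational.Base as ℚ using (ℚ; 0ℚ; 1ℚ; ½)
import Data.Rational.Properties as ℚ
open import Data.Rational.Solver using (module +-*-Solver)
open import Data.Vec.Base as Vec using (Vec; []; _∷_; lookup; tabulate; _[_]≔_)
import Data.Vec.Relation.Binary.Lex.NonStrict as VecLex
open import Function.Bundles using (_⤖_; _⇔_; module Bijection)
open import Relation.Binary.Bundles using (DecTotalOrder)
open import Relation.Binary.Core using (Rel)
open import Relation.Binary.Definitions using (Symmetric; Irreflexive; Decidable)
open import Relation.Binary.PropositionalEquality
  using (_≡_; _≗_; refl; sym; trans; cong; cong₂; subst)
open import Relation.Nullary using (¬_; does)

-- Real numbers: Cauchy sequences of rationals, compared by the setoid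
-- equality _≈_.  Strictness of the bounds involving ε is immaterial.

record ℝ : Set where
  constructor mkℝ
  field
    seq    : ℕ → ℚ
    cauchy : ∀ ε → 0ℚ ℚ.< ε →
             ∃ λ N → ∀ m n → N ℕ.≤ m → N ℕ.≤ n → ℚ.∣ seq m ℚ.- seq n ∣ ℚ.≤ ε

open ℝ public

infix  4 _≈_ _≤_
infixl 6 _+_
infixl 7 _*_

_≈_ : Rel ℝ 0ℓ
x ≈ y = ∀ ε → 0ℚ ℚ.< ε → ∃ λ N → ∀ n → N ℕ.≤ n → ℚ.∣ seq x n ℚ.- seq y n ∣ ℚ.≤ ε

_≤_ : Rel ℝ 0ℓ
x ≤ y = ∀ ε → 0ℚ ℚ.< ε → ∃ λ N → ∀ n → N ℕ.≤ n → seq x n ℚ.≤ seq y n ℚ.+ ε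

fromℚ : ℚ → ℝ
fromℚ q = mkℝ (λ _ → q) λ ε 0<ε → 0 , λ _ _ _ _ →
  subst (λ d → ℚ.∣ d ∣ ℚ.≤ ε) (sym (ℚ.+-inverseʳ q)) (ℚ.<⇒≤ 0<ε)

0ℝ 1ℝ -1ℝ : ℝ
0ℝ  = fromℚ 0ℚ
1ℝ  = fromℚ 1ℚ
-1ℝ = fromℚ (ℚ.- 1ℚ)

abstract

  +-cauchy : (x y : ℝ) → ∀ ε → 0ℚ ℚ.< ε →
             ∃ λ N → ∀ m n → N ℕ.≤ m → N ℕ.≤ n →
             ℚ.∣ (seq x m ℚ.+ seq y m) ℚ.- (seq x n ℚ.+ seq y n) ∣ ℚ.≤ ε
  +-cauchy x y ε 0<ε =
    let 0<ε/2      = subst (ℚ._< ½ ℚ.* ε) (ℚ.*-zeroʳ ½) (ℚ.*-monoʳ-<-pos ½ 0<ε)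
        (M , x-ok) = cauchy x (½ ℚ.* ε) 0<ε/2
        (N , y-ok) = cauchy y (½ ℚ.* ε) 0<ε/2
    in M ⊔ N , λ m n m≥ n≥ →
       bound ε (seq x m) (seq x n) (seq y m) (seq y n)
         (x-ok m n (ℕ.m⊔n≤o⇒m≤o M N m≥) (ℕ.m⊔n≤o⇒m≤o M N n≥))
         (y-ok m n (ℕ.m⊔n≤o⇒n≤o M N m≥) (ℕ.m⊔n≤o⇒n≤o M N n≥))
    where
    open ℚ.≤-Reasoning
    open +-*-Solver
    bound : ∀ ε a b c d → ℚ.∣ a ℚ.- b ∣ ℚ.≤ ½ ℚ.* ε → ℚ.∣ c ℚ.- d ∣ ℚ.≤ ½ ℚ.* ε →
            ℚ.∣ (a ℚ.+ c) ℚ.- (b ℚ.+ d) ∣ ℚ.≤ ε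
    bound ε a b c d p q = begin
      ℚ.∣ (a ℚ.+ c) ℚ.- (b ℚ.+ d) ∣
        ≡⟨ cong ℚ.∣_∣ (solve 4 (λ a b c d →
             ((a :+ c) :- (b :+ d)) := ((a :- b) :+ (c :- d))) refl a b c d) ⟩
      ℚ.∣ (a ℚ.- b) ℚ.+ (c ℚ.- d) ∣        ≤⟨ ℚ.∣p+q∣≤∣p∣+∣q∣ (a ℚ.- b) (c ℚ.- d) ⟩
      ℚ.∣ a ℚ.- b ∣ ℚ.+ ℚ.∣ c ℚ.- d ∣      ≤⟨ ℚ.+-mono-≤ p q ⟩
      ½ ℚ.* ε ℚ.+ ½ ℚ.* ε                  ≡⟨ ℚ.*-distribʳ-+ ε ½ ½ ⟨
      1ℚ ℚ.* ε                             ≡⟨ ℚ.*-identityˡ ε ⟩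
      ε ∎

  bounded : ∀ x → ∃ λ B → ℚ.Positive B ×
            ∃ λ N → ∀ n → N ℕ.≤ n → ℚ.∣ seq x n ∣ ℚ.≤ B
  bounded x with cauchy x 1ℚ (ℚ.positive⁻¹ 1ℚ)
  ... | N , x-ok = ℚ.∣ b ∣ ℚ.+ 1ℚ
                 , ℚ.nonNeg+pos⇒pos ℚ.∣ b ∣ {{ℚ.nonNegative (ℚ.0≤∣p∣ b)}} 1ℚ
                 , N , λ n n≥ → begin
    ℚ.∣ seq x n ∣
      ≡⟨ cong ℚ.∣_∣ (solve 2 (λ a b → a := (b :+ (a :- b))) refl (seq x n) b) ⟩
    ℚ.∣ b ℚ.+ (seq x n ℚ.- b) ∣            ≤⟨ ℚ.∣p+q∣≤∣p∣+∣q∣ b (seq x n ℚ.- b) ⟩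
    ℚ.∣ b ∣ ℚ.+ ℚ.∣ seq x n ℚ.- b ∣        ≤⟨ ℚ.+-monoʳ-≤ ℚ.∣ b ∣ (x-ok n N n≥ ℕ.≤-refl) ⟩
    ℚ.∣ b ∣ ℚ.+ 1ℚ ∎
    where
    b : ℚ
    b = seq x N
    open ℚ.≤-Reasoning
    open +-*-Solver

  *-cauchy : (x y : ℝ) → ∀ ε → 0ℚ ℚ.< ε →
             ∃ λ N → ∀ m n → N ℕ.≤ m → N ℕ.≤ n →
             ℚ.∣ (seq x m ℚ.* seq y m) ℚ.- (seq x n ℚ.* seq y n) ∣ ℚ.≤ ε
  *-cauchy x y ε 0<ε =
    let (A , A>0 , K , x≤A) = bounded x
        (B , B>0 , L , y≤B) = bounded y
        (δ , δ>0 , Cδ≡ε)    = shrink (A ℚ.+ B) ε (ℚ.pos+pos⇒pos A {{A>0}} B {{B>0}}) 0<ε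
        (M , x-ok)          = cauchy x δ (ℚ.positive⁻¹ δ {{δ>0}})
        (N , y-ok)          = cauchy y δ (ℚ.positive⁻¹ δ {{δ>0}})
    in (K ⊔ L) ⊔ (M ⊔ N) , combineBounds A>0 δ>0 Cδ≡ε x≤A y≤B x-ok y-ok
    where
    open ℚ.≤-Reasoning
    open +-*-Solver

    bound : ∀ A B δ .{{_ : ℚ.Positive A}} .{{_ : ℚ.Positive δ}} a b c d →
            ℚ.∣ a ∣ ℚ.≤ A → ℚ.∣ d ∣ ℚ.≤ B →
            ℚ.∣ a ℚ.- b ∣ ℚ.≤ δ → ℚ.∣ c ℚ.- d ∣ ℚ.≤ δ →
            ℚ.∣ a ℚ.* c ℚ.- b ℚ.* d ∣ ℚ.≤ (A ℚ.+ B) ℚ.* δ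
    bound A B δ a b c d a≤A d≤B a-b≤δ c-d≤δ = begin
      ℚ.∣ a ℚ.* c ℚ.- b ℚ.* d ∣
        ≡⟨ cong ℚ.∣_∣ (solve 4 (λ a b c d →
             ((a :* c) :- (b :* d)) := ((a :* (c :- d)) :+ (d :* (a :- b)))) refl a b c d) ⟩
      ℚ.∣ a ℚ.* (c ℚ.- d) ℚ.+ d ℚ.* (a ℚ.- b) ∣
        ≤⟨ ℚ.∣p+q∣≤∣p∣+∣q∣ (a ℚ.* (c ℚ.- d)) (d ℚ.* (a ℚ.- b)) ⟩
      ℚ.∣ a ℚ.* (c ℚ.- d) ∣ ℚ.+ ℚ.∣ d ℚ.* (a ℚ.- b) ∣
        ≡⟨ cong₂ ℚ._+_ (ℚ.∣p*q∣≡∣p∣*∣q∣ a (c ℚ.- d)) (ℚ.∣p*q∣≡∣p∣*∣q∣ d (a ℚ.- b)) ⟩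
      ℚ.∣ a ∣ ℚ.* ℚ.∣ c ℚ.- d ∣ ℚ.+ ℚ.∣ d ∣ ℚ.* ℚ.∣ a ℚ.- b ∣
        ≤⟨ ℚ.+-mono-≤ (mono a c-d≤δ) (mono d a-b≤δ) ⟩
      ℚ.∣ a ∣ ℚ.* δ ℚ.+ ℚ.∣ d ∣ ℚ.* δ
        ≤⟨ ℚ.+-mono-≤ (ℚ.*-monoʳ-≤-nonNeg δ {{δ≥0}} a≤A) (ℚ.*-monoʳ-≤-nonNeg δ {{δ≥0}} d≤B) ⟩
      A ℚ.* δ ℚ.+ B ℚ.* δ
        ≡⟨ ℚ.*-distribʳ-+ δ A B ⟨
      (A ℚ.+ B) ℚ.* δ ∎
      where
      δ≥0 : ℚ.NonNegative δ
      δ≥0 = ℚ.pos⇒nonNeg δ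
      mono : ∀ p {q} → q ℚ.≤ δ → ℚ.∣ p ∣ ℚ.* q ℚ.≤ ℚ.∣ p ∣ ℚ.* δ
      mono p = ℚ.*-monoˡ-≤-nonNeg ℚ.∣ p ∣ {{ℚ.nonNegative (ℚ.0≤∣p∣ p)}}

    shrink : ∀ C ε → ℚ.Positive C → 0ℚ ℚ.< ε → ∃ λ δ → ℚ.Positive δ × C ℚ.* δ ≡ ε
    shrink C ε C>0 0<ε = (ℚ.1/ C) ℚ.* ε
      , ℚ.pos*pos⇒pos (ℚ.1/ C) {{ℚ.1/pos⇒pos C {{C>0}}}} ε {{ℚ.positive 0<ε}}
      , trans (sym (ℚ.*-assoc C (ℚ.1/ C) ε))
          (trans (cong (ℚ._* ε) (ℚ.*-inverseʳ C)) (ℚ.*-identityˡ ε))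
      where
      instance
        C≢0 : ℚ.NonZero C
        C≢0 = ℚ.pos⇒nonZero C {{C>0}}

    combineBounds :
      ∀ {A B K L M N ε δ} → ℚ.Positive A → ℚ.Positive δ → (A ℚ.+ B) ℚ.* δ ≡ ε →
      (∀ n → K ℕ.≤ n → ℚ.∣ seq x n ∣ ℚ.≤ A) →
      (∀ n → L ℕ.≤ n → ℚ.∣ seq y n ∣ ℚ.≤ B) →
      (∀ m n → M ℕ.≤ m → M ℕ.≤ n → ℚ.∣ seq x m ℚ.- seq x n ∣ ℚ.≤ δ) →
      (∀ m n → N ℕ.≤ m → N ℕ.≤ n → ℚ.∣ seq y m ℚ.- seq y n ∣ ℚ.≤ δ) →
      ∀ m n → (K ⊔ L) ⊔ (M ⊔ N) ℕ.≤ m → (K ⊔ L) ⊔ (M ⊔ N) ℕ.≤ n →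
      ℚ.∣ seq x m ℚ.* seq y m ℚ.- seq x n ℚ.* seq y n ∣ ℚ.≤ ε
    combineBounds {A} {B} {K} {L} {M} {N} {ε} {δ} A>0 δ>0 Cδ≡ε x≤A y≤B x-ok y-ok m n m≥ n≥ =
      ℚ.≤-trans
        (bound A B δ {{A>0}} {{δ>0}} (seq x m) (seq x n) (seq y m) (seq y n)
          (x≤A m (ℕ.m⊔n≤o⇒m≤o K L (left m≥)))
          (y≤B n (ℕ.m⊔n≤o⇒n≤o K L (left n≥)))
          (x-ok m n (ℕ.m⊔n≤o⇒m≤o M N (right m≥)) (ℕ.m⊔n≤o⇒m≤o M N (right n≥)))
          (y-ok m n (ℕ.m⊔n≤o⇒n≤o M N (right m≥)) (ℕ.m⊔n≤o⇒n≤o M N (right n≥))))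
        (ℚ.≤-reflexive Cδ≡ε)
      where
      left : ∀ {m} → (K ⊔ L) ⊔ (M ⊔ N) ℕ.≤ m → K ⊔ L ℕ.≤ m
      left = ℕ.m⊔n≤o⇒m≤o (K ⊔ L) (M ⊔ N)
      right : ∀ {m} → (K ⊔ L) ⊔ (M ⊔ N) ℕ.≤ m → M ⊔ N ℕ.≤ m
      right = ℕ.m⊔n≤o⇒n≤o (K ⊔ L) (M ⊔ N)

_+_ : ℝ → ℝ → ℝ
x + y = mkℝ (λ n → seq x n ℚ.+ seq y n) (+-cauchy x y)

_*_ : ℝ → ℝ → ℝ
x * y = mkℝ (λ n → seq x n ℚ.* seq y n) (*-cauchy x y)

-- Real polynomials in N variables, as lists of terms.  A monomial is its
-- vector of exponents; like terms need not be collected.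

Monomial : ℕ → Set
Monomial N = Vec ℕ N

Poly : ℕ → Set
Poly N = List (ℝ × Monomial N)

infixl 6 _+ₚ_ _-ₚ_
infixl 7 _*ₚ_

const : ∀ {N} → ℝ → Poly N
const c = (c , Vec.replicate _ 0) ∷ []

var : ∀ {N} → Fin N → Poly N
var i = (1ℝ , Vec.replicate _ 0 [ i ]≔ 1) ∷ []

_+ₚ_ _*ₚ_ _-ₚ_ : ∀ {N} → Poly N → Poly N → Poly N
p +ₚ q = p ++ q
p *ₚ q = cartesianProductWith (λ (c , a) (d , b) → c * d , Vec.zipWith ℕ._+_ a b) p q
p -ₚ q = p +ₚ const -1ℝ *ₚ q

sumₚ : ∀ {N n} → (Fin n → Poly N) → Poly N
sumₚ {n = n} f = foldr (λ i p → f i +ₚ p) [] (allFin n)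

∏ₚ : ∀ {N} → Subset N → (Fin N → Poly N) → Poly N
∏ₚ S f = foldr (λ i p → f i *ₚ p) (const 1ℝ) (filter (_∈? S) (allFin _))

-- A polynomial description of P = {x ∈ [0,1]^N : eqs = 0, ineqs ≥ 0}.
record PolySystem (N : ℕ) : Set₁ where
  field
    EqIx   : Set
    eqs    : EqIx → Poly N
    IneqIx : Set
    ineqs  : IneqIx → Poly N

-- Exhaustively replacing x_i² by x_i leaves exactly the variables of
-- positive exponent.
squareFree : ∀ {N} → Monomial N → Subset N
squareFree = Vec.map (0 <ᵇ_)

-- y also has coordinates at the empty set and at sets too large to occur in
-- any constraint.  Nothing depends on them, so the projection to the
-- singletons is unaffected.
monomialValue : ∀ {N} → (Subset N → ℝ) → Subset N → ℝ
monomialValue y S = if does (nonempty? S) then y S else 1ℝ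

linearise : ∀ {N} → (Subset N → ℝ) → Poly N → ℝ
linearise y = foldr (λ (c , a) r → c * monomialValue y (squareFree a) + r) 0ℝ

∏x : ∀ {N} → Subset N → Poly N
∏x I = ∏ₚ I var

∏x∏[1-x] : ∀ {N} → Subset N → Subset N → Poly N
∏x∏[1-x] I J = ∏x I *ₚ ∏ₚ (J ─ I) (λ i → const 1ℝ -ₚ var i)

-- The polyhedron in y-space; the level ℓ is meant to be positive, so that
-- ∣ I ∣ < ℓ says ∣ I ∣ ≤ ℓ - 1.
record Lift {N} (P : PolySystem N) (ℓ : ℕ) (y : Subset N → ℝ) : Set where
  open PolySystem P
  field
    equality    : ∀ I j → ∣ I ∣ ℕ.< ℓ → linearise y (∏x I *ₚ eqs j) ≈ 0ℝ
    inequality  : ∀ I J j → I ⊆ J → ∣ J ∣ ℕ.< ℓ → 0ℝ ≤ linearise y (∏x∏[1-x] I J *ₚ ineqs j)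
    nonnegative : ∀ I J → I ⊆ J → ∣ J ∣ ℕ.≤ ℓ → 0ℝ ≤ linearise y (∏x∏[1-x] I J)

SheraliAdams : ∀ {N} → PolySystem N → ℕ → (Fin N → ℝ) → Set
SheraliAdams P ℓ x = ∃ λ y → Lift P ℓ y × (∀ i → x i ≈ y ⁅ i ⁆)

record SimpleGraph (n : ℕ) : Set₁ where
  field
    Adj    : Rel (Fin n) 0ℓ
    adj?   : Decidable Adj
    symm   : Symmetric Adj
    irrefl : Irreflexive _≡_ Adj

open SimpleGraph public

Matrix : ℕ → Set
Matrix n = Fin n → Fin n → ℝ

infix 4 _≈ᴹ_

_≈ᴹ_ : ∀ {n} → Rel (Matrix n) 0ℓ
X ≈ᴹ Y = ∀ u v → X u v ≈ Y u v

𝓘 : ∀ n → Matrix n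
𝓘 n u v = if does (u Fin.≟ v) then 1ℝ else 0ℝ

data 𝒬Equation {n} (G H : SimpleGraph n) : Set where
  row col      : Fin n → 𝒬Equation G H
  edge-nonedge : ∀ u₁ u₂ v₁ v₂ → Adj G u₁ u₂ → ¬ Adj H v₁ v₂ → 𝒬Equation G H
  nonedge-edge : ∀ u₁ u₂ v₁ v₂ → ¬ Adj G u₁ u₂ → Adj H v₁ v₂ → 𝒬Equation G H

entry : ∀ {n} → Fin n → Fin n → Poly (n ℕ.* n)
entry u v = var (combine u v)

𝒬System : ∀ {n} → SimpleGraph n → SimpleGraph n → PolySystem (n ℕ.* n)
𝒬System G H = record
  { EqIx   = 𝒬Equation G H
  ; eqs    = λ where
      (row u)                        → sumₚ (λ v → entry u v) -ₚ const 1ℝ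
      (col v)                        → sumₚ (λ u → entry u v) -ₚ const 1ℝ
      (edge-nonedge u₁ u₂ v₁ v₂ _ _) → entry u₁ v₁ *ₚ entry u₂ v₂
      (nonedge-edge u₁ u₂ v₁ v₂ _ _) → entry u₁ v₁ *ₚ entry u₂ v₂
  ; IneqIx = ⊥
  ; ineqs  = λ ()
  }

𝒬⟨_⟩ : ∀ {n} → ℕ → SimpleGraph n → SimpleGraph n → Matrix n → Set
𝒬⟨_⟩ {n} ℓ G H X = SheraliAdams (𝒬System G H) ℓ (λ i → uncurry X (remQuot n i))

Tuple : ℕ → ℕ → Set
Tuple n k = Vec (Fin n) k

φ : ∀ {n k} → Fin k → Tuple n k → Fin n → Tuple n k
φ i u w = u [ i ]≔ w

𝓒 : ∀ {n k} → SimpleGraph n → Tuple n k → Vec (Vec ℤ k) k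
𝓒 G u = tabulate λ i → tabulate λ j →
  if does (lookup u i Fin.≟ lookup u j) then 0ℤ
  else if does (adj? G (lookup u i) (lookup u j)) then 1ℤ
  else -1ℤ

allTuples : ∀ n k → List (Tuple n k)
allTuples n zero    = [] ∷ []
allTuples n (suc k) = cartesianProductWith _∷_ (allFin n) (allTuples n k)

-- A partition is given by its equivalence relation.

module Automorphism {n : ℕ} (k : ℕ) (G : SimpleGraph n) where

  Partition : Set₁
  Partition = Rel (Tuple n k) 0ℓ

  initial : Partition
  initial u v = 𝓒 G u ≡ 𝓒 G v

  refine : Partition → Partition
  refine π u v = π u v ×
    ∃ λ (ψ : Fin n ⤖ Fin n) → ∀ i w → π (φ i u w) (φ i v (Bijection.to ψ w))

  iterate : ℕ → Partition
  iterate zero    = initial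
  iterate (suc t) = refine (iterate t)

  Stable : Partition → Set
  Stable π = ∀ u v → π u v ⇔ refine π u v

  Complete : Partition → Set
  Complete π = ∀ u v → π u v → u ≡ v

-- Once an iterate is stable, all later ones define the same partition, so the
-- final partition does not depend on the choice of t.
WLDeterminesAsymmetric : ∀ {n} → ℕ → SimpleGraph n → Set
WLDeterminesAsymmetric k G = ∃ λ t → Stable (iterate t) × Complete (iterate t)
  where open Automorphism k G

-- π u is the number [u] of the cell of u, cells being numbered from 1.
OrderedPartition : ℕ → ℕ → Set
OrderedPartition n k = Tuple n k → ℕ

-- The level sets of D in increasing order of the value of D: the cell number
-- of u is the number of distinct values of D that are at most D u.
levelSets : ∀ {a ℓ₁ ℓ₂ n k} (O : DecTotalOrder a ℓ₁ ℓ₂) →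
            (Tuple n k → DecTotalOrder.Carrier O) → OrderedPartition n k
levelSets {n = n} {k} O D u =
  length (filter (O._≤? D u) (deduplicate O._≟_ (map D (allTuples n k))))
  where module O = DecTotalOrder O

-- Lexicographic, row by row, with -1 < 0 < 1.
𝓒-order : ℕ → DecTotalOrder _ _ _
𝓒-order k = VecLex.≤-decTotalOrder (VecLex.≤-decTotalOrder ℤ.≤-decTotalOrder k) k

ω-order : ℕ → DecTotalOrder _ _ _
ω-order k = VecLex.≤-decTotalOrder ℕ.≤-decTotalOrder k

D-order : ℕ → DecTotalOrder _ _ _
D-order k = ProductLex.×-decTotalOrder ℕ.≤-decTotalOrder (ListLex.≤-decTotalOrder (ω-order k))

module _ {n k : ℕ} (π : OrderedPartition n k) where

  ωAt : Tuple n k → Fin n → Vec ℕ k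
  ωAt u w = tabulate λ i → π (φ i u w)

  ω : Tuple n k → List (Vec ℕ k)
  ω u = sort (map (ωAt u) (allFin n))
    where open Data.List.Sort (ω-order k)

  D : Tuple n k → ℕ × List (Vec ℕ k)
  D u = π u , ω u

module Isomorphism {n : ℕ} (k : ℕ) where

  initial : SimpleGraph n → OrderedPartition n k
  initial G = levelSets (𝓒-order k) (𝓒 G)

  refine : OrderedPartition n k → OrderedPartition n k
  refine π = levelSets (D-order k) (D π)

  iterate : SimpleGraph n → ℕ → OrderedPartition n k
  iterate G zero    = initial G
  iterate G (suc t) = refine (iterate G t)

  Stable : OrderedPartition n k → Set
  Stable π = refine π ≗ π

  InitialMatch : SimpleGraph n → SimpleGraph n → Set
  InitialMatch G H = ∃ λ (γ₀ : Tuple n k ⤖ Tuple n k) →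
    ∀ u → 𝓒 G u ≡ 𝓒 H (Bijection.to γ₀ u)

  FinalMatch : OrderedPartition n k → OrderedPartition n k → Set
  FinalMatch π τ = ∃ λ (γ : Tuple n k ⤖ Tuple n k) →
    ∀ u → D π u ≡ D τ (Bijection.to γ u)

-- As before, the stable iterates π* and τ* do not depend on s and t.
WLDeterminesNonIsomorphic : ∀ {n} → ℕ → SimpleGraph n → SimpleGraph n → Set
WLDeterminesNonIsomorphic k G H = ∃₂ λ s t →
  Stable (iterate G s) × Stable (iterate H t) ×
  ¬ (InitialMatch G H × FinalMatch (iterate G s) (iterate H t))
  where open Isomorphism k

{-# OPTIONS --safe #-}
module Submission where

-- Let y be a point of the lifted relaxation.  For tuples u, v ∈ Vᵏ let Y(u, v) be
-- the value of y at the set of all pairs (uᵢ, vᵢ).  The row and column equations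
-- make Y doubly stochastic.  If a matrix with constant line sums s vanishes
-- where the colours of its row and its column differ, then either s = 0 or every
-- colour occurs as often among the rows as among the columns.  Applied to the
-- values of y at the extensions of u, v by one more pair, this shows round by
-- round that Y vanishes where the W-L colours of u and v differ; applied to Y
-- itself, it yields the bijections that the algorithm looks for.
--
-- Conversely, let the stable colours of G and H match, and call a partial map S
-- consistent if it preserves the colours of tuples.  Put y_S = 1 / N(S) for
-- consistent S and y_S = 0 otherwise, where N(S) counts the consistent maps with
-- the domain of S.  Stability says that a consistent map S of size at most k has
-- a bijection ψ with all S ∪ {(w, ψ w)} consistent, so N(S ∪ {(u, v)}) is N(S)
-- times the number of consistent choices for the image of u, which gives the row
-- and column equations.  The remaining inequalities follow from y ≥ 0 since a row
-- equation turns 1 - x_{uv} into a sum of variables.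

open import Defs
open import Algebra.Bundles using (CommutativeMonoid)
import Algebra.Properties.CommutativeSemigroup
open import Data.Bool.Base using (Bool; true; false; if_then_else_)
import Data.Bool.Properties as Bool
open import Data.Fin.Base as Fin using (Fin; zero; suc; combine; remQuot; punchIn; punchOut)
import Data.Fin.Properties as Fin
open import Data.Fin.Subset using (Subset; _∈_; _⊆_; _∪_; _─_; ⁅_⁆; ∣_∣) renaming (⊥ to ⊥ₛ)
open import Data.Fin.Subset.Properties
  using (_∈?_; nonempty?; Empty-unique; ∉⊥; ∣⊥∣≡0; drop-∷-⊆; x∈⁅x⁆; x∈⁅y⁆⇒x≡y; ⊆-antisym; x∈p∪q⁻;
         p⊆p∪q; q⊆p∪q; ∪-assoc; ∪-comm; ∪-idem; ∪-identityˡ; ∪-identityʳ)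
open import Data.Integer.Base using (ℤ; 0ℤ; 1ℤ; -1ℤ)
import Data.Integer.Properties as ℤ
open import Data.List.Base as List
  using (List; []; _∷_; _++_; map; foldr; filter; length; deduplicate; allFin; cartesianProduct; cartesianProductWith)
open import Data.List.Membership.Propositional using (find; lose) renaming (_∈_ to _∈ˡ_; _∉_ to _∉ˡ_)
open import Data.List.Membership.Propositional.Properties
  using (map-∈↔; ∈-∃++; ∈-allFin; ∈-cartesianProduct⁺; ∈-cartesianProductWith⁺; ∈-map⁺; ∈-map⁻;
         ∈-filter⁺; ∈-filter⁻; ∈-deduplicate⁺; ∈-deduplicate⁻)
open import Data.List.Membership.Propositional.Properties.WithK using (unique⇒irrelevant; unique∧set⇒bag)
open import Data.List.Properties as List using (map-∘; map-cong; length-map; filter-≐)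
open import Data.List.Relation.Binary.BagAndSetEquality using (∼bag⇒↭; ↭⇒∼bag)
open import Data.List.Relation.Binary.Permutation.Propositional
  using (_↭_; ↭⇒↭ₛ′; ↭-refl; ↭-sym; ↭-trans; ↭-prep; prep; swap; ↭-reflexive)
open import Data.List.Relation.Binary.Permutation.Propositional.Properties using (shift; map⁺)
import Data.List.Relation.Binary.Pointwise as ListPointwise
open import Data.List.Relation.Unary.All as All using (All; []; _∷_)
open import Data.List.Relation.Unary.Any using (Any; here; there; any?)
open import Data.List.Relation.Unary.Sorted.TotalOrder.Properties using (↗↭↗⇒≋)
import Data.List.Relation.Unary.Unique.DecPropositional.Properties as DecUnique
open import Data.List.Relation.Unary.Unique.Propositional using (Unique; []; _∷_)
import Data.List.Relation.Unary.Unique.Propositional.Properties as Unique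
import Data.List.Sort
open import Data.Nat.Base as ℕ using (ℕ; zero; suc; _<_; _⊔_; z≤n; s≤s)
open import Data.Nat.Induction using (<-wellFounded)
import Data.Nat.Properties as ℕ
open import Data.Product.Base using (∃; ∃₂; _×_; _,_; proj₁; proj₂; uncurry)
import Data.Product.Properties as Product
open import Data.Rational.Base as ℚ using (ℚ; 0ℚ; 1ℚ; ½)
import Data.Rational.Properties as ℚ
open import Data.Rational.Solver using (module +-*-Solver)
open import Data.Sum.Base as Sum using (_⊎_; inj₁; inj₂; map₁; map₂; [_,_]′)
open import Data.Vec.Base as Vec using (Vec; []; _∷_; lookup; tabulate; replicate; head; _[_]≔_)
import Data.Vec.Properties as Vec
import Data.Vec.Relation.Binary.Pointwise.Inductive as VecPointwise
open import Function.Base using (_∘_; id)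
open import Function.Bundles
  using (_↔_; _⇔_; mk⇔; mk↔ₛ′; module Inverse; module Equivalence)
open import Function.Construct.Composition using (_↔-∘_)
open import Function.Construct.Identity using (↔-id)
open import Function.Properties.Bijection using (⤖⇒↔)
open import Function.Properties.Inverse using (↔⇒⤖; ↔-sym)
open import Induction.WellFounded using (Acc; acc)
open import Level using (Level; 0ℓ)
open import Relation.Binary.Bundles using (DecTotalOrder)
open import Relation.Binary.Core using (Rel)
open import Relation.Binary.Definitions using (DecidableEquality; tri<; tri≈; tri>)
open import Relation.Binary.PropositionalEquality
  using (_≡_; _≢_; _≗_; refl; sym; trans; cong; cong₂; subst; subst₂; module ≡-Reasoning)
open import Relation.Nullary using (¬_; Dec; yes; no; does; contradiction)
open import Relation.Nullary.Decidable using (dec-true; dec-false; ¬?; decidable-stable; _×-dec_; _→-dec_; map′)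
open import Relation.Unary using (Decidable)

-- The isomorphism version numbers the cells of `G` and of `H` separately, so numbers can be
-- compared across the graphs only if the same values occur in both. From a point of the relaxation
-- this follows in each round because no line of `Y` can vanish entirely (`excludes`). From a final
-- match, agreement is known in the last round only; since every refinement respects the order of
-- the cells, a count of sublevel sets forces the initial cells to agree too (`coarse-≤`). The level
-- exceeds the dimension by one because a round looks at a tuple together with one further vertex.
-- Weights on k + 1 pairs make sense although only k-tuples have colours: a map is tested on all
-- k-tuples inside it, and extensions pass from tuples to maps because the matching of colours is
-- invariant under substitution of positions (`∼-[]`). Equality of reals is undecidable, so case
-- distinctions are made on colours, and the constructed point is rational.

private
  variable
    a b ℓ : Level
    A B C I J : Set a

-- Finite sums and enumerations

module Summation {c ℓ} (M : CommutativeMonoid c ℓ) where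

  open CommutativeMonoid M renaming (refl to ≈-refl; sym to ≈-sym; trans to ≈-trans; _≈_ to _≈′_)
  open Algebra.Properties.CommutativeSemigroup commutativeSemigroup using (interchange)
  open import Relation.Binary.Reasoning.Setoid setoid

  ∑ : List I → (I → Carrier) → Carrier
  ∑ xs f = foldr (λ i s → f i ∙ s) ε xs

  ∑-cong : ∀ (xs : List I) {f g : I → Carrier} → (∀ i → f i ≈′ g i) → ∑ xs f ≈′ ∑ xs g
  ∑-cong []       f≈g = ≈-refl
  ∑-cong (x ∷ xs) f≈g = ∙-cong (f≈g x) (∑-cong xs f≈g)

  ∑-ε : ∀ (xs : List I) {f : I → Carrier} → (∀ i → f i ≈′ ε) → ∑ xs f ≈′ ε
  ∑-ε []       f≈ε = ≈-refl
  ∑-ε (x ∷ xs) f≈ε = ≈-trans (∙-cong (f≈ε x) (∑-ε xs f≈ε)) (identityˡ ε)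

  ∑-∙ : ∀ (xs : List I) (f g : I → Carrier) → ∑ xs (λ i → f i ∙ g i) ≈′ ∑ xs f ∙ ∑ xs g
  ∑-∙ []       f g = ≈-sym (identityˡ ε)
  ∑-∙ (x ∷ xs) f g = ≈-trans (∙-congˡ (∑-∙ xs f g)) (interchange (f x) (g x) (∑ xs f) (∑ xs g))

  ∑-swap : ∀ (xs : List I) (ys : List J) (f : I → J → Carrier) →
           ∑ xs (λ i → ∑ ys (f i)) ≈′ ∑ ys (λ j → ∑ xs (λ i → f i j))
  ∑-swap []       ys f = ≈-sym (∑-ε ys λ _ → ≈-refl)
  ∑-swap (x ∷ xs) ys f = ≈-trans (∙-congˡ (∑-swap xs ys f))
    (≈-sym (∑-∙ ys (f x) λ j → ∑ xs (λ i → f i j)))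

  ∑-++ : ∀ (xs ys : List I) (f : I → Carrier) → ∑ (xs ++ ys) f ≈′ ∑ xs f ∙ ∑ ys f
  ∑-++ []       ys f = ≈-sym (identityˡ _)
  ∑-++ (x ∷ xs) ys f = ≈-trans (∙-congˡ (∑-++ xs ys f)) (≈-sym (assoc _ _ _))

  ∑-map : ∀ (g : I → J) (xs : List I) (f : J → Carrier) → ∑ (map g xs) f ≈′ ∑ xs (f ∘ g)
  ∑-map g []       f = ≈-refl
  ∑-map g (x ∷ xs) f = ∙-congˡ (∑-map g xs f)

  ∑-cartesianProductWith : ∀ {K : Set a} (h : I → J → K) (xs : List I) (ys : List J) (f : K → Carrier) →
    ∑ (cartesianProductWith h xs ys) f ≈′ ∑ xs (λ i → ∑ ys (λ j → f (h i j)))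
  ∑-cartesianProductWith h []       ys f = ≈-refl
  ∑-cartesianProductWith h (x ∷ xs) ys f = ≈-trans
    (∑-++ (map (h x) ys) (cartesianProductWith h xs ys) f)
    (∙-cong (∑-map (h x) ys f) (∑-cartesianProductWith h xs ys f))

  ∑-↭ : ∀ {xs ys : List I} → xs ↭ ys → ∀ (f : I → Carrier) → ∑ xs f ≈′ ∑ ys f
  ∑-↭ _↭_.refl              f = ≈-refl
  ∑-↭ (prep x p)            f = ∙-congˡ (∑-↭ p f)
  ∑-↭ (swap {xs} {ys} x y p) f = begin
    f x ∙ (f y ∙ ∑ xs f)  ≈⟨ assoc _ _ _ ⟨
    (f x ∙ f y) ∙ ∑ xs f  ≈⟨ ∙-cong (comm _ _) (∑-↭ p f) ⟩
    (f y ∙ f x) ∙ ∑ ys f  ≈⟨ assoc _ _ _ ⟩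
    f y ∙ (f x ∙ ∑ ys f)  ∎
  ∑-↭ (_↭_.trans p q)       f = ≈-trans (∑-↭ p f) (∑-↭ q f)

module ∑ℕ = Summation ℕ.+-0-commutativeMonoid
open ∑ℕ using () renaming (∑ to ∑ⁿ) public

record Enumeration (A : Set a) : Set a where
  field
    elements : List A
    unique   : Unique elements
    complete : ∀ x → x ∈ˡ elements

open Enumeration public

fins : ∀ n → Enumeration (Fin n)
fins n = record { elements = allFin n ; unique = Unique.allFin⁺ n ; complete = ∈-allFin }

vectors : Enumeration A → ∀ k → Enumeration (Vec A k)
vectors E zero    = record
  { elements = [] ∷ [] ; unique = [] ∷ [] ; complete = λ { [] → here refl } }
vectors E (suc k) = record
  { elements = cartesianProductWith _∷_ (elements E) (elements (vectors E k))
  ; unique   = Unique.cartesianProductWith⁺ _∷_ Vec.∷-injective (unique E) (unique (vectors E k))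
  ; complete = λ { (x ∷ xs) → ∈-cartesianProductWith⁺ _∷_ (complete E x) (complete (vectors E k) xs) }
  }

allTuples≡vectors : ∀ n k → allTuples n k ≡ elements (vectors (fins n) k)
allTuples≡vectors n zero    = refl
allTuples≡vectors n (suc k) = cong (cartesianProductWith _∷_ (allFin n)) (allTuples≡vectors n k)

tuples : ∀ n k → Enumeration (Tuple n k)
tuples n k = record
  { elements = allTuples n k
  ; unique   = subst Unique (sym (allTuples≡vectors n k)) (unique (vectors (fins n) k))
  ; complete = λ x → subst (x ∈ˡ_) (sym (allTuples≡vectors n k)) (complete (vectors (fins n) k) x)
  }

bools : Enumeration Bool
bools = record
  { elements = true ∷ false ∷ []
  ; unique   = ((λ ()) ∷ []) ∷ [] ∷ []
  ; complete = λ { true → here refl ; false → there (here refl) }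
  }

bijection⇒↭ : (E : Enumeration A) (σ : A ↔ A) → map (Inverse.to σ) (elements E) ↭ elements E
bijection⇒↭ E σ = ∼bag⇒↭ (unique∧set⇒bag
  (Unique.map⁺ (λ {x} {y} eq → trans (sym (strictlyInverseʳ x)) (trans (cong from eq) (strictlyInverseʳ y))) (unique E))
  (unique E)
  (mk⇔ (λ _ → complete E _)
       (λ _ → subst (_∈ˡ map to (elements E)) (strictlyInverseˡ _) (∈-map⁺ to (complete E (from _))))))
  where open Inverse σ

bijection⇒map-↭ : (E : Enumeration A) (σ : A ↔ A) {f g : A → C} →
  (∀ x → f x ≡ g (Inverse.to σ x)) → map f (elements E) ↭ map g (elements E)
bijection⇒map-↭ E σ {f} {g} eq = ↭-trans
  (↭-reflexive (trans (map-cong eq (elements E)) (map-∘ (elements E))))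
  (map⁺ g (bijection⇒↭ E σ))

-- A permutation of lists is, value by value, a bijection between the occurrences of that value. The
-- enumeration has no repetitions, so the occurrences of `c` in `map f` are exactly the `x` with
-- `f x ≡ c`, and the bijections between fibres glue to one of `A`.
map-↭⇒bijection : (E : Enumeration A) {f g : A → C} →
  map f (elements E) ↭ map g (elements E) →
  ∃ λ (σ : A ↔ A) → ∀ x → f x ≡ g (Inverse.to σ x)
map-↭⇒bijection {A = A} {C = C} E {f} {g} p =
  mk↔ₛ′ (λ x → proj₁ (image x)) (λ y → proj₁ (preimage y))
    (λ y → let x , x∈ , gy≡fx = preimage y in
       trans (image-unique (g y) gy≡fx x∈) (cong proj₁ (strictlyInverseˡ (fibre (g y)) (y , complete E y , refl))))
    (λ x → let y , y∈ , fx≡gy = image x in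
       trans (preimage-unique (f x) fx≡gy y∈) (cong proj₁ (strictlyInverseʳ (fibre (f x)) (x , complete E x , refl))))
  , λ x → proj₂ (proj₂ (image x))
  where
  open Inverse
  Fibre : (A → C) → C → Set _
  Fibre h c = ∃ λ x → x ∈ˡ elements E × c ≡ h x

  fibre : ∀ c → Fibre f c ↔ Fibre g c
  fibre c = mk↔ₛ′
    (from G ∘ to bag ∘ to F)
    (from F ∘ from bag ∘ to G)
    (λ y → trans (cong (from G ∘ to bag) (strictlyInverseˡ F _))
      (trans (cong (from G) (strictlyInverseˡ bag _)) (strictlyInverseʳ G y)))
    (λ x → trans (cong (from F ∘ from bag) (strictlyInverseˡ G _))
      (trans (cong (from F) (strictlyInverseʳ bag _)) (strictlyInverseʳ F x)))
    where
    F : Fibre f c ↔ (c ∈ˡ map f (elements E))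
    F = map-∈↔ f
    G : Fibre g c ↔ (c ∈ˡ map g (elements E))
    G = map-∈↔ g
    bag : (c ∈ˡ map f (elements E)) ↔ (c ∈ˡ map g (elements E))
    bag = ↭⇒∼bag p

  image : ∀ x → Fibre g (f x)
  image x = to (fibre (f x)) (x , complete E x , refl)

  preimage : ∀ y → Fibre f (g y)
  preimage y = from (fibre (g y)) (y , complete E y , refl)

  image-unique : ∀ {x} c (eq : c ≡ f x) (x∈ : x ∈ˡ elements E) →
    proj₁ (image x) ≡ proj₁ (to (fibre c) (x , x∈ , eq))
  image-unique {x} .(f x) refl x∈ =
    cong (λ x∈ → proj₁ (to (fibre (f x)) (x , x∈ , refl))) (unique⇒irrelevant (unique E) _ _)

  preimage-unique : ∀ {y} c (eq : c ≡ g y) (y∈ : y ∈ˡ elements E) →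
    proj₁ (preimage y) ≡ proj₁ (from (fibre c) (y , y∈ , eq))
  preimage-unique {y} .(g y) refl y∈ =
    cong (λ y∈ → proj₁ (from (fibre (g y)) (y , y∈ , refl))) (unique⇒irrelevant (unique E) _ _)

ι : {P : Set ℓ} → Dec P → ℕ
ι P? = if does P? then 1 else 0

ι-cong : {P : Set a} {Q : Set b} (P? : Dec P) (Q? : Dec Q) → (P → Q) → (Q → P) → ι P? ≡ ι Q?
ι-cong (yes p) (yes q) _   _   = refl
ι-cong (yes p) (no ¬q) P⇒Q _   = contradiction (P⇒Q p) ¬q
ι-cong (no ¬p) (yes q) _   Q⇒P = contradiction (Q⇒P q) ¬p
ι-cong (no ¬p) (no ¬q) _   _   = refl

ι-mono : {P : Set a} {Q : Set b} (P? : Dec P) (Q? : Dec Q) → (P → Q) → ι P? ℕ.≤ ι Q?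
ι-mono (yes p) (yes q) _   = ℕ.≤-refl
ι-mono (yes p) (no ¬q) P⇒Q = contradiction (P⇒Q p) ¬q
ι-mono (no ¬p) Q?      _   = z≤n

ι-yes : {P : Set a} (P? : Dec P) → P → ι P? ≡ 1
ι-yes P? p = cong (λ b → if b then 1 else 0) (dec-true P? p)

ι-no : {P : Set a} (P? : Dec P) → ¬ P → ι P? ≡ 0
ι-no P? ¬p = cong (λ b → if b then 1 else 0) (dec-false P? ¬p)

∑ⁿ-mono : ∀ (xs : List I) {f g : I → ℕ} → (∀ i → f i ℕ.≤ g i) → ∑ⁿ xs f ℕ.≤ ∑ⁿ xs g
∑ⁿ-mono []       f≤g = z≤n
∑ⁿ-mono (x ∷ xs) f≤g = ℕ.+-mono-≤ (f≤g x) (∑ⁿ-mono xs f≤g)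

∑ⁿ-mono-< : ∀ (xs : List I) {f g : I → ℕ} → (∀ i → f i ℕ.≤ g i) →
            ∀ {x} → x ∈ˡ xs → f x ℕ.< g x → ∑ⁿ xs f ℕ.< ∑ⁿ xs g
∑ⁿ-mono-< (x ∷ xs) f≤g (here refl) f<g = ℕ.+-mono-<-≤ f<g (∑ⁿ-mono xs f≤g)
∑ⁿ-mono-< (x ∷ xs) f≤g (there x∈)  f<g = ℕ.+-mono-≤-< (f≤g x) (∑ⁿ-mono-< xs f≤g x∈ f<g)

≤-∑ⁿ : ∀ {xs : List I} (f : I → ℕ) {x} → x ∈ˡ xs → f x ℕ.≤ ∑ⁿ xs f
≤-∑ⁿ {xs = x ∷ xs} f (here refl) = ℕ.m≤m+n (f x) _
≤-∑ⁿ {xs = x ∷ xs} f (there x∈)  = ℕ.≤-trans (≤-∑ⁿ f x∈) (ℕ.m≤n+m _ (f x))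

∑ⁿ-*ʳ : ∀ (xs : List I) (f : I → ℕ) m → ∑ⁿ xs (λ i → f i ℕ.* m) ≡ ∑ⁿ xs f ℕ.* m
∑ⁿ-*ʳ []       f m = refl
∑ⁿ-*ʳ (x ∷ xs) f m = trans (cong (f x ℕ.* m ℕ.+_) (∑ⁿ-*ʳ xs f m)) (sym (ℕ.*-distribʳ-+ m (f x) _))

module _ (E : Enumeration A) {P : A → Set ℓ} (P? : Decidable P) where

  # : ℕ
  # = ∑ⁿ (elements E) (ι ∘ P?)

  #-unique : ∀ {x} → P x → (∀ {y} → P y → y ≡ x) → # ≡ 1
  #-unique {x} px uniq = go (unique E) (complete E x)
    where
    none : ∀ {xs} → All (x ≢_) xs → ∑ⁿ xs (ι ∘ P?) ≡ 0
    none []          = refl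
    none (x≢ ∷ x∉xs) = cong₂ ℕ._+_ (ι-no (P? _) (x≢ ∘ sym ∘ uniq)) (none x∉xs)

    go : ∀ {xs} → Unique xs → x ∈ˡ xs → ∑ⁿ xs (ι ∘ P?) ≡ 1
    go (x∉ ∷ xs!) (here refl) = cong₂ ℕ._+_ (ι-yes (P? _) px) (none x∉)
    go (y∉ ∷ xs!) (there x∈)  = cong₂ ℕ._+_
      (ι-no (P? _) λ py → All.lookup y∉ x∈ (uniq py)) (go xs! x∈)

  #-none : (∀ {y} → ¬ P y) → # ≡ 0
  #-none ¬p = ∑ℕ.∑-ε (elements E) λ i → ι-no (P? i) ¬p

  #-positive : ∀ {x} → P x → 0 ℕ.< #
  #-positive {x} px = ℕ.≤-trans (ℕ.≤-reflexive (sym (ι-yes (P? x) px))) (≤-∑ⁿ (ι ∘ P?) (complete E x))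

∑ⁿ-reindex : (E : Enumeration A) (σ : A ↔ A) (f : A → ℕ) →
             ∑ⁿ (elements E) f ≡ ∑ⁿ (elements E) (f ∘ Inverse.to σ)
∑ⁿ-reindex E σ f = trans (sym (∑ℕ.∑-↭ (bijection⇒↭ E σ) f)) (∑ℕ.∑-map (Inverse.to σ) (elements E) f)

module Counting {C : Set} (_≟_ : DecidableEquality C) where

  count : C → List C → ℕ
  count c xs = ∑ⁿ xs λ x → ι (c ≟ x)

  -- A dichotomy with a witness, because `≈0⊎↭` needs the colour `c` itself: its two unequal
  -- multiplicities force the common line sum to vanish.
  ↭⊎count≢ : ∀ xs ys → xs ↭ ys ⊎ ∃ λ c → count c xs ≢ count c ys
  ↭⊎count≢ []       []       = inj₁ ↭-refl
  ↭⊎count≢ []       (y ∷ ys) = inj₂ (y , λ eq →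
    ℕ.0≢1+n (trans eq (cong (ℕ._+ count y ys) (ι-yes (y ≟ y) refl))))
  ↭⊎count≢ (x ∷ xs) ys with x ∈ˡ? ys
    where open import Data.List.Membership.DecPropositional _≟_ using () renaming (_∈?_ to _∈ˡ?_)
  ... | no x∉ys = inj₂ (x , λ eq →
    ℕ.1+n≢0 (trans (sym (cong (ℕ._+ count x xs) (ι-yes (x ≟ x) refl))) (trans eq (absent ys x∉ys))))
    where
    absent : ∀ ys → x ∉ˡ ys → count x ys ≡ 0
    absent []       _    = refl
    absent (y ∷ ys) x∉ys = cong₂ ℕ._+_ (ι-no (x ≟ y) (x∉ys ∘ here)) (absent ys (x∉ys ∘ there))
  ... | yes x∈ys with ∈-∃++ x∈ys
  ...   | ys₁ , ys₂ , refl with ↭⊎count≢ xs (ys₁ ++ ys₂)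
  ...     | inj₁ p          = inj₁ (↭-trans (↭-prep x p) (↭-sym (shift x ys₁ ys₂)))
  ...     | inj₂ (c , c≢)   = inj₂ (c , λ eq →
    c≢ (ℕ.+-cancelˡ-≡ (ι (c ≟ x)) _ _ (trans eq (∑ℕ.∑-↭ (shift x ys₁ ys₂) _))))

-- Level sets of functions into an ordered set

length-filter≡∑ : {P : A → Set ℓ} (P? : Decidable P) (xs : List A) →
                  length (filter P? xs) ≡ ∑ⁿ xs (ι ∘ P?)
length-filter≡∑ P? []       = refl
length-filter≡∑ P? (x ∷ xs) with does (P? x)
... | true  = cong suc (length-filter≡∑ P? xs)
... | false = length-filter≡∑ P? xs

filter-map : {P : B → Set ℓ} (P? : Decidable P) (f : A → B) (xs : List A) →
             filter P? (map f xs) ≡ map f (filter (P? ∘ f) xs)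
filter-map P? f []       = refl
filter-map P? f (x ∷ xs) with does (P? (f x))
... | true  = cong (f x ∷_) (filter-map P? f xs)
... | false = filter-map P? f xs

deduplicate-map : {R : B → B → Set ℓ} (R? : ∀ x y → Dec (R x y)) (f : A → B) (xs : List A) →
                  deduplicate R? (map f xs) ≡ map f (deduplicate (λ x y → R? (f x) (f y)) xs)
deduplicate-map R? f []       = refl
deduplicate-map R? f (x ∷ xs) = cong (f x ∷_)
  (trans (cong (filter (¬? ∘ R? (f x))) (deduplicate-map R? f xs))
         (filter-map (¬? ∘ R? (f x)) f (deduplicate (λ x y → R? (f x) (f y)) xs)))

deduplicate-cong : {R : A → A → Set a} {S : A → A → Set b} (R? : ∀ x y → Dec (R x y)) (S? : ∀ x y → Dec (S x y)) →
                   (∀ {x y} → R x y → S x y) → (∀ {x y} → S x y → R x y) →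
                   ∀ xs → deduplicate R? xs ≡ deduplicate S? xs
deduplicate-cong R? S? R⇒S S⇒R []       = refl
deduplicate-cong R? S? R⇒S S⇒R (x ∷ xs) = cong (x ∷_)
  (trans (cong (filter (¬? ∘ R? x)) (deduplicate-cong R? S? R⇒S S⇒R xs))
         (filter-≐ (¬? ∘ R? x) (¬? ∘ S? x) ((_∘ S⇒R) , (_∘ R⇒S)) (deduplicate S? xs)))

module Ranking {a ℓ₁ ℓ₂} (O : DecTotalOrder a ℓ₁ ℓ₂)
  (≈⇒≡ : ∀ {x y} → DecTotalOrder._≈_ O x y → x ≡ y) {n k : ℕ} where

  open DecTotalOrder O using () renaming
    (Carrier to X; _≈_ to _≈ₒ_; _≤_ to _≤ₒ_; _≤?_ to _≤ₒ?_; _≟_ to _≟ₒ_;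
     refl to ≤ₒ-refl; trans to ≤ₒ-trans; total to ≤ₒ-total; antisym to ≤ₒ-antisym)

  _≟_ : DecidableEquality X
  x ≟ y = map′ ≈⇒≡ (DecTotalOrder.Eq.reflexive O) (x ≟ₒ y)

  values : (Tuple n k → X) → List X
  values d = deduplicate _≟_ (map d (allTuples n k))

  values-unique : ∀ d → Unique (values d)
  values-unique d = DecUnique.deduplicate-! _≟_ (map d (allTuples n k))

  ∈-values⁺ : ∀ d u → d u ∈ˡ values d
  ∈-values⁺ d u = ∈-deduplicate⁺ _≟_ (∈-map⁺ d (complete (tuples n k) u))

  ∈-values⁻ : ∀ d {x} → x ∈ˡ values d → ∃ λ u → x ≡ d u
  ∈-values⁻ d x∈ = let u , _ , eq = ∈-map⁻ d (∈-deduplicate⁻ _≟_ (map d (allTuples n k)) x∈) in u , eq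

  levelSets≡∑ : ∀ d u → levelSets O d u ≡ ∑ⁿ (values d) (λ x → ι (x ≤ₒ? d u))
  levelSets≡∑ d u = trans
    (cong (length ∘ filter (_≤ₒ? d u))
      (deduplicate-cong _≟ₒ_ _≟_ ≈⇒≡ (DecTotalOrder.Eq.reflexive O) (map d (allTuples n k))))
    (length-filter≡∑ (_≤ₒ? d u) (values d))

  levelSets-mono : ∀ d {u v} → d u ≤ₒ d v → levelSets O d u ℕ.≤ levelSets O d v
  levelSets-mono d {u} {v} du≤dv =
    subst₂ ℕ._≤_ (sym (levelSets≡∑ d u)) (sym (levelSets≡∑ d v))
      (∑ⁿ-mono (values d) λ x → ι-mono (x ≤ₒ? d u) (x ≤ₒ? d v) λ x≤ → ≤ₒ-trans x≤ du≤dv)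

  levelSets-cancel : ∀ d {u v} → levelSets O d u ℕ.≤ levelSets O d v → d u ≤ₒ d v
  levelSets-cancel d {u} {v} ru≤rv with ≤ₒ-total (d u) (d v)
  ... | inj₁ du≤dv = du≤dv
  ... | inj₂ dv≤du with d u ≤ₒ? d v
  ...   | yes du≤dv = du≤dv
  ...   | no  du≰dv = contradiction
    (subst₂ ℕ._<_ (sym (levelSets≡∑ d v)) (sym (levelSets≡∑ d u))
      (∑ⁿ-mono-< (values d)
        (λ x → ι-mono (x ≤ₒ? d v) (x ≤ₒ? d u) λ x≤ → ≤ₒ-trans x≤ dv≤du)
        (∈-values⁺ d u)
        (subst₂ ℕ._<_ (sym (ι-no (d u ≤ₒ? d v) du≰dv)) (sym (ι-yes (d u ≤ₒ? d u) ≤ₒ-refl)) (s≤s z≤n))))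
    (ℕ.≤⇒≯ ru≤rv)

  levelSets-injective : ∀ d {u v} → levelSets O d u ≡ levelSets O d v → d u ≡ d v
  levelSets-injective d eq = ≈⇒≡ (≤ₒ-antisym
    (levelSets-cancel d (ℕ.≤-reflexive eq)) (levelSets-cancel d (ℕ.≤-reflexive (sym eq))))

  levelSets-≡ : ∀ d {u v} → d u ≡ d v → levelSets O d u ≡ levelSets O d v
  levelSets-≡ d eq = cong (λ x → length (filter (_≤ₒ? x) (deduplicate _≟ₒ_ (map d (allTuples n k))))) eq

  -- A rank counts the values below a given one, so it is determined by that value and the set of
  -- all values. The hypotheses only deny that a value has no partner, which suffices since
  -- membership in a list of values is decidable.
  levelSets-sameValues : ∀ d d′ → (∀ u → ¬ ∀ v → d u ≢ d′ v) → (∀ v → ¬ ∀ u → d u ≢ d′ v) →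
                         ∀ {u v} → d u ≡ d′ v → levelSets O d u ≡ levelSets O d′ v
  levelSets-sameValues d d′ d⊆d′ d′⊆d {u} {v} du≡d′v = begin
    levelSets O d u                           ≡⟨ levelSets≡∑ d u ⟩
    ∑ⁿ (values d) (λ x → ι (x ≤ₒ? d u))       ≡⟨ ∑ℕ.∑-↭ values-↭ _ ⟩
    ∑ⁿ (values d′) (λ x → ι (x ≤ₒ? d u))      ≡⟨ cong (λ y → ∑ⁿ (values d′) (λ x → ι (x ≤ₒ? y))) du≡d′v ⟩
    ∑ⁿ (values d′) (λ x → ι (x ≤ₒ? d′ v))     ≡⟨ levelSets≡∑ d′ v ⟨
    levelSets O d′ v                          ∎
    where
    open ≡-Reasoning
    open import Data.List.Membership.DecPropositional _≟_ using () renaming (_∈?_ to _∈ˡ?_)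
    ⊆ : ∀ d d′ → (∀ u → ¬ ∀ v → d u ≢ d′ v) → ∀ {x} → x ∈ˡ values d → x ∈ˡ values d′
    ⊆ d d′ d⊆d′ x∈ with ∈-values⁻ d x∈
    ... | u , refl with d u ∈ˡ? values d′
    ...   | yes p = p
    ...   | no ¬p = contradiction (λ v eq → ¬p (subst (_∈ˡ values d′) (sym eq) (∈-values⁺ d′ v))) (d⊆d′ u)

    values-↭ : values d ↭ values d′
    values-↭ = ∼bag⇒↭ (unique∧set⇒bag (values-unique d) (values-unique d′)
      (mk⇔ (⊆ d d′ d⊆d′) (⊆ d′ d λ v ¬eq → d′⊆d v λ u eq → ¬eq u (sym eq))))

module _ {a ℓ₁ ℓ₂ a′ ℓ₁′ ℓ₂′} (O : DecTotalOrder a ℓ₁ ℓ₂) (O′ : DecTotalOrder a′ ℓ₁′ ℓ₂′) where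

  private
    module O = DecTotalOrder O
    module O′ = DecTotalOrder O′

  -- Ranks depend only on the preorder induced on tuples, so duplicates can be removed among the
  -- tuples instead of among their values. This compares functions with different codomains.
  levelSets-sameOrder : ∀ {n k} (d : Tuple n k → O.Carrier) (d′ : Tuple n k → O′.Carrier) →
    (∀ u v → d u O.≤ d v → d′ u O′.≤ d′ v) → (∀ u v → d′ u O′.≤ d′ v → d u O.≤ d v) →
    levelSets O d ≗ levelSets O′ d′
  levelSets-sameOrder {n} {k} d d′ f g u = begin
    length (filter (O._≤? d u) (deduplicate O._≟_ (map d ts)))
      ≡⟨ pull O d ⟩
    length (filter (λ t → d t O.≤? d u) (deduplicate (λ s t → d s O.≟ d t) ts))
      ≡⟨ cong (length ∘ filter _) (deduplicate-cong _ _
           (λ {s} {t} s≈t → O′.antisym (f s t (O.reflexive s≈t)) (f t s (O.reflexive (O.Eq.sym s≈t))))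
           (λ {s} {t} s≈t → O.antisym (g s t (O′.reflexive s≈t)) (g t s (O′.reflexive (O′.Eq.sym s≈t))))
           ts) ⟩
    length (filter (λ t → d t O.≤? d u) (deduplicate (λ s t → d′ s O′.≟ d′ t) ts))
      ≡⟨ cong length (filter-≐ _ _ ((λ {t} → f t u) , (λ {t} → g t u))
           (deduplicate (λ s t → d′ s O′.≟ d′ t) ts)) ⟩
    length (filter (λ t → d′ t O′.≤? d′ u) (deduplicate (λ s t → d′ s O′.≟ d′ t) ts))
      ≡⟨ pull O′ d′ ⟨
    length (filter (O′._≤? d′ u) (deduplicate O′._≟_ (map d′ ts))) ∎
    where
    open ≡-Reasoning
    ts : List (Tuple n k)
    ts = allTuples n k
    pull : ∀ {a ℓ₁ ℓ₂} (O : DecTotalOrder a ℓ₁ ℓ₂) (d : Tuple n k → DecTotalOrder.Carrier O) →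
      levelSets O d u
      ≡ length (filter (λ t → DecTotalOrder._≤?_ O (d t) (d u))
          (deduplicate (λ s t → DecTotalOrder._≟_ O (d s) (d t)) ts))
    pull O d = trans (cong (length ∘ filter (_≤ₒ? d u)) (deduplicate-map _≟ₒ_ d ts))
      (trans (cong length (filter-map (_≤ₒ? d u) d dts)) (length-map d (filter ((_≤ₒ? d u) ∘ d) dts)))
      where
      open DecTotalOrder O using () renaming (_≤?_ to _≤ₒ?_; _≟_ to _≟ₒ_)
      dts : List (Tuple n k)
      dts = deduplicate (λ s t → d s ≟ₒ d t) ts

-- Tuples and their atomic types

lookup-ext : ∀ {k} {xs ys : Vec A k} → (∀ i → lookup xs i ≡ lookup ys i) → xs ≡ ys
lookup-ext {xs = xs} {ys} eq =
  trans (sym (Vec.tabulate∘lookup xs)) (trans (Vec.tabulate-cong eq) (Vec.tabulate∘lookup ys))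

tabulate-injective : ∀ {k} {f g : Fin k → A} → tabulate f ≡ tabulate g → ∀ i → f i ≡ g i
tabulate-injective {f = f} {g} eq i =
  trans (sym (Vec.lookup∘tabulate f i)) (trans (cong (λ xs → lookup xs i) eq) (Vec.lookup∘tabulate g i))

-- Apart from `i` there are k - 1 positions, too few for their values to exhaust `Fin k`.
missedValue : ∀ {k} (f : Fin k → Fin k) (i : Fin k) → ∃ λ m → ∀ j → j ≢ i → f j ≢ m
missedValue {suc k} f i with Fin.any? (λ m → ¬? (Fin.any? λ p → f (punchIn i p) Fin.≟ m))
... | yes (m , ¬p) = m , λ j j≢i fj≡m →
  ¬p (punchOut (j≢i ∘ sym) , trans (cong f (Fin.punchIn-punchOut (j≢i ∘ sym))) fj≡m)
... | no ¬m =
  let a , b , a<b , eq = Fin.pigeonhole (ℕ.n<1+n k) (proj₁ ∘ preimage)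
  in contradiction (trans (sym (proj₂ (preimage a)))
       (trans (cong (f ∘ punchIn i) eq) (proj₂ (preimage b)))) (Fin.<⇒≢ a<b)
  where
  preimage : ∀ m → ∃ λ p → f (punchIn i p) ≡ m
  preimage m = decidable-stable (Fin.any? λ p → f (punchIn i p) Fin.≟ m) (λ ¬p → ¬m (m , ¬p))

-- The substitution v ∘ f of a tuple regarded as a function of its positions.
infixl 9 _[_]
_[_] : ∀ {k l} → Vec A k → (Fin l → Fin k) → Vec A l
v [ f ] = tabulate λ i → lookup v (f i)

-- Position `i` is overwritten, so the other positions of `u [ f ]` leave some entry `m` of `u`
-- unread. Writing `w` there and letting position `i` read it gives the same tuple; `m` and `g`
-- depend on `f` and `i` alone.
φ-[] : ∀ {n k} (f : Fin k → Fin k) i →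
       ∃₂ λ m g → ∀ (u : Tuple n k) w → φ i (u [ f ]) w ≡ φ m u w [ g ]
φ-[] {n} {k} f i = let m , f≢m = missedValue f i in m , g m , λ u w → lookup-ext (eq m f≢m u w)
  where
  g : Fin k → Fin k → Fin k
  g m j = if does (j Fin.≟ i) then m else f j

  eq : ∀ m → (∀ j → j ≢ i → f j ≢ m) → ∀ (u : Tuple n k) w j →
       lookup (φ i (u [ f ]) w) j ≡ lookup (φ m u w [ g m ]) j
  eq m f≢m u w j with j Fin.≟ i | Vec.lookup∘tabulate (λ j → lookup (φ m u w) (g m j)) j
  ... | yes refl | rhs = trans (Vec.lookup∘update i (u [ f ]) w) (sym (trans rhs (Vec.lookup∘update m u w)))
  ... | no j≢i   | rhs = trans (Vec.lookup∘update′ j≢i (u [ f ]) w)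
    (trans (Vec.lookup∘tabulate (lookup u ∘ f) j) (sym (trans rhs (Vec.lookup∘update′ (f≢m j j≢i) u w))))

module _ {n} (G : SimpleGraph n) where

  atomicType : Fin n → Fin n → ℤ
  atomicType x y = if does (x Fin.≟ y) then 0ℤ else if does (adj? G x y) then 1ℤ else -1ℤ

  𝓒-lookup : ∀ {k} (u : Tuple n k) i j → lookup (lookup (𝓒 G u) i) j ≡ atomicType (lookup u i) (lookup u j)
  𝓒-lookup u i j = trans
    (cong (λ r → lookup r j) (Vec.lookup∘tabulate (λ i → tabulate λ j → atomicType (lookup u i) (lookup u j)) i))
    (Vec.lookup∘tabulate (λ j → atomicType (lookup u i) (lookup u j)) j)

module _ {n} (G H : SimpleGraph n) where

  𝓒-≡⁻ : ∀ {k} (u v : Tuple n k) → 𝓒 G u ≡ 𝓒 H v →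
          ∀ i j → atomicType G (lookup u i) (lookup u j) ≡ atomicType H (lookup v i) (lookup v j)
  𝓒-≡⁻ u v eq i j =
    trans (sym (𝓒-lookup G u i j)) (trans (cong (λ M → lookup (lookup M i) j) eq) (𝓒-lookup H v i j))

  𝓒-≡⁺ : ∀ {k} (u v : Tuple n k) →
          (∀ i j → atomicType G (lookup u i) (lookup u j) ≡ atomicType H (lookup v i) (lookup v j)) → 𝓒 G u ≡ 𝓒 H v
  𝓒-≡⁺ u v eq = Vec.tabulate-cong λ i → Vec.tabulate-cong (eq i)

  𝓒-[] : ∀ {k l} (u v : Tuple n k) (f : Fin l → Fin k) → 𝓒 G u ≡ 𝓒 H v → 𝓒 G (u [ f ]) ≡ 𝓒 H (v [ f ])
  𝓒-[] u v f eq = 𝓒-≡⁺ (u [ f ]) (v [ f ]) λ i j → trans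
    (cong₂ (atomicType G) (Vec.lookup∘tabulate (lookup u ∘ f) i) (Vec.lookup∘tabulate (lookup u ∘ f) j))
    (trans (𝓒-≡⁻ u v eq (f i) (f j))
      (sym (cong₂ (atomicType H) (Vec.lookup∘tabulate (lookup v ∘ f) i) (Vec.lookup∘tabulate (lookup v ∘ f) j))))

  atomicType-≡ : ∀ x y x′ y′ → atomicType G x y ≡ atomicType H x′ y′ →
                 (x ≡ y → x′ ≡ y′) × (x′ ≡ y′ → x ≡ y) × (Adj G x y → Adj H x′ y′) × (Adj H x′ y′ → Adj G x y)
  atomicType-≡ x y x′ y′ eq with x Fin.≟ y | x′ Fin.≟ y′ | adj? G x y | adj? H x′ y′
  ... | yes p | yes q | _     | _     =
    (λ _ → q) , (λ _ → p) , (λ a → contradiction a (irrefl G p)) , λ a → contradiction a (irrefl H q)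
  ... | yes p | no ¬q | _     | yes b = contradiction eq λ ()
  ... | yes p | no ¬q | _     | no ¬b = contradiction eq λ ()
  ... | no ¬p | yes q | yes a | _     = contradiction eq λ ()
  ... | no ¬p | yes q | no ¬a | _     = contradiction eq λ ()
  ... | no ¬p | no ¬q | yes a | yes b =
    (λ p → contradiction p ¬p) , (λ q → contradiction q ¬q) , (λ _ → b) , λ _ → a
  ... | no ¬p | no ¬q | yes a | no ¬b = contradiction eq λ ()
  ... | no ¬p | no ¬q | no ¬a | yes b = contradiction eq λ ()
  ... | no ¬p | no ¬q | no ¬a | no ¬b =
    (λ p → contradiction p ¬p) , (λ q → contradiction q ¬q) ,
    (λ a → contradiction a ¬a) , λ b → contradiction b ¬b

module _ (E : Enumeration A) where

  -- Termination measure for the refinement: splitting a cell separates some pair of equal colour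
  -- and creates none.
  coincidences : (A → ℕ) → ℕ
  coincidences π = ∑ⁿ (elements E) λ u → ∑ⁿ (elements E) λ v → ι (π u ℕ.≟ π v)

  unrefined⊎fewer : ∀ (π ρ : A → ℕ) → (∀ u v → ρ u ≡ ρ v → π u ≡ π v) →
    (∀ u v → π u ≡ π v → ρ u ≡ ρ v) ⊎ coincidences ρ ℕ.< coincidences π
  unrefined⊎fewer π ρ refines with any? split? (elements E)
    where
    split? : ∀ u → Dec (Any (λ v → π u ≡ π v × ρ u ≢ ρ v) (elements E))
    split? u = any? (λ v → (π u ℕ.≟ π v) ×-dec ¬? (ρ u ℕ.≟ ρ v)) (elements E)
  ... | yes p = inj₂ (
    let u , u∈ , q = find p
        v , v∈ , same , split = find q
        mono : ∀ u v → ι (ρ u ℕ.≟ ρ v) ℕ.≤ ι (π u ℕ.≟ π v)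
        mono u v = ι-mono (ρ u ℕ.≟ ρ v) (π u ℕ.≟ π v) (refines u v)
    in ∑ⁿ-mono-< (elements E) (λ u → ∑ⁿ-mono (elements E) (mono u)) u∈
         (∑ⁿ-mono-< (elements E) (mono u) v∈
           (subst₂ ℕ._<_ (sym (ι-no (ρ u ℕ.≟ ρ v) split)) (sym (ι-yes (π u ℕ.≟ π v) same)) (s≤s z≤n))))
  ... | no ¬p = inj₁ λ u v same → decidable-stable (ρ u ℕ.≟ ρ v) λ split →
    ¬p (lose (complete E u) (lose (complete E v) (same , split)))

-- Weisfeiler-Leman colours

module WL {n k : ℕ} where

  module Iso = Isomorphism {n} k

  module Rank𝓒 = Ranking (𝓒-order k) (VecPointwise.Pointwise-≡⇒≡ ∘ VecPointwise.map VecPointwise.Pointwise-≡⇒≡) {n} {k}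
  module RankD = Ranking (D-order k)
    (λ (p , q) → cong₂ _,_ p (ListPointwise.Pointwise-≡⇒≡ (ListPointwise.map VecPointwise.Pointwise-≡⇒≡ q))) {n} {k}

  module _ (π τ : OrderedPartition n k) (u v : Tuple n k) where

    open Data.List.Sort (ω-order k)

    private
      us vs : List (Vec ℕ k)
      us = map (ωAt π u) (allFin n)
      vs = map (ωAt τ v) (allFin n)

    D-≡⁺ : π u ≡ τ v → us ↭ vs → D π u ≡ D τ v
    D-≡⁺ eq p = cong₂ _,_ eq (ListPointwise.Pointwise-≡⇒≡ (ListPointwise.map VecPointwise.Pointwise-≡⇒≡
      (↗↭↗⇒≋ (DecTotalOrder.totalOrder (ω-order k)) (sort-↗ us) (sort-↗ vs)
        (↭⇒↭ₛ′ (DecTotalOrder.Eq.isEquivalence (ω-order k)) (↭-trans (sort-↭ us) (↭-trans p (↭-sym (sort-↭ vs))))))))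

    D-≡⁻ : D π u ≡ D τ v → ∃ λ (ψ : Fin n ↔ Fin n) → ∀ i w → π (φ i u w) ≡ τ (φ i v (Inverse.to ψ w))
    D-≡⁻ eq =
      let ψ , ψ-ok = map-↭⇒bijection (fins n) (↭-trans (↭-sym (sort-↭ us))
                       (↭-trans (↭-reflexive (cong proj₂ eq)) (sort-↭ vs)))
      in ψ , λ i w → tabulate-injective (ψ-ok w) i

    D-≡-bijection : π u ≡ τ v → (ψ : Fin n ↔ Fin n) →
      (∀ i w → π (φ i u w) ≡ τ (φ i v (Inverse.to ψ w))) → D π u ≡ D τ v
    D-≡-bijection eq ψ ψ-ok = D-≡⁺ eq (bijection⇒map-↭ (fins n) ψ λ w → Vec.tabulate-cong λ i → ψ-ok i w)

  D-cong : ∀ {π τ : OrderedPartition n k} → π ≗ τ → D π ≗ D τ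
  D-cong π≗τ u = cong₂ _,_ (π≗τ u) (cong sort (map-cong
    (λ w → Vec.tabulate-cong λ i → π≗τ (φ i u w)) (allFin n)))
    where open Data.List.Sort (ω-order k)

  infix 4 _≤𝓒_ _≤ᴰ_
  _≤𝓒_ : Rel (Vec (Vec ℤ k) k) 0ℓ
  _≤𝓒_ = DecTotalOrder._≤_ (𝓒-order k)

  _≤ᴰ_ : Rel (ℕ × List (Vec ℕ k)) 0ℓ
  _≤ᴰ_ = DecTotalOrder._≤_ (D-order k)

  ≤ᴰ-proj₁ : ∀ {p q} → p ≤ᴰ q → proj₁ p ℕ.≤ proj₁ q
  ≤ᴰ-proj₁ (inj₁ (p≤q , _)) = p≤q
  ≤ᴰ-proj₁ (inj₂ (p≡q , _)) = ℕ.≤-reflexive p≡q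

  -- Colours are opaque because comparing their unfoldings is infeasible.
  opaque

    colour : SimpleGraph n → ℕ → Tuple n k → ℕ
    colour = Iso.iterate

    colour₀-mono : ∀ G u v → 𝓒 G u ≤𝓒 𝓒 G v → colour G 0 u ℕ.≤ colour G 0 v
    colour₀-mono G u v = Rank𝓒.levelSets-mono (𝓒 G) {u} {v}

    colour₀-cancel : ∀ G u v → colour G 0 u ℕ.≤ colour G 0 v → 𝓒 G u ≤𝓒 𝓒 G v
    colour₀-cancel G u v = Rank𝓒.levelSets-cancel (𝓒 G) {u} {v}

    colour₀-≡⁺ : ∀ G u v → 𝓒 G u ≡ 𝓒 G v → colour G 0 u ≡ colour G 0 v
    colour₀-≡⁺ G u v = Rank𝓒.levelSets-≡ (𝓒 G) {u} {v}

    colour₀-≡⁻ : ∀ G u v → colour G 0 u ≡ colour G 0 v → 𝓒 G u ≡ 𝓒 G v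
    colour₀-≡⁻ G u v = Rank𝓒.levelSets-injective (𝓒 G) {u} {v}

    colour₀-sameValues : ∀ G H →
      (∀ (u : Tuple n k) → ¬ ∀ (v : Tuple n k) → 𝓒 G u ≢ 𝓒 H v) →
      (∀ (v : Tuple n k) → ¬ ∀ (u : Tuple n k) → 𝓒 G u ≢ 𝓒 H v) →
      ∀ u v → 𝓒 G u ≡ 𝓒 H v → colour G 0 u ≡ colour H 0 v
    colour₀-sameValues G H p q u v = Rank𝓒.levelSets-sameValues (𝓒 G) (𝓒 H) p q {u} {v}

    colour₊-mono : ∀ G t u v → D (colour G t) u ≤ᴰ D (colour G t) v → colour G (suc t) u ℕ.≤ colour G (suc t) v
    colour₊-mono G t u v = RankD.levelSets-mono (D (Iso.iterate G t)) {u} {v}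

    colour₊-cancel : ∀ G t u v → colour G (suc t) u ℕ.≤ colour G (suc t) v → D (colour G t) u ≤ᴰ D (colour G t) v
    colour₊-cancel G t u v = RankD.levelSets-cancel (D (Iso.iterate G t)) {u} {v}

    colour₊-≡⁺ : ∀ G t u v → D (colour G t) u ≡ D (colour G t) v → colour G (suc t) u ≡ colour G (suc t) v
    colour₊-≡⁺ G t u v = RankD.levelSets-≡ (D (Iso.iterate G t)) {u} {v}

    colour₊-≡⁻ : ∀ G t u v → colour G (suc t) u ≡ colour G (suc t) v → D (colour G t) u ≡ D (colour G t) v
    colour₊-≡⁻ G t u v = RankD.levelSets-injective (D (Iso.iterate G t)) {u} {v}

    colour₊-sameValues : ∀ G H t →
      (∀ u → ¬ ∀ v → D (colour G t) u ≢ D (colour H t) v) → (∀ v → ¬ ∀ u → D (colour G t) u ≢ D (colour H t) v) →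
      ∀ u v → D (colour G t) u ≡ D (colour H t) v → colour G (suc t) u ≡ colour H (suc t) v
    colour₊-sameValues G H t p q u v =
      RankD.levelSets-sameValues (D (Iso.iterate G t)) (D (Iso.iterate H t)) p q {u} {v}

    colour₁-sameOrder : ∀ G → (∀ u v → D (colour G 0) u ≤ᴰ D (colour G 0) v → 𝓒 G u ≤𝓒 𝓒 G v) →
      (∀ u v → 𝓒 G u ≤𝓒 𝓒 G v → D (colour G 0) u ≤ᴰ D (colour G 0) v) → colour G 1 ≗ colour G 0
    colour₁-sameOrder G = levelSets-sameOrder (D-order k) (𝓒-order k) (D (Iso.iterate G 0)) (𝓒 G)

    colour₊-sameOrder : ∀ G s t → (∀ u v → D (colour G s) u ≤ᴰ D (colour G s) v → D (colour G t) u ≤ᴰ D (colour G t) v) →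
      (∀ u v → D (colour G t) u ≤ᴰ D (colour G t) v → D (colour G s) u ≤ᴰ D (colour G s) v) →
      colour G (suc s) ≗ colour G (suc t)
    colour₊-sameOrder G s t =
      levelSets-sameOrder (D-order k) (D-order k) (D (Iso.iterate G s)) (D (Iso.iterate G t))

    FinalMatch-iterate : ∀ {G H s t} → Iso.FinalMatch (colour G s) (colour H t) →
                         Iso.FinalMatch (Iso.iterate G s) (Iso.iterate H t)
    FinalMatch-iterate match = match

    FinalMatch-colour : ∀ {G H s t} → Iso.FinalMatch (Iso.iterate G s) (Iso.iterate H t) →
                        Iso.FinalMatch (colour G s) (colour H t)
    FinalMatch-colour match = match

    Stable⇒IsoStable : ∀ {G t} → colour G (suc t) ≗ colour G t → Iso.Stable (Iso.iterate G t)
    Stable⇒IsoStable stable = stable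

    IsoStable⇒Stable : ∀ {G t} → Iso.Stable (Iso.iterate G t) → colour G (suc t) ≗ colour G t
    IsoStable⇒Stable stable = stable

  Stable : SimpleGraph n → ℕ → Set
  Stable G t = colour G (suc t) ≗ colour G t

  module _ (G : SimpleGraph n) where

    open Automorphism k G using (iterate)

    -- For a single graph the two versions of the algorithm agree round by round, since the sorted
    -- lists in `D` are equal exactly when some `ψ` matches the colours of the replaced tuples.
    iterate⇔colour : ∀ t u v → iterate t u v ⇔ (colour G t u ≡ colour G t v)
    iterate⇔colour zero    u v = mk⇔ (colour₀-≡⁺ G u v) (colour₀-≡⁻ G u v)
    iterate⇔colour (suc t) u v = mk⇔
      (λ (π≡ , ψ , ψ-ok) → colour₊-≡⁺ G t u v
        (D-≡-bijection (colour G t) (colour G t) u v (to (iterate⇔colour t u v) π≡) (⤖⇒↔ ψ)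
          λ i w → to (iterate⇔colour t _ _) (ψ-ok i w)))
      (λ eq → let D≡ = colour₊-≡⁻ G t u v eq
                  ψ , ψ-ok = D-≡⁻ (colour G t) (colour G t) u v D≡
              in from (iterate⇔colour t u v) (cong proj₁ D≡) , ↔⇒⤖ ψ
               , λ i w → from (iterate⇔colour t _ _) (ψ-ok i w))
      where open Equivalence

    -- The first component of `D` is the previous cell number, so refining never reverses the order
    -- of two cells.
    colour-mono₀ : ∀ t u v → colour G t u ℕ.≤ colour G t v → colour G 0 u ℕ.≤ colour G 0 v
    colour-mono₀ zero    u v u≤v = u≤v
    colour-mono₀ (suc t) u v u≤v = colour-mono₀ t u v (≤ᴰ-proj₁ (colour₊-cancel G t u v u≤v))

    colour-refines : ∀ t u v → colour G (suc t) u ≡ colour G (suc t) v → colour G t u ≡ colour G t v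
    colour-refines t u v eq = cong proj₁ (colour₊-≡⁻ G t u v eq)

    module _ (t : ℕ) (unrefined : ∀ u v → colour G t u ≡ colour G t v → colour G (suc t) u ≡ colour G (suc t) v) where

      ≤⇒≤ᴰ : ∀ u v → colour G t u ℕ.≤ colour G t v → D (colour G t) u ≤ᴰ D (colour G t) v
      ≤⇒≤ᴰ u v u≤v with ℕ.m≤n⇒m<n∨m≡n u≤v
      ... | inj₁ u<v = inj₁ (u≤v , ℕ.<⇒≢ u<v)
      ... | inj₂ u≡v = DecTotalOrder.reflexive (D-order k) (DecTotalOrder.Eq.reflexive (D-order k)
          (colour₊-≡⁻ G t u v (unrefined u v u≡v)))

    -- `Stable` asks for the same numbers, not just the same cells. When no cell splits, `D` induces
    -- the same preorder on tuples as the function whose ranks are the present numbers; that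
    -- function is `𝓒 G` at the start and the previous `D` later, hence the two cases.
    unrefined⇒stable : ∀ t → (∀ u v → colour G t u ≡ colour G t v → colour G (suc t) u ≡ colour G (suc t) v) → Stable G t
    unrefined⇒stable zero    unrefined = colour₁-sameOrder G
      (λ u v → colour₀-cancel G u v ∘ ≤ᴰ-proj₁)
      (λ u v → ≤⇒≤ᴰ 0 unrefined u v ∘ colour₀-mono G u v)
    unrefined⇒stable (suc t) unrefined = colour₊-sameOrder G (suc t) t
      (λ u v → colour₊-cancel G t u v ∘ ≤ᴰ-proj₁)
      (λ u v → ≤⇒≤ᴰ (suc t) unrefined u v ∘ colour₊-mono G t u v)

    stable⊎fewer : ∀ t → Stable G t ⊎
      coincidences (tuples n k) (colour G (suc t)) ℕ.< coincidences (tuples n k) (colour G t)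
    stable⊎fewer t = map₁ (unrefined⇒stable t)
      (unrefined⊎fewer (tuples n k) (colour G t) (colour G (suc t)) (colour-refines t))

    stabilises : ∃ λ t → Stable G t
    stabilises = go 0 (<-wellFounded (coincidences (tuples n k) (colour G 0)))
      where
      go : ∀ t → Acc ℕ._<_ (coincidences (tuples n k) (colour G t)) → ∃ λ t → Stable G t
      go t (acc rec) = [ (t ,_) , (λ fewer → go (suc t) (rec fewer)) ]′ (stable⊎fewer t)

    stable-suc : ∀ t → Stable G t → Stable G (suc t)
    stable-suc t stable = colour₊-sameOrder G (suc t) t
      (λ u v → subst₂ _≤ᴰ_ (D-cong stable u) (D-cong stable v))
      (λ u v → subst₂ _≤ᴰ_ (sym (D-cong stable u)) (sym (D-cong stable v)))

    stable-+ : ∀ {t} → Stable G t → ∀ j → Stable G (j ℕ.+ t)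
    stable-+     stable zero    = stable
    stable-+ {t} stable (suc j) = stable-suc (j ℕ.+ t) (stable-+ stable j)

    colour-+ : ∀ {t} → Stable G t → ∀ j → colour G (j ℕ.+ t) ≗ colour G t
    colour-+ stable zero    u = refl
    colour-+ stable (suc j) u = trans (stable-+ stable j u) (colour-+ stable j u)

  module _ (G H : SimpleGraph n) (Excluded : Tuple n k → Tuple n k → Set ℓ)
    (totalˡ : ∀ u → ¬ ∀ v → Excluded u v) (totalʳ : ∀ v → ¬ ∀ u → Excluded u v)
    (base : ∀ u v → 𝓒 G u ≢ 𝓒 H v → Excluded u v)
    (step : ∀ t → (∀ u v → colour G t u ≢ colour H t v → Excluded u v) →
            ∀ u v → D (colour G t) u ≢ D (colour H t) v → Excluded u v) where

    -- A value of one graph without a partner in the other would exclude a whole row or column,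
    -- against totality. So both graphs have the same values, equal values get equal numbers, and
    -- unequal numbers come from unequal values. `Excluded` stands for the vanishing of `Y` in one
    -- direction and for the negation of `Substituted` in the other.
    excludes : ∀ t u v → colour G t u ≢ colour H t v → Excluded u v
    excludes zero    u v u≢v = base u v (u≢v ∘ colour₀-sameValues G H
      (λ u distinct → totalˡ u λ v → base u v (distinct v)) (λ v distinct → totalʳ v λ u → base u v (distinct u)) u v)
    excludes (suc t) u v u≢v = step′ u v (u≢v ∘ colour₊-sameValues G H t
      (λ u distinct → totalˡ u λ v → step′ u v (distinct v)) (λ v distinct → totalʳ v λ u → step′ u v (distinct u)) u v)
      where
      step′ : ∀ u v → D (colour G t) u ≢ D (colour H t) v → Excluded u v
      step′ = step t (excludes t)

-- Matched stable colours of two graphs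

module _ {T : Set a} (E : Enumeration T) where

  -- The sublevel set is contained in its preimage under `σ`, and both have equally many elements.
  permuted-sublevel : ∀ (h : T → ℕ) m (σ : T ↔ T) → (∀ x → h x ℕ.≤ m → h (Inverse.to σ x) ℕ.≤ m) →
                      ∀ x → h (Inverse.to σ x) ℕ.≤ m → h x ℕ.≤ m
  permuted-sublevel h m σ closed x hσx≤m with h x ℕ.≤? m
  ... | yes hx≤m = hx≤m
  ... | no  hx≰m = contradiction (∑ⁿ-reindex E σ (λ x → ι (h x ℕ.≤? m)))
    (ℕ.<⇒≢ (∑ⁿ-mono-< (elements E)
      (λ y → ι-mono (h y ℕ.≤? m) (h (Inverse.to σ y) ℕ.≤? m) (closed y))
      (complete E x)
      (subst₂ ℕ._<_ (sym (ι-no (h x ℕ.≤? m) hx≰m)) (sym (ι-yes (h (Inverse.to σ x) ℕ.≤? m) hσx≤m)) (s≤s z≤n))))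

  -- A matching γ of the fine colours and a matching γ₀ of the coarse ones give
  -- the permutation γ₀ ∘ γ⁻¹, which maps a sublevel set of coarse colours into itself.
  coarse-≤ : ∀ (g₀ gᵣ h₀ hᵣ : T → ℕ) (γ₀ γ : T ↔ T) →
    (∀ x → g₀ x ≡ h₀ (Inverse.to γ₀ x)) → (∀ x → gᵣ x ≡ hᵣ (Inverse.to γ x)) →
    (∀ x y → gᵣ x ℕ.≤ gᵣ y → g₀ x ℕ.≤ g₀ y) → (∀ x y → hᵣ x ℕ.≤ hᵣ y → h₀ x ℕ.≤ h₀ y) →
    ∀ u v → gᵣ u ≡ hᵣ v → h₀ v ℕ.≤ g₀ u
  coarse-≤ g₀ gᵣ h₀ hᵣ γ₀ γ γ₀-ok γ-ok g-mono h-mono u v gu≡hv with h₀ v ℕ.≤? g₀ u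
  ... | yes h₀v≤g₀u = h₀v≤g₀u
  -- If `h₀ v` exceeds `g₀ u`, the sublevel set of `g₀ u` lies below `v` in the fine order, and `σ`
  -- moves everything up to `v` into that set. So the set is closed under `σ` and contains the image
  -- of `v`, hence `v`.
  ... | no  h₀v≰g₀u = permuted-sublevel h₀ (g₀ u) σ
    (λ x h₀x≤ → push x (ℕ.<⇒≤ (ℕ.≰⇒> λ hv≤hx → h₀v≰g₀u (ℕ.≤-trans (h-mono v x hv≤hx) h₀x≤))))
    v (push v ℕ.≤-refl)
    where
    σ : T ↔ T
    σ = γ₀ ↔-∘ ↔-sym γ
    push : ∀ x → hᵣ x ℕ.≤ hᵣ v → h₀ (Inverse.to σ x) ℕ.≤ g₀ u
    push x hx≤hv = ℕ.≤-trans (ℕ.≤-reflexive (sym (γ₀-ok (Inverse.from γ x))))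
      (g-mono _ u (subst₂ ℕ._≤_
        (sym (trans (γ-ok _) (cong hᵣ (Inverse.strictlyInverseˡ γ x)))) (sym gu≡hv) hx≤hv))

constant-if-sameType : ∀ {n k} (G H : SimpleGraph n) u (x : Tuple n (suc k)) →
  𝓒 G (replicate (suc k) u) ≡ 𝓒 H x → x ≡ replicate (suc k) (head x)
constant-if-sameType {n} {k} G H u (x ∷ xs) eq = lookup-ext λ i →
  trans
    (proj₁ (atomicType-≡ G H (lookup (replicate (suc k) u) i) u (lookup (x ∷ xs) i) x
      (𝓒-≡⁻ G H (replicate (suc k) u) (x ∷ xs) eq i zero)) (Vec.lookup-replicate i u))
    (sym (Vec.lookup-replicate i x))

module StableMatch {n k : ℕ} (G H : SimpleGraph n) (r : ℕ) (stable : WL.Stable {n} {suc k} H r)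
  (γ₀ γ : Tuple n (suc k) ↔ Tuple n (suc k))
  (γ₀-ok : ∀ u → 𝓒 G u ≡ 𝓒 H (Inverse.to γ₀ u))
  (γ-ok : ∀ u → D (WL.colour G r) u ≡ D (WL.colour H r) (Inverse.to γ u)) where

  open WL {n} {suc k}
  open Inverse

  infix 4 _∼_
  _∼_ : Tuple n (suc k) → Tuple n (suc k) → Set
  u ∼ v = colour G r u ≡ colour H r v

  γ-∼ : ∀ u → u ∼ to γ u
  γ-∼ u = cong proj₁ (γ-ok u)

  γ⁻¹-∼ : ∀ v → from γ v ∼ v
  γ⁻¹-∼ v = trans (γ-∼ (from γ v)) (cong (colour H r) (strictlyInverseˡ γ v))

  γ₀-colour : ∀ u → colour G 0 u ≡ colour H 0 (to γ₀ u)
  γ₀-colour u = colour₀-sameValues G H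
    (λ u ≢ → ≢ (to γ₀ u) (γ₀-ok u))
    (λ v ≢ → ≢ (from γ₀ v) (trans (γ₀-ok (from γ₀ v)) (cong (𝓒 H) (strictlyInverseˡ γ₀ v))))
    u (to γ₀ u) (γ₀-ok u)

  -- The final match does not mention earlier rounds, so the initial colours are recovered from the
  -- order of the cells, by one inequality from `G` to `H` and one, with both bijections inverted,
  -- from `H` to `G`.
  ∼⇒colour₀ : ∀ u v → u ∼ v → colour G 0 u ≡ colour H 0 v
  ∼⇒colour₀ u v u∼v = ℕ.≤-antisym
    (coarse-≤ (tuples n (suc k)) (colour H 0) (colour H r) (colour G 0) (colour G r) (↔-sym γ₀) (↔-sym γ)
      (λ x → trans (cong (colour H 0) (sym (strictlyInverseˡ γ₀ x))) (sym (γ₀-colour (from γ₀ x))))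
      (λ x → sym (γ⁻¹-∼ x))
      (colour-mono₀ H r) (colour-mono₀ G r) v u (sym u∼v))
    (coarse-≤ (tuples n (suc k)) (colour G 0) (colour G r) (colour H 0) (colour H r) γ₀ γ
      γ₀-colour γ-∼ (colour-mono₀ G r) (colour-mono₀ H r) u v u∼v)

  ∼⇒𝓒 : ∀ u v → u ∼ v → 𝓒 G u ≡ 𝓒 H v
  ∼⇒𝓒 u v u∼v = trans (γ₀-ok u)
    (sym (colour₀-≡⁻ H v (to γ₀ u) (trans (sym (∼⇒colour₀ u v u∼v)) (γ₀-colour u))))

  -- `v` and `γ u` have the same colour in `H`, which in a stable colouring means the same `D`.
  ∼⇒D : ∀ u v → u ∼ v → D (colour G r) u ≡ D (colour H r) v
  ∼⇒D u v u∼v = trans (γ-ok u) (sym (colour₊-≡⁻ H r v (to γ u)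
    (trans (stable v) (trans (sym u∼v) (trans (γ-∼ u) (sym (stable (to γ u))))))))

  extend : ∀ u v → u ∼ v → ∃ λ (ψ : Fin n ↔ Fin n) → ∀ i w → φ i u w ∼ φ i v (to ψ w)
  extend u v u∼v = D-≡⁻ (colour G r) (colour H r) u v (∼⇒D u v u∼v)

  -- The closure of `∼` under substitution of positions. It behaves as a bisimulation for the
  -- refinement: by `φ-[]`, replacing an entry in a substituted pair gives a substituted pair again,
  -- so such pairs share their colours in every round.
  Substituted : Tuple n (suc k) → Tuple n (suc k) → Set
  Substituted u v = ∃₂ λ u′ v′ → u′ ∼ v′ × ∃ λ f → u ≡ u′ [ f ] × v ≡ v′ [ f ]

  ∼⇒Substituted : ∀ u v → u ∼ v → Substituted u v
  ∼⇒Substituted u v u∼v = u , v , u∼v , id , sym (Vec.tabulate∘lookup u) , sym (Vec.tabulate∘lookup v)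

  ∼-[] : ∀ u v (f : Fin (suc k) → Fin (suc k)) → u ∼ v → u [ f ] ∼ v [ f ]
  ∼-[] u v f u∼v = decidable-stable (colour G r (u [ f ]) ℕ.≟ colour H r (v [ f ])) λ u≢v →
    excludes G H (λ u v → ¬ Substituted u v)
      (λ u ¬s → ¬s (to γ u) (∼⇒Substituted u (to γ u) (γ-∼ u)))
      (λ v ¬s → ¬s (from γ v) (∼⇒Substituted (from γ v) v (γ⁻¹-∼ v)))
      (λ { _ _ u≢v (u′ , v′ , u∼v , f , refl , refl) → u≢v (𝓒-[] G H u′ v′ f (∼⇒𝓒 u′ v′ u∼v)) })
      step r (u [ f ]) (v [ f ]) u≢v (u , v , u∼v , f , refl , refl)
    where
    step : ∀ t → (∀ u v → colour G t u ≢ colour H t v → ¬ Substituted u v) →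
           ∀ u v → D (colour G t) u ≢ D (colour H t) v → ¬ Substituted u v
    step t distinct _ _ u≢v s@(u′ , v′ , u∼v , f , refl , refl) =
      let ψ , ψ-ok = extend u′ v′ u∼v
      in u≢v (D-≡-bijection (colour G t) (colour H t) (u′ [ f ]) (v′ [ f ]) (same _ _ s) ψ λ i w →
           let m , g , eq = φ-[] f i
           in same _ _ (φ m u′ w , φ m v′ (to ψ w) , ψ-ok m w , g , eq u′ w , eq v′ (to ψ w)))
      where
      same : ∀ u v → Substituted u v → colour G t u ≡ colour H t v
      same u v s = decidable-stable (colour G t u ℕ.≟ colour H t v) λ u≢v → distinct u v u≢v s

  -- Atomic types force `γ` to preserve constant tuples in both directions, so it restricts to a
  -- bijection of vertices. This serves to extend the empty map, which contains no tuple to start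
  -- from.
  const-∼ : ∃ λ (ψ : Fin n ↔ Fin n) → ∀ w → replicate (suc k) w ∼ replicate (suc k) (to ψ w)
  const-∼ = mk↔ₛ′ (λ u → head (to γ (replicate _ u))) (λ v → head (from γ (replicate _ v)))
      (λ v → cong head (trans (cong (to γ) (sym (from-const v))) (strictlyInverseˡ γ _)))
      (λ u → cong head (trans (cong (from γ) (sym (to-const u))) (strictlyInverseʳ γ _)))
    , λ u → trans (γ-∼ (replicate _ u)) (cong (colour H r) (to-const u))
    where
    to-const : ∀ u → to γ (replicate _ u) ≡ replicate _ (head (to γ (replicate _ u)))
    to-const u = constant-if-sameType G H u (to γ (replicate _ u)) (∼⇒𝓒 _ _ (γ-∼ (replicate _ u)))
    from-const : ∀ v → from γ (replicate _ v) ≡ replicate _ (head (from γ (replicate _ v)))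
    from-const v = constant-if-sameType H G v (from γ (replicate _ v)) (sym (∼⇒𝓒 _ _ (γ⁻¹-∼ (replicate _ v))))

-- The ordered additive group of real numbers

module Real where

  open import Data.Rational.Solver using (module +-*-Solver)
  open +-*-Solver
  open ℚ.≤-Reasoning

  half : ∀ {ε} → 0ℚ ℚ.< ε → 0ℚ ℚ.< ½ ℚ.* ε
  half {ε} 0<ε = subst (ℚ._< ½ ℚ.* ε) (ℚ.*-zeroʳ ½) (ℚ.*-monoʳ-<-pos ½ 0<ε)

  halves : ∀ ε → ½ ℚ.* ε ℚ.+ ½ ℚ.* ε ≡ ε
  halves ε = trans (sym (ℚ.*-distribʳ-+ ε ½ ½)) (ℚ.*-identityˡ ε)

  ∣p∣≤q⇒p≤q : ∀ {p q} → ℚ.∣ p ∣ ℚ.≤ q → p ℚ.≤ q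
  ∣p∣≤q⇒p≤q {p} le = ℚ.≤-trans (p≤∣p∣ p) le
    where
    p≤∣p∣ : ∀ p → p ℚ.≤ ℚ.∣ p ∣
    p≤∣p∣ p with ℚ.≤-total 0ℚ p
    ... | inj₁ 0≤p = ℚ.≤-reflexive (sym (ℚ.0≤p⇒∣p∣≡p 0≤p))
    ... | inj₂ p≤0 = ℚ.≤-trans p≤0 (ℚ.0≤∣p∣ p)

  ∣p∣≤q : ∀ {p q} → p ℚ.≤ q → ℚ.- p ℚ.≤ q → ℚ.∣ p ∣ ℚ.≤ q
  ∣p∣≤q {p} {q} p≤q -p≤q with ℚ.∣p∣≡p∨∣p∣≡-p p
  ... | inj₁ eq = subst (ℚ._≤ q) (sym eq) p≤q
  ... | inj₂ eq = subst (ℚ._≤ q) (sym eq) -p≤q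

  p-q≤r⇒p≤q+r : ∀ {p q r} → p ℚ.- q ℚ.≤ r → p ℚ.≤ q ℚ.+ r
  p-q≤r⇒p≤q+r {p} {q} {r} le = begin
    p                  ≡⟨ lemma p q ⟩
    q ℚ.+ (p ℚ.- q)    ≤⟨ ℚ.+-monoʳ-≤ q le ⟩
    q ℚ.+ r            ∎
    where
    lemma : ∀ p q → p ≡ q ℚ.+ (p ℚ.- q)
    lemma = solve 2 (λ p q → p := q :+ (p :- q)) refl

  p≤q+r⇒p-q≤r : ∀ {p q r} → p ℚ.≤ q ℚ.+ r → p ℚ.- q ℚ.≤ r
  p≤q+r⇒p-q≤r {p} {q} {r} le = begin
    p ℚ.- q            ≤⟨ ℚ.+-monoˡ-≤ (ℚ.- q) le ⟩
    q ℚ.+ r ℚ.- q      ≡⟨ lemma q r ⟩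
    r                  ∎
    where
    lemma : ∀ q r → q ℚ.+ r ℚ.- q ≡ r
    lemma = solve 2 (λ q r → q :+ r :- q := r) refl

  swap-- : ∀ p q → ℚ.- (p ℚ.- q) ≡ q ℚ.- p
  swap-- = solve 2 (λ p q → :- (p :- q) := q :- p) refl

  ≤-pointwise : ∀ {x y} → (∀ n → seq x n ℚ.≤ seq y n) → x ≤ y
  ≤-pointwise {x} {y} x≤y ε 0<ε = 0 , λ n _ → begin
    seq x n            ≤⟨ x≤y n ⟩
    seq y n            ≡⟨ ℚ.+-identityʳ (seq y n) ⟨
    seq y n ℚ.+ 0ℚ     ≤⟨ ℚ.+-monoʳ-≤ (seq y n) (ℚ.<⇒≤ 0<ε) ⟩
    seq y n ℚ.+ ε      ∎

  ≈⇒≤ : ∀ {x y} → x ≈ y → x ≤ y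
  ≈⇒≤ x≈y ε 0<ε = let N , h = x≈y ε 0<ε in N , λ n N≤n → p-q≤r⇒p≤q+r (∣p∣≤q⇒p≤q (h n N≤n))

  ≤-antisym : ∀ {x y} → x ≤ y → y ≤ x → x ≈ y
  ≤-antisym {x} {y} x≤y y≤x ε 0<ε =
    let M , h = x≤y ε 0<ε
        N , g = y≤x ε 0<ε
    in M ⊔ N , λ n n≥ → ∣p∣≤q (p≤q+r⇒p-q≤r (h n (ℕ.m⊔n≤o⇒m≤o M N n≥)))
         (ℚ.≤-trans (ℚ.≤-reflexive (swap-- (seq x n) (seq y n))) (p≤q+r⇒p-q≤r (g n (ℕ.m⊔n≤o⇒n≤o M N n≥))))

  ≤-trans : ∀ {x y z} → x ≤ y → y ≤ z → x ≤ z
  ≤-trans {x} {y} {z} x≤y y≤z ε 0<ε =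
    let M , h = x≤y (½ ℚ.* ε) (half 0<ε)
        N , g = y≤z (½ ℚ.* ε) (half 0<ε)
    in M ⊔ N , λ n n≥ → begin
      seq x n                                  ≤⟨ h n (ℕ.m⊔n≤o⇒m≤o M N n≥) ⟩
      seq y n ℚ.+ ½ ℚ.* ε                      ≤⟨ ℚ.+-monoˡ-≤ (½ ℚ.* ε) (g n (ℕ.m⊔n≤o⇒n≤o M N n≥)) ⟩
      seq z n ℚ.+ ½ ℚ.* ε ℚ.+ ½ ℚ.* ε          ≡⟨ ℚ.+-assoc (seq z n) _ _ ⟩
      seq z n ℚ.+ (½ ℚ.* ε ℚ.+ ½ ℚ.* ε)        ≡⟨ cong (seq z n ℚ.+_) (halves ε) ⟩
      seq z n ℚ.+ ε                            ∎

  +-mono-≤ : ∀ {x y z w} → x ≤ y → z ≤ w → x + z ≤ y + w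
  +-mono-≤ {x} {y} {z} {w} x≤y z≤w ε 0<ε =
    let M , h = x≤y (½ ℚ.* ε) (half 0<ε)
        N , g = z≤w (½ ℚ.* ε) (half 0<ε)
    in M ⊔ N , λ n n≥ → begin
      seq x n ℚ.+ seq z n
        ≤⟨ ℚ.+-mono-≤ (h n (ℕ.m⊔n≤o⇒m≤o M N n≥)) (g n (ℕ.m⊔n≤o⇒n≤o M N n≥)) ⟩
      (seq y n ℚ.+ ½ ℚ.* ε) ℚ.+ (seq w n ℚ.+ ½ ℚ.* ε)
        ≡⟨ lemma (seq y n) (seq w n) (½ ℚ.* ε) ⟩
      (seq y n ℚ.+ seq w n) ℚ.+ (½ ℚ.* ε ℚ.+ ½ ℚ.* ε)
        ≡⟨ cong (seq y n ℚ.+ seq w n ℚ.+_) (halves ε) ⟩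
      (seq y n ℚ.+ seq w n) ℚ.+ ε ∎
    where
    lemma : ∀ y w δ → (y ℚ.+ δ) ℚ.+ (w ℚ.+ δ) ≡ (y ℚ.+ w) ℚ.+ (δ ℚ.+ δ)
    lemma = solve 3 (λ y w δ → (y :+ δ) :+ (w :+ δ) := (y :+ w) :+ (δ :+ δ)) refl

  ≈-pointwise : ∀ {x y} → seq x ≗ seq y → x ≈ y
  ≈-pointwise {x} {y} eq = ≤-antisym {x} {y}
    (≤-pointwise {x} {y} λ n → ℚ.≤-reflexive (eq n)) (≤-pointwise {y} {x} λ n → ℚ.≤-reflexive (sym (eq n)))

  ≤-refl : ∀ {x} → x ≤ x
  ≤-refl {x} = ≤-pointwise {x} {x} λ n → ℚ.≤-refl

  ≈-refl : ∀ {x} → x ≈ x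
  ≈-refl {x} = ≈-pointwise {x} {x} λ n → refl

  ≈-sym : ∀ {x y} → x ≈ y → y ≈ x
  ≈-sym {x} {y} x≈y ε 0<ε = let N , h = x≈y ε 0<ε in
    N , λ n N≤n → subst (ℚ._≤ ε)
      (trans (sym (ℚ.∣-p∣≡∣p∣ (seq x n ℚ.- seq y n))) (cong ℚ.∣_∣ (swap-- (seq x n) (seq y n))))
      (h n N≤n)

  ≈-trans : ∀ {x y z} → x ≈ y → y ≈ z → x ≈ z
  ≈-trans {x} {y} {z} x≈y y≈z = ≤-antisym {x} {z}
    (≤-trans {x} {y} {z} (≈⇒≤ {x} {y} x≈y) (≈⇒≤ {y} {z} y≈z))
    (≤-trans {z} {y} {x} (≈⇒≤ {z} {y} (≈-sym {y} {z} y≈z)) (≈⇒≤ {y} {x} (≈-sym {x} {y} x≈y)))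

  +-cong : ∀ {x y z w} → x ≈ y → z ≈ w → x + z ≈ y + w
  +-cong {x} {y} {z} {w} x≈y z≈w = ≤-antisym {x + z} {y + w}
    (+-mono-≤ {x} {y} {z} {w} (≈⇒≤ {x} {y} x≈y) (≈⇒≤ {z} {w} z≈w))
    (+-mono-≤ {y} {x} {w} {z} (≈⇒≤ {y} {x} (≈-sym {x} {y} x≈y)) (≈⇒≤ {w} {z} (≈-sym {z} {w} z≈w)))

  +-cancelˡ-≤ : ∀ x {y z} → x + y ≤ x + z → y ≤ z
  +-cancelˡ-≤ x {y} {z} le ε 0<ε = let N , h = le ε 0<ε in N , λ n N≤n → begin
    seq y n                                            ≡⟨ lemma₁ (seq x n) (seq y n) ⟩
    ℚ.- seq x n ℚ.+ (seq x n ℚ.+ seq y n)              ≤⟨ ℚ.+-monoʳ-≤ (ℚ.- seq x n) (h n N≤n) ⟩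
    ℚ.- seq x n ℚ.+ ((seq x n ℚ.+ seq z n) ℚ.+ ε)      ≡⟨ lemma₂ (seq x n) (seq z n) ε ⟩
    seq z n ℚ.+ ε                                      ∎
    where
    lemma₁ : ∀ x y → y ≡ ℚ.- x ℚ.+ (x ℚ.+ y)
    lemma₁ = solve 2 (λ x y → y := :- x :+ (x :+ y)) refl
    lemma₂ : ∀ x z ε → ℚ.- x ℚ.+ ((x ℚ.+ z) ℚ.+ ε) ≡ z ℚ.+ ε
    lemma₂ = solve 3 (λ x z ε → :- x :+ ((x :+ z) :+ ε) := z :+ ε) refl

  fromℚ-injective : ∀ {p q} → fromℚ p ≈ fromℚ q → p ≡ q
  fromℚ-injective {p} {q} p≈q = ℚ.≤-antisym
    (cancel (≈⇒≤ {fromℚ p} {fromℚ q} p≈q)) (cancel (≈⇒≤ {fromℚ q} {fromℚ p} (≈-sym {fromℚ p} {fromℚ q} p≈q)))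
    where
    cancel : ∀ {p q} → fromℚ p ≤ fromℚ q → p ℚ.≤ q
    cancel {p} {q} le = ℚ.≮⇒≥ λ q<p →
      let r , q<r , r<p = ℚ.<-dense q<p
          0<r-q = subst (ℚ._< r ℚ.- q) (ℚ.+-inverseʳ q) (ℚ.+-monoˡ-< (ℚ.- q) q<r)
          N , h = le (r ℚ.- q) 0<r-q
      in ℚ.<-irrefl refl (ℚ.<-≤-trans r<p (ℚ.≤-trans (h N ℕ.≤-refl) (ℚ.≤-reflexive (lemma q r))))
      where
      lemma : ∀ q r → q ℚ.+ (r ℚ.- q) ≡ r
      lemma = solve 2 (λ q r → q :+ (r :- q) := r) refl

  +-0-commutativeMonoid : CommutativeMonoid 0ℓ 0ℓ
  +-0-commutativeMonoid = record
    { Carrier = ℝ ; _≈_ = _≈_ ; _∙_ = _+_ ; ε = 0ℝ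
    ; isCommutativeMonoid = record
      { isMonoid = record
        { isSemigroup = record
          { isMagma = record
            { isEquivalence = record
              { refl = λ {x} → ≈-refl {x}
              ; sym = λ {x} {y} → ≈-sym {x} {y}
              ; trans = λ {x} {y} {z} → ≈-trans {x} {y} {z} }
            ; ∙-cong = λ {x} {y} {z} {w} → +-cong {x} {y} {z} {w} }
          ; assoc = λ x y z → ≈-pointwise {x + y + z} {x + (y + z)} λ n → ℚ.+-assoc (seq x n) (seq y n) (seq z n) }
        ; identity = (λ x → ≈-pointwise {0ℝ + x} {x} λ n → ℚ.+-identityˡ (seq x n))
                   , (λ x → ≈-pointwise {x + 0ℝ} {x} λ n → ℚ.+-identityʳ (seq x n)) }
      ; comm = λ x y → ≈-pointwise {x + y} {y + x} λ n → ℚ.+-comm (seq x n) (seq y n) } }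

open Real public

module ∑ℝ = Summation +-0-commutativeMonoid
open ∑ℝ using () renaming (∑ to ∑ʳ) public

-- Matrices with constant line sums

-- The weight arguments use addition, order and cancellation only. `Solution` and `OrderedSums` can
-- thus serve both the reals of a given point and the rationals of a constructed one.
record OrderedCommutativeMonoid : Set₁ where
  field
    commutativeMonoid : CommutativeMonoid 0ℓ 0ℓ

  open CommutativeMonoid commutativeMonoid public
    renaming (_≈_ to _≈ₘ_; _∙_ to _+ₘ_; ε to 0ₘ; refl to ≈ₘ-refl; sym to ≈ₘ-sym; trans to ≈ₘ-trans;
              reflexive to ≈ₘ-reflexive; ∙-cong to +ₘ-cong; ∙-congˡ to +ₘ-congˡ; ∙-congʳ to +ₘ-congʳ;
              identityˡ to +ₘ-identityˡ; identityʳ to +ₘ-identityʳ; comm to +ₘ-comm)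
    using (Carrier; setoid; monoid)

  infix 4 _≤ₘ_
  field
    _≤ₘ_         : Rel Carrier 0ℓ
    ≤ₘ-reflexive : ∀ {x y} → x ≈ₘ y → x ≤ₘ y
    ≤ₘ-trans     : ∀ {x y z} → x ≤ₘ y → y ≤ₘ z → x ≤ₘ z
    ≤ₘ-antisym   : ∀ {x y} → x ≤ₘ y → y ≤ₘ x → x ≈ₘ y
    +ₘ-mono-≤    : ∀ {x y z w} → x ≤ₘ y → z ≤ₘ w → x +ₘ z ≤ₘ y +ₘ w
    +ₘ-cancelˡ-≤ : ∀ x {y z} → x +ₘ y ≤ₘ x +ₘ z → y ≤ₘ z

module OrderedSums (M : OrderedCommutativeMonoid) where

  open OrderedCommutativeMonoid M
  open Summation commutativeMonoid
  open import Algebra.Properties.Monoid.Mult monoid using (×-homo-+; ×-congˡ) renaming (_×_ to _·_)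

  ∑-≥0 : ∀ (xs : List I) {f : I → Carrier} → (∀ i → 0ₘ ≤ₘ f i) → 0ₘ ≤ₘ ∑ xs f
  ∑-≥0 []       f≥0 = ≤ₘ-reflexive ≈ₘ-refl
  ∑-≥0 (x ∷ xs) f≥0 = ≤ₘ-trans (≤ₘ-reflexive (≈ₘ-sym (+ₘ-identityˡ 0ₘ))) (+ₘ-mono-≤ (f≥0 x) (∑-≥0 xs f≥0))

  ≤-+ʳ : ∀ {x y} → 0ₘ ≤ₘ y → x ≤ₘ x +ₘ y
  ≤-+ʳ {x} y≥0 = ≤ₘ-trans (≤ₘ-reflexive (≈ₘ-sym (+ₘ-identityʳ x))) (+ₘ-mono-≤ (≤ₘ-reflexive ≈ₘ-refl) y≥0)

  ≤-+ˡ : ∀ {x y} → 0ₘ ≤ₘ y → x ≤ₘ y +ₘ x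
  ≤-+ˡ y≥0 = ≤ₘ-trans (≤-+ʳ y≥0) (≤ₘ-reflexive (+ₘ-comm _ _))

  ≤-∑ : ∀ {xs : List I} {f : I → Carrier} → (∀ i → 0ₘ ≤ₘ f i) → ∀ {i} → i ∈ˡ xs → f i ≤ₘ ∑ xs f
  ≤-∑ {xs = _ ∷ xs} f≥0 (here refl) = ≤-+ʳ (∑-≥0 xs f≥0)
  ≤-∑ f≥0 (there {x = x} i∈xs) = ≤ₘ-trans (≤-∑ f≥0 i∈xs) (≤-+ˡ (f≥0 x))

  +-≤-∑ : ∀ {xs : List I} {f : I → Carrier} → (∀ i → 0ₘ ≤ₘ f i) →
          ∀ {i j} → i ≢ j → i ∈ˡ xs → j ∈ˡ xs → f i +ₘ f j ≤ₘ ∑ xs f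
  +-≤-∑ f≥0 i≢j (here refl)          (here refl)  = contradiction refl i≢j
  +-≤-∑ f≥0 i≢j (here refl)          (there j∈xs) = +ₘ-mono-≤ (≤ₘ-reflexive ≈ₘ-refl) (≤-∑ f≥0 j∈xs)
  +-≤-∑ f≥0 i≢j (there i∈xs)         (here refl)  =
    ≤ₘ-trans (≤ₘ-reflexive (+ₘ-comm _ _)) (+ₘ-mono-≤ (≤ₘ-reflexive ≈ₘ-refl) (≤-∑ f≥0 i∈xs))
  +-≤-∑ f≥0 i≢j (there {x = x} i∈xs) (there j∈xs) = ≤ₘ-trans (+-≤-∑ f≥0 i≢j i∈xs j∈xs) (≤-+ˡ (f≥0 x))

  ·-≥0 : ∀ m {s} → 0ₘ ≤ₘ s → 0ₘ ≤ₘ m · s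
  ·-≥0 zero    s≥0 = ≤ₘ-reflexive ≈ₘ-refl
  ·-≥0 (suc m) s≥0 = ≤ₘ-trans s≥0 (≤-+ʳ (·-≥0 m s≥0))

  -- Writing `b` as `a + 1 + c` and cancelling `a · s` leaves `s + c · s ≤ 0`, whence `s ≤ 0`.
  ·-cancel-< : ∀ {a b s} → 0ₘ ≤ₘ s → a ℕ.< b → a · s ≈ₘ b · s → s ≈ₘ 0ₘ
  ·-cancel-< {a} {b} {s} s≥0 a<b eq with ℕ.m≤n⇒∃[o]m+o≡n a<b
  ... | c , refl = ≤ₘ-antisym
    (≤ₘ-trans (≤-+ʳ (·-≥0 c s≥0)) (+ₘ-cancelˡ-≤ (a · s) (≤ₘ-reflexive (begin
      a · s +ₘ (s +ₘ c · s)      ≈⟨ ×-homo-+ s a (suc c) ⟨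
      (a ℕ.+ suc c) · s          ≈⟨ ×-congˡ (ℕ.+-suc a c) ⟩
      suc (a ℕ.+ c) · s          ≈⟨ eq ⟨
      a · s                      ≈⟨ +ₘ-identityʳ (a · s) ⟨
      a · s +ₘ 0ₘ                ∎))))
    s≥0
    where open import Relation.Binary.Reasoning.Setoid setoid

  ·-cancel-≢ : ∀ {a b s} → 0ₘ ≤ₘ s → a ≢ b → a · s ≈ₘ b · s → s ≈ₘ 0ₘ
  ·-cancel-≢ {a} {b} s≥0 a≢b eq with ℕ.<-cmp a b
  ... | tri< a<b _ _ = ·-cancel-< s≥0 a<b eq
  ... | tri≈ _ a≡b _ = contradiction a≡b a≢b
  ... | tri> _ _ b<a = ·-cancel-< s≥0 b<a (≈ₘ-sym eq)

  infixr 5 _?·_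
  _?·_ : {P : Set ℓ} → Dec P → Carrier → Carrier
  P? ?· x = if does P? then x else 0ₘ

  ?·-cong : {P : Set ℓ} (P? : Dec P) → ∀ {x y} → (P → x ≈ₘ y) → (P? ?· x) ≈ₘ (P? ?· y)
  ?·-cong (yes p) x≈y = x≈y p
  ?·-cong (no ¬p) x≈y = ≈ₘ-refl

  ?·-∑ : {P : Set ℓ} (P? : Dec P) (xs : List I) (f : I → Carrier) → (P? ?· ∑ xs f) ≈ₘ ∑ xs (λ i → P? ?· f i)
  ?·-∑ (yes p) xs f = ≈ₘ-refl
  ?·-∑ (no ¬p) xs f = ≈ₘ-sym (∑-ε xs λ _ → ≈ₘ-refl)

  ∑-?· : {P : I → Set ℓ} (P? : Decidable P) (xs : List I) (s : Carrier) →
         ∑ xs (λ i → P? i ?· s) ≈ₘ ∑ⁿ xs (ι ∘ P?) · s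
  ∑-?· P? []       s = ≈ₘ-refl
  ∑-?· P? (x ∷ xs) s with does (P? x)
  ... | true  = +ₘ-congˡ (∑-?· P? xs s)
  ... | false = ≈ₘ-trans (+ₘ-identityˡ _) (∑-?· P? xs s)

  -- Class by class, the rows and the columns of a matrix with constant line
  -- sums s that respects the classes carry the same total weight.
  module _ {C : Set} (_≟_ : DecidableEquality C) (xs : List I) (f g : I → C) (m : I → I → Carrier) {s : Carrier}
    (s≥0 : 0ₘ ≤ₘ s) (rows : ∀ i → ∑ xs (m i) ≈ₘ s) (cols : ∀ j → ∑ xs (λ i → m i j) ≈ₘ s)
    (respects : ∀ i j → f i ≢ g j → m i j ≈ₘ 0ₘ) where

    open Counting _≟_
    open import Relation.Binary.Reasoning.Setoid setoid

    classWeights : ∀ c → count c (map f xs) · s ≈ₘ count c (map g xs) · s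
    classWeights c = begin
      count c (map f xs) · s                            ≈⟨ ×-congˡ (∑ℕ.∑-map f xs _) ⟩
      ∑ⁿ xs (λ i → ι (c ≟ f i)) · s                     ≈⟨ ∑-?· (λ i → c ≟ f i) xs s ⟨
      ∑ xs (λ i → c ≟ f i ?· s)                         ≈⟨ ∑-cong xs (λ i → ?·-cong (c ≟ f i) λ _ → rows i) ⟨
      ∑ xs (λ i → c ≟ f i ?· ∑ xs (m i))                ≈⟨ ∑-cong xs (λ i → ?·-∑ (c ≟ f i) xs (m i)) ⟩
      ∑ xs (λ i → ∑ xs (λ j → c ≟ f i ?· m i j))        ≈⟨ ∑-cong xs (λ i → ∑-cong xs (sameClass i)) ⟩
      ∑ xs (λ i → ∑ xs (λ j → c ≟ g j ?· m i j))        ≈⟨ ∑-swap xs xs _ ⟩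
      ∑ xs (λ j → ∑ xs (λ i → c ≟ g j ?· m i j))        ≈⟨ ∑-cong xs (λ j → ?·-∑ (c ≟ g j) xs (λ i → m i j)) ⟨
      ∑ xs (λ j → c ≟ g j ?· ∑ xs (λ i → m i j))        ≈⟨ ∑-cong xs (λ j → ?·-cong (c ≟ g j) λ _ → cols j) ⟩
      ∑ xs (λ j → c ≟ g j ?· s)                         ≈⟨ ∑-?· (λ j → c ≟ g j) xs s ⟩
      ∑ⁿ xs (λ j → ι (c ≟ g j)) · s                     ≈⟨ ×-congˡ (∑ℕ.∑-map g xs _) ⟨
      count c (map g xs) · s                            ∎
      where
      sameClass : ∀ i j → (c ≟ f i ?· m i j) ≈ₘ (c ≟ g j ?· m i j)
      sameClass i j with c ≟ f i | c ≟ g j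
      ... | yes _ | yes _ = ≈ₘ-refl
      ... | no _  | no _  = ≈ₘ-refl
      ... | yes p | no ¬q = respects i j λ eq → ¬q (trans p eq)
      ... | no ¬p | yes q = ≈ₘ-sym (respects i j λ eq → ¬p (trans q (sym eq)))

    -- The split is on the colour lists, which can be compared, since whether a real `s` vanishes
    -- cannot be decided.
    ≈0⊎↭ : s ≈ₘ 0ₘ ⊎ map f xs ↭ map g xs
    ≈0⊎↭ with ↭⊎count≢ (map f xs) (map g xs)
    ... | inj₁ p        = inj₂ p
    ... | inj₂ (c , c≢) = inj₁ (·-cancel-≢ s≥0 c≢ (classWeights c))

-- From a point of the relaxation to matchings of colours

∣p∪⁅x⁆∣≤1+∣p∣ : ∀ {N} (p : Subset N) x → ∣ p ∪ ⁅ x ⁆ ∣ ℕ.≤ suc ∣ p ∣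
∣p∪⁅x⁆∣≤1+∣p∣ (true ∷ p)  zero    = s≤s (ℕ.≤-trans (ℕ.≤-reflexive (cong ∣_∣ (∪-identityʳ p))) (ℕ.n≤1+n _))
∣p∪⁅x⁆∣≤1+∣p∣ (false ∷ p) zero    = s≤s (ℕ.≤-reflexive (cong ∣_∣ (∪-identityʳ p)))
∣p∪⁅x⁆∣≤1+∣p∣ (true ∷ p)  (suc x) = s≤s (∣p∪⁅x⁆∣≤1+∣p∣ p x)
∣p∪⁅x⁆∣≤1+∣p∣ (false ∷ p) (suc x) = ∣p∪⁅x⁆∣≤1+∣p∣ p x

p∪⁅x⁆≡p : ∀ {N} {p : Subset N} {x} → x ∈ p → p ∪ ⁅ x ⁆ ≡ p
p∪⁅x⁆≡p {p = p} {x} x∈p = ⊆-antisym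
  (λ y∈ → [ id , (λ y∈⁅x⁆ → subst (_∈ p) (sym (x∈⁅y⁆⇒x≡y x y∈⁅x⁆)) x∈p) ]′ (x∈p∪q⁻ p ⁅ x ⁆ y∈))
  (p⊆p∪q ⁅ x ⁆)

p∪⁅x⁆∪⁅y⁆≡p : ∀ {N} {p : Subset N} {x y} → x ∈ p → y ∈ p → (p ∪ ⁅ x ⁆) ∪ ⁅ y ⁆ ≡ p
p∪⁅x⁆∪⁅y⁆≡p {y = y} x∈p y∈p = trans (cong (_∪ ⁅ y ⁆) (p∪⁅x⁆≡p x∈p)) (p∪⁅x⁆≡p y∈p)

∈-∪⁅⁆⁻ : ∀ {N} (p : Subset N) x {y} → y ∈ p ∪ ⁅ x ⁆ → y ∈ p ⊎ y ≡ x
∈-∪⁅⁆⁻ p x y∈ = map₂ (x∈⁅y⁆⇒x≡y x) (x∈p∪q⁻ p ⁅ x ⁆ y∈)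

∈-∪⁅⁆ˡ : ∀ {N} {p : Subset N} {x y} → y ∈ p → y ∈ p ∪ ⁅ x ⁆
∈-∪⁅⁆ˡ {x = x} = p⊆p∪q ⁅ x ⁆

∈-∪⁅⁆ʳ : ∀ {N} (p : Subset N) x → x ∈ p ∪ ⁅ x ⁆
∈-∪⁅⁆ʳ p x = q⊆p∪q p ⁅ x ⁆ (x∈⁅x⁆ x)

infix 7 _↦_
_↦_ : ∀ {n} → Fin n → Fin n → Fin (n ℕ.* n)
_↦_ = combine

module _ {n : ℕ} where

  pairs : ∀ {j} → Tuple n j → Tuple n j → Subset (n ℕ.* n)
  pairs []      []      = ⊥ₛ
  pairs (a ∷ u) (b ∷ v) = pairs u v ∪ ⁅ a ↦ b ⁆

  ∈-pairs⁺ : ∀ {j} (u v : Tuple n j) i → lookup u i ↦ lookup v i ∈ pairs u v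
  ∈-pairs⁺ (a ∷ u) (b ∷ v) zero    = ∈-∪⁅⁆ʳ (pairs u v) (a ↦ b)
  ∈-pairs⁺ (a ∷ u) (b ∷ v) (suc i) = ∈-∪⁅⁆ˡ (∈-pairs⁺ u v i)

  ∈-pairs⁻ : ∀ {j} (u v : Tuple n j) {x} → x ∈ pairs u v → ∃ λ i → x ≡ lookup u i ↦ lookup v i
  ∈-pairs⁻ []      []      x∈ = contradiction x∈ ∉⊥
  ∈-pairs⁻ (a ∷ u) (b ∷ v) x∈ with ∈-∪⁅⁆⁻ (pairs u v) (a ↦ b) x∈
  ... | inj₁ x∈′ = let i , eq = ∈-pairs⁻ u v x∈′ in suc i , eq
  ... | inj₂ eq  = zero , eq

  ∣pairs∣≤ : ∀ {j} (u v : Tuple n j) → ∣ pairs u v ∣ ℕ.≤ j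
  ∣pairs∣≤ []      []      = ℕ.≤-reflexive (∣⊥∣≡0 (n ℕ.* n))
  ∣pairs∣≤ (a ∷ u) (b ∷ v) = ℕ.≤-trans (∣p∪⁅x⁆∣≤1+∣p∣ (pairs u v) (a ↦ b)) (s≤s (∣pairs∣≤ u v))

  -- Restoring the overwritten entry turns a replacement into an extension. Hence `z` at an
  -- extension is controlled by `Y` at the replaced tuples, where the induction on rounds applies.
  pairs-φ : ∀ {j} (u v : Tuple n j) i w w′ →
            pairs (φ i u w) (φ i v w′) ∪ ⁅ lookup u i ↦ lookup v i ⁆ ≡ pairs u v ∪ ⁅ w ↦ w′ ⁆
  pairs-φ u v i w w′ = ⊆-antisym ⊆₁ ⊆₂
    where
    ⊆₁ : pairs (φ i u w) (φ i v w′) ∪ ⁅ lookup u i ↦ lookup v i ⁆ ⊆ pairs u v ∪ ⁅ w ↦ w′ ⁆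
    ⊆₁ x∈ with ∈-∪⁅⁆⁻ (pairs (φ i u w) (φ i v w′)) _ x∈
    ... | inj₂ refl = ∈-∪⁅⁆ˡ (∈-pairs⁺ u v i)
    ... | inj₁ x∈′ with ∈-pairs⁻ (φ i u w) (φ i v w′) x∈′
    ...   | j , refl with j Fin.≟ i
    ...     | yes refl = subst (_∈ pairs u v ∪ ⁅ w ↦ w′ ⁆)
      (sym (cong₂ _↦_ (Vec.lookup∘update i u w) (Vec.lookup∘update i v w′))) (∈-∪⁅⁆ʳ (pairs u v) (w ↦ w′))
    ...     | no j≢i   = subst (_∈ pairs u v ∪ ⁅ w ↦ w′ ⁆)
      (sym (cong₂ _↦_ (Vec.lookup∘update′ j≢i u w) (Vec.lookup∘update′ j≢i v w′))) (∈-∪⁅⁆ˡ (∈-pairs⁺ u v j))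

    ⊆₂ : pairs u v ∪ ⁅ w ↦ w′ ⁆ ⊆ pairs (φ i u w) (φ i v w′) ∪ ⁅ lookup u i ↦ lookup v i ⁆
    ⊆₂ x∈ with ∈-∪⁅⁆⁻ (pairs u v) _ x∈
    ... | inj₂ refl = ∈-∪⁅⁆ˡ (subst (_∈ pairs (φ i u w) (φ i v w′))
      (cong₂ _↦_ (Vec.lookup∘update i u w) (Vec.lookup∘update i v w′)) (∈-pairs⁺ (φ i u w) (φ i v w′) i))
    ... | inj₁ x∈′ with ∈-pairs⁻ u v x∈′
    ...   | j , refl with j Fin.≟ i
    ...     | yes refl = ∈-∪⁅⁆ʳ (pairs (φ i u w) (φ i v w′)) _
    ...     | no j≢i   = ∈-∪⁅⁆ˡ (subst (_∈ pairs (φ i u w) (φ i v w′))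
      (cong₂ _↦_ (Vec.lookup∘update′ j≢i u w) (Vec.lookup∘update′ j≢i v w′)) (∈-pairs⁺ (φ i u w) (φ i v w′) j))

  pairs-replicate : ∀ k (a b : Fin n) → pairs (replicate (suc k) a) (replicate (suc k) b) ≡ ⁅ a ↦ b ⁆
  pairs-replicate zero    a b = ∪-identityˡ ⁅ a ↦ b ⁆
  pairs-replicate (suc k) a b = trans (cong (_∪ ⁅ a ↦ b ⁆) (pairs-replicate k a b)) (∪-idem ⁅ a ↦ b ⁆)

-- z S is the value of the monomial with support S in a lift of level k + 1.
record Solution {n : ℕ} (k : ℕ) (G H : SimpleGraph n) (M : OrderedCommutativeMonoid)
  (z : Subset (n ℕ.* n) → OrderedCommutativeMonoid.Carrier M) : Set where
  open OrderedCommutativeMonoid M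
  open Summation commutativeMonoid
  field
    nonneg   : ∀ S → ∣ S ∣ ℕ.≤ suc k → 0ₘ ≤ₘ z S
    row-sum  : ∀ S u → ∣ S ∣ ℕ.≤ k → ∑ (allFin n) (λ v → z (S ∪ ⁅ u ↦ v ⁆)) ≈ₘ z S
    col-sum  : ∀ S v → ∣ S ∣ ℕ.≤ k → ∑ (allFin n) (λ u → z (S ∪ ⁅ u ↦ v ⁆)) ≈ₘ z S
    edge-nonedge≈0 : ∀ S {u₁ u₂ v₁ v₂} → ∣ S ∣ ℕ.≤ k → Adj G u₁ u₂ → ¬ Adj H v₁ v₂ →
      z ((S ∪ ⁅ u₁ ↦ v₁ ⁆) ∪ ⁅ u₂ ↦ v₂ ⁆) ≈ₘ 0ₘ
    nonedge-edge≈0 : ∀ S {u₁ u₂ v₁ v₂} → ∣ S ∣ ℕ.≤ k → ¬ Adj G u₁ u₂ → Adj H v₁ v₂ →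
      z ((S ∪ ⁅ u₁ ↦ v₁ ⁆) ∪ ⁅ u₂ ↦ v₂ ⁆) ≈ₘ 0ₘ

module FromSolution {n k : ℕ} {G H : SimpleGraph n} (M : OrderedCommutativeMonoid)
  {z : Subset (n ℕ.* n) → OrderedCommutativeMonoid.Carrier M} (solution : Solution k G H M z)
  (z⊥≉0 : ¬ OrderedCommutativeMonoid._≈ₘ_ M (z ⊥ₛ) (OrderedCommutativeMonoid.0ₘ M)) where

  open OrderedCommutativeMonoid M
  open Solution solution
  open Summation commutativeMonoid
  open OrderedSums M
  open WL {n} {k}

  z-cong : ∀ {S T} → S ≡ T → z S ≈ₘ z T
  z-cong eq = ≈ₘ-reflexive (cong z eq)

  Y : Tuple n k → Tuple n k → Carrier
  Y u v = z (pairs u v)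

  nonneg-∪ : ∀ S x → ∣ S ∣ ℕ.≤ k → 0ₘ ≤ₘ z (S ∪ ⁅ x ⁆)
  nonneg-∪ S x S≤k = nonneg _ (ℕ.≤-trans (∣p∪⁅x⁆∣≤1+∣p∣ S x) (s≤s S≤k))

  row-sums : ∀ {j} → j ℕ.≤ suc k → ∀ (u : Tuple n j) → ∑ (allTuples n j) (λ v → z (pairs u v)) ≈ₘ z ⊥ₛ
  row-sums {zero}  j≤ []      = +ₘ-identityʳ _
  row-sums {suc j} (s≤s j≤k) (a ∷ u) = begin
    ∑ (allTuples n (suc j)) (λ v → z (pairs (a ∷ u) v))
      ≈⟨ ∑-cartesianProductWith _∷_ (allFin n) (allTuples n j) _ ⟩
    ∑ (allFin n) (λ b → ∑ (allTuples n j) (λ v → z (pairs u v ∪ ⁅ a ↦ b ⁆)))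
      ≈⟨ ∑-swap (allFin n) (allTuples n j) _ ⟩
    ∑ (allTuples n j) (λ v → ∑ (allFin n) (λ b → z (pairs u v ∪ ⁅ a ↦ b ⁆)))
      ≈⟨ ∑-cong (allTuples n j) (λ v → row-sum (pairs u v) a (ℕ.≤-trans (∣pairs∣≤ u v) j≤k)) ⟩
    ∑ (allTuples n j) (λ v → z (pairs u v))
      ≈⟨ row-sums (ℕ.m≤n⇒m≤1+n j≤k) u ⟩
    z ⊥ₛ ∎
    where open import Relation.Binary.Reasoning.Setoid setoid

  col-sums : ∀ {j} → j ℕ.≤ suc k → ∀ (v : Tuple n j) → ∑ (allTuples n j) (λ u → z (pairs u v)) ≈ₘ z ⊥ₛ
  col-sums {zero}  j≤ []      = +ₘ-identityʳ _
  col-sums {suc j} (s≤s j≤k) (b ∷ v) = begin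
    ∑ (allTuples n (suc j)) (λ u → z (pairs u (b ∷ v)))
      ≈⟨ ∑-cartesianProductWith _∷_ (allFin n) (allTuples n j) _ ⟩
    ∑ (allFin n) (λ a → ∑ (allTuples n j) (λ u → z (pairs u v ∪ ⁅ a ↦ b ⁆)))
      ≈⟨ ∑-swap (allFin n) (allTuples n j) _ ⟩
    ∑ (allTuples n j) (λ u → ∑ (allFin n) (λ a → z (pairs u v ∪ ⁅ a ↦ b ⁆)))
      ≈⟨ ∑-cong (allTuples n j) (λ u → col-sum (pairs u v) b (ℕ.≤-trans (∣pairs∣≤ u v) j≤k)) ⟩
    ∑ (allTuples n j) (λ u → z (pairs u v))
      ≈⟨ col-sums (ℕ.m≤n⇒m≤1+n j≤k) v ⟩
    z ⊥ₛ ∎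
    where open import Relation.Binary.Reasoning.Setoid setoid

  Y-rows : ∀ u → ∑ (allTuples n k) (Y u) ≈ₘ z ⊥ₛ
  Y-rows = row-sums (ℕ.n≤1+n k)

  Y-cols : ∀ v → ∑ (allTuples n k) (λ u → Y u v) ≈ₘ z ⊥ₛ
  Y-cols = col-sums (ℕ.n≤1+n k)

  Y≥0 : ∀ u v → 0ₘ ≤ₘ Y u v
  Y≥0 u v = nonneg (pairs u v) (ℕ.m≤n⇒m≤1+n (∣pairs∣≤ u v))

  ∪-≈0 : ∀ S (a b : Fin n) → ∣ S ∣ ℕ.≤ k → z S ≈ₘ 0ₘ → z (S ∪ ⁅ a ↦ b ⁆) ≈ₘ 0ₘ
  ∪-≈0 S a b S≤k zS≈0 = ≤ₘ-antisym
    (≤ₘ-trans (≤-∑ (λ v → nonneg-∪ S (a ↦ v) S≤k) (∈-allFin b))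
      (≤ₘ-reflexive (≈ₘ-trans (row-sum S a S≤k) zS≈0)))
    (nonneg-∪ S (a ↦ b) S≤k)

  x+x≤x⇒x≈0 : ∀ {x} → 0ₘ ≤ₘ x → x +ₘ x ≤ₘ x → x ≈ₘ 0ₘ
  x+x≤x⇒x≈0 {x} 0≤x le = ≤ₘ-antisym
    (+ₘ-cancelˡ-≤ x (≤ₘ-trans le (≤ₘ-reflexive (≈ₘ-sym (+ₘ-identityʳ x))))) 0≤x

  -- Both pairs already belong to `S`, so the row of `a` over `S` contains the term `z S` twice
  -- while adding up to `z S` once.
  two-values-≈0 : ∀ S (a : Fin n) {b b′} → ∣ S ∣ ℕ.≤ k → b ≢ b′ → a ↦ b ∈ S → a ↦ b′ ∈ S → z S ≈ₘ 0ₘ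
  two-values-≈0 S a S≤k b≢b′ b∈ b′∈ = x+x≤x⇒x≈0 (nonneg S (ℕ.m≤n⇒m≤1+n S≤k)) (≤ₘ-trans
    (≤ₘ-reflexive (+ₘ-cong (z-cong (sym (p∪⁅x⁆≡p b∈))) (z-cong (sym (p∪⁅x⁆≡p b′∈)))))
    (≤ₘ-trans (+-≤-∑ (λ v → nonneg-∪ S (a ↦ v) S≤k) b≢b′ (∈-allFin _) (∈-allFin _))
      (≤ₘ-reflexive (row-sum S a S≤k))))

  two-arguments-≈0 : ∀ S {a a′} (b : Fin n) → ∣ S ∣ ℕ.≤ k → a ≢ a′ → a ↦ b ∈ S → a′ ↦ b ∈ S → z S ≈ₘ 0ₘ
  two-arguments-≈0 S b S≤k a≢a′ a∈ a′∈ = x+x≤x⇒x≈0 (nonneg S (ℕ.m≤n⇒m≤1+n S≤k)) (≤ₘ-trans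
    (≤ₘ-reflexive (+ₘ-cong (z-cong (sym (p∪⁅x⁆≡p a∈))) (z-cong (sym (p∪⁅x⁆≡p a′∈)))))
    (≤ₘ-trans (+-≤-∑ (λ u → nonneg-∪ S (u ↦ b) S≤k) a≢a′ (∈-allFin _) (∈-allFin _))
      (≤ₘ-reflexive (col-sum S b S≤k))))

  atomicType-≢⇒≈0 : ∀ S {a a′ b b′ : Fin n} → ∣ S ∣ ℕ.≤ k → a ↦ b ∈ S → a′ ↦ b′ ∈ S →
    atomicType G a a′ ≢ atomicType H b b′ → z S ≈ₘ 0ₘ
  atomicType-≢⇒≈0 S {a} {a′} {b} {b′} S≤k p∈ q∈ ≢type
    with a Fin.≟ a′ | b Fin.≟ b′ | adj? G a a′ | adj? H b b′
  ... | yes _    | yes _    | _     | _     = contradiction refl ≢type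
  ... | yes refl | no b≢b′  | _     | _     = two-values-≈0 S a S≤k b≢b′ p∈ q∈
  ... | no a≢a′  | yes refl | _     | _     = two-arguments-≈0 S b S≤k a≢a′ p∈ q∈
  ... | no _     | no _     | yes _ | yes _ = contradiction refl ≢type
  ... | no _     | no _     | no _  | no _  = contradiction refl ≢type
  ... | no _     | no _     | yes e | no ¬e = ≈ₘ-trans (z-cong (sym (p∪⁅x⁆∪⁅y⁆≡p p∈ q∈))) (edge-nonedge≈0 S S≤k e ¬e)
  ... | no _     | no _     | no ¬e | yes e = ≈ₘ-trans (z-cong (sym (p∪⁅x⁆∪⁅y⁆≡p p∈ q∈))) (nonedge-edge≈0 S S≤k ¬e e)

  𝓒-≢⇒≈0 : ∀ u v → 𝓒 G u ≢ 𝓒 H v → Y u v ≈ₘ 0ₘ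
  𝓒-≢⇒≈0 u v u≢v with Fin.any? (λ i → Fin.any? λ j → ¬? (type G u i j ℤ.≟ type H v i j))
    where
    type : SimpleGraph n → Tuple n k → Fin k → Fin k → ℤ
    type F x i j = atomicType F (lookup x i) (lookup x j)
  ... | yes (i , j , ≢type) =
    atomicType-≢⇒≈0 (pairs u v) (∣pairs∣≤ u v) (∈-pairs⁺ u v i) (∈-pairs⁺ u v j) ≢type
  ... | no ¬≢type = contradiction (𝓒-≡⁺ G H u v λ i j →
    decidable-stable (_ ℤ.≟ _) λ ≢type → ¬≢type (i , j , ≢type)) u≢v

  -- The matrix of values at `pairs u v ∪ ⁅ w ↦ w′ ⁆` has all line sums equal to `Y u v`. Its
  -- entries live on up to k + 1 pairs, which is why level k + 1 goes with k-tuples.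
  D-≢⇒≈0 : ∀ t → (∀ u v → colour G t u ≢ colour H t v → Y u v ≈ₘ 0ₘ) →
           ∀ u v → D (colour G t) u ≢ D (colour H t) v → Y u v ≈ₘ 0ₘ
  D-≢⇒≈0 t colour-≢⇒≈0 u v D≢ with colour G t u ℕ.≟ colour H t v
  ... | no c≢  = colour-≢⇒≈0 u v c≢
  ... | yes c≡ = [ id , (λ p → contradiction (D-≡⁺ (colour G t) (colour H t) u v c≡ p) D≢) ]′
    (≈0⊎↭ (Vec.≡-dec ℕ._≟_) (allFin n) (ωAt (colour G t) u) (ωAt (colour H t) v)
      (λ w w′ → z (pairs u v ∪ ⁅ w ↦ w′ ⁆)) (Y≥0 u v)
      (λ w → row-sum (pairs u v) w (∣pairs∣≤ u v)) (λ w′ → col-sum (pairs u v) w′ (∣pairs∣≤ u v))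
      -- The two vectors of colours differ at some position `i`, and the extension contains the
      -- pairs of the tuples replaced there, at which `z` vanishes by assumption.
      λ w w′ ω≢ →
        let i , c≢ = differ w w′ ω≢
        in ≈ₘ-trans (z-cong (sym (pairs-φ u v i w w′)))
             (∪-≈0 (pairs (φ i u w) (φ i v w′)) (lookup u i) (lookup v i) (∣pairs∣≤ (φ i u w) (φ i v w′))
               (colour-≢⇒≈0 (φ i u w) (φ i v w′) c≢)))
    where
    differ : ∀ w w′ → ωAt (colour G t) u w ≢ ωAt (colour H t) v w′ →
             ∃ λ i → colour G t (φ i u w) ≢ colour H t (φ i v w′)
    differ w w′ ω≢ with Fin.any? (λ i → ¬? (colour G t (φ i u w) ℕ.≟ colour H t (φ i v w′)))
    ... | yes i,≢ = i,≢
    ... | no ¬≢   = contradiction (Vec.tabulate-cong λ i →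
      decidable-stable (colour G t (φ i u w) ℕ.≟ colour H t (φ i v w′)) λ ≢ᵢ → ¬≢ (i , ≢ᵢ)) ω≢

  colour-≢⇒≈0 : ∀ t u v → colour G t u ≢ colour H t v → Y u v ≈ₘ 0ₘ
  colour-≢⇒≈0 = excludes G H (λ u v → Y u v ≈ₘ 0ₘ)
    -- A row of `Y` adds up to `z ⊥ₛ`, so it cannot vanish throughout.
    (λ u Y≈0 → z⊥≉0 (≈ₘ-trans (≈ₘ-sym (Y-rows u)) (∑-ε (allTuples n k) Y≈0)))
    (λ v Y≈0 → z⊥≉0 (≈ₘ-trans (≈ₘ-sym (Y-cols v)) (∑-ε (allTuples n k) Y≈0)))
    𝓒-≢⇒≈0 D-≢⇒≈0

  matching : {C : Set} → DecidableEquality C → (f g : Tuple n k → C) →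
    (∀ u v → f u ≢ g v → Y u v ≈ₘ 0ₘ) → ∃ λ (γ : Tuple n k ↔ Tuple n k) → ∀ u → f u ≡ g (Inverse.to γ u)
  matching _≟_ f g ≢⇒≈0 = map-↭⇒bijection (tuples n k)
    ([ (λ z⊥≈0 → contradiction z⊥≈0 z⊥≉0) , id ]′
      (≈0⊎↭ _≟_ (allTuples n k) f g Y (nonneg ⊥ₛ (ℕ.≤-trans (ℕ.≤-reflexive (∣⊥∣≡0 (n ℕ.* n))) z≤n)) Y-rows Y-cols ≢⇒≈0))

  initialMatching : ∃ λ (γ : Tuple n k ↔ Tuple n k) → ∀ u → 𝓒 G u ≡ 𝓒 H (Inverse.to γ u)
  initialMatching = matching (Vec.≡-dec (Vec.≡-dec ℤ._≟_)) (𝓒 G) (𝓒 H) 𝓒-≢⇒≈0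

  finalMatching : ∀ t → ∃ λ (γ : Tuple n k ↔ Tuple n k) → ∀ u → D (colour G t) u ≡ D (colour H t) (Inverse.to γ u)
  finalMatching t = matching (Product.≡-dec ℕ._≟_ (List.≡-dec (Vec.≡-dec ℕ._≟_)))
    (D (colour G t)) (D (colour H t)) (D-≢⇒≈0 t (colour-≢⇒≈0 t))

  diagonal : (∀ a b → a ≢ b → z ⁅ a ↦ b ⁆ ≈ₘ 0ₘ) → ∀ a → z ⁅ a ↦ a ⁆ ≈ₘ z ⊥ₛ
  diagonal off-diagonal a = begin
    z ⁅ a ↦ a ⁆                                            ≈⟨ +ₘ-identityʳ _ ⟨
    1 · z ⁅ a ↦ a ⁆                                        ≈⟨ ×-congˡ (#-unique (fins n) (Fin._≟ a) refl id) ⟨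
    # (fins n) (Fin._≟ a) · z ⁅ a ↦ a ⁆                    ≈⟨ ∑-?· (Fin._≟ a) (allFin n) (z ⁅ a ↦ a ⁆) ⟨
    ∑ (allFin n) (λ b → (b Fin.≟ a) ?· z ⁅ a ↦ a ⁆)          ≈⟨ ∑-cong (allFin n) only-a ⟩
    ∑ (allFin n) (λ b → z (⊥ₛ ∪ ⁅ a ↦ b ⁆))
      ≈⟨ row-sum ⊥ₛ a (ℕ.≤-trans (ℕ.≤-reflexive (∣⊥∣≡0 (n ℕ.* n))) z≤n) ⟩
    z ⊥ₛ                                                   ∎
    where
    open import Relation.Binary.Reasoning.Setoid setoid
    open import Algebra.Properties.Monoid.Mult monoid using (×-congˡ) renaming (_×_ to _·_)
    only-a : ∀ b → ((b Fin.≟ a) ?· z ⁅ a ↦ a ⁆) ≈ₘ z (⊥ₛ ∪ ⁅ a ↦ b ⁆)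
    only-a b with b Fin.≟ a
    ... | yes refl = z-cong (sym (∪-identityˡ ⁅ a ↦ a ⁆))
    ... | no  b≢a  = ≈ₘ-sym (≈ₘ-trans (z-cong (∪-identityˡ ⁅ a ↦ b ⁆)) (off-diagonal a b (b≢a ∘ sym)))

-- Polynomials as operators on set functions

ℚ-ordered : OrderedCommutativeMonoid
ℚ-ordered = record
  { commutativeMonoid = ℚ.+-0-commutativeMonoid
  ; _≤ₘ_         = ℚ._≤_
  ; ≤ₘ-reflexive = ℚ.≤-reflexive
  ; ≤ₘ-trans     = ℚ.≤-trans
  ; ≤ₘ-antisym   = ℚ.≤-antisym
  ; +ₘ-mono-≤    = ℚ.+-mono-≤
  ; +ₘ-cancelˡ-≤ = λ x {y} {z} le → subst₂ ℚ._≤_ (cancel x y) (cancel x z) (ℚ.+-monoʳ-≤ (ℚ.- x) le)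
  }
  where
  open +-*-Solver
  cancel : ∀ x y → ℚ.- x ℚ.+ (x ℚ.+ y) ≡ y
  cancel = solve 2 (λ x y → :- x :+ (x :+ y) := y) refl

ℝ-ordered : OrderedCommutativeMonoid
ℝ-ordered = record
  { commutativeMonoid = +-0-commutativeMonoid
  ; _≤ₘ_         = _≤_
  ; ≤ₘ-reflexive = λ {x} {y} → ≈⇒≤ {x} {y}
  ; ≤ₘ-trans     = λ {x} {y} {z} → ≤-trans {x} {y} {z}
  ; ≤ₘ-antisym   = λ {x} {y} → ≤-antisym {x} {y}
  ; +ₘ-mono-≤    = λ {x} {y} {z} {w} → +-mono-≤ {x} {y} {z} {w}
  ; +ₘ-cancelˡ-≤ = λ x {y} {z} → +-cancelˡ-≤ x {y} {z}
  }

module ∑ℚ = Summation ℚ.+-0-commutativeMonoid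
open ∑ℚ using () renaming (∑ to ∑ᵠ) public

∑ᵠ-*ˡ : ∀ c (xs : List I) (f : I → ℚ) → ∑ᵠ xs (λ i → c ℚ.* f i) ≡ c ℚ.* ∑ᵠ xs f
∑ᵠ-*ˡ c []       f = sym (ℚ.*-zeroʳ c)
∑ᵠ-*ˡ c (x ∷ xs) f = trans (cong (c ℚ.* f x ℚ.+_) (∑ᵠ-*ˡ c xs f)) (sym (ℚ.*-distribˡ-+ c (f x) _))

seq-∑ : ∀ (xs : List I) (f : I → ℝ) n → seq (∑ʳ xs f) n ≡ ∑ᵠ xs (λ i → seq (f i) n)
seq-∑ []       f n = refl
seq-∑ (x ∷ xs) f n = cong (seq (f x) n ℚ.+_) (seq-∑ xs f n)

squareFree-+ : ∀ {N} (a b : Monomial N) → squareFree (Vec.zipWith ℕ._+_ a b) ≡ squareFree a ∪ squareFree b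
squareFree-+ []          []       = refl
squareFree-+ (zero ∷ a)  (y ∷ b)  = cong (_ ∷_) (squareFree-+ a b)
squareFree-+ (suc x ∷ a) (y ∷ b)  = cong (_ ∷_) (squareFree-+ a b)

squareFree-0 : ∀ N → squareFree (replicate N 0) ≡ ⊥ₛ
squareFree-0 zero    = refl
squareFree-0 (suc N) = cong (false ∷_) (squareFree-0 N)

squareFree-var : ∀ {N} (i : Fin N) → squareFree (replicate N 0 [ i ]≔ 1) ≡ ⁅ i ⁆
squareFree-var {suc N} zero    = cong (true ∷_) (squareFree-0 N)
squareFree-var {suc N} (suc i) = cong (false ∷_) (squareFree-var i)

members : ∀ {N} → Subset N → List (Fin N)
members S = filter (_∈? S) (allFin _)

module _ {N : ℕ} where

  module _ (n : ℕ) where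

    term : (Subset N → ℚ) → Subset N → ℝ × Monomial N → ℚ
    term h S (c , a) = seq c n ℚ.* h (S ∪ squareFree a)

    -- The nth rational approximations of the coefficients of p turn p into an
    -- operator on set functions, x_i acting by h ↦ h (_ ∪ ⁅ i ⁆).  Products
    -- become compositions, so linearisation is evaluation at the values of y.
    act : Poly N → (Subset N → ℚ) → Subset N → ℚ
    act p h S = ∑ᵠ p (term h S)

    linearise-act : ∀ y p → seq (linearise y p) n ≡ act p (λ S → seq (monomialValue y S) n) ⊥ₛ
    linearise-act y []            = refl
    linearise-act y ((c , a) ∷ p) = cong₂ ℚ._+_
      (cong (λ S → seq c n ℚ.* seq (monomialValue y S) n) (sym (∪-identityˡ (squareFree a))))
      (linearise-act y p)

    act-cong : ∀ p {h h′} → h ≗ h′ → act p h ≗ act p h′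
    act-cong p eq S = ∑ℚ.∑-cong p λ (c , a) → cong (seq c n ℚ.*_) (eq (S ∪ squareFree a))

    act-+ₚ : ∀ p q h S → act (p +ₚ q) h S ≡ act p h S ℚ.+ act q h S
    act-+ₚ p q h S = ∑ℚ.∑-++ p q (term h S)

    act-*ₚ : ∀ p q h S → act (p *ₚ q) h S ≡ act p (act q h) S
    act-*ₚ p q h S = trans (∑ℚ.∑-cartesianProductWith _ p q (term h S)) (∑ℚ.∑-cong p λ (c , a) →
      trans (∑ℚ.∑-cong q λ (d , b) → trans (ℚ.*-assoc (seq c n) (seq d n) (h (S ∪ squareFree (Vec.zipWith ℕ._+_ a b))))
          (cong (λ T → seq c n ℚ.* (seq d n ℚ.* h T))
            (trans (cong (S ∪_) (squareFree-+ a b)) (sym (∪-assoc S (squareFree a) (squareFree b))))))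
        (∑ᵠ-*ˡ (seq c n) q (term h (S ∪ squareFree a))))

    act-const : ∀ c h S → act (const c) h S ≡ seq c n ℚ.* h S
    act-const c h S = trans (ℚ.+-identityʳ _)
      (cong (λ T → seq c n ℚ.* h T) (trans (cong (S ∪_) (squareFree-0 N)) (∪-identityʳ S)))

    act-var : ∀ i h S → act (var i) h S ≡ h (S ∪ ⁅ i ⁆)
    act-var i h S = trans (ℚ.+-identityʳ _) (trans (ℚ.*-identityˡ _)
      (cong (λ T → h (S ∪ T)) (squareFree-var i)))

    act--ₚ : ∀ p q h S → act (p -ₚ q) h S ≡ act p h S ℚ.- act q h S
    act--ₚ p q h S = trans (act-+ₚ p (const -1ℝ *ₚ q) h S)
      (cong (act p h S ℚ.+_) (trans (act-*ₚ (const -1ℝ) q h S) (trans (act-const -1ℝ (act q h) S)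
        (solve 1 (λ x → con (ℚ.- 1ℚ) :* x := :- x) refl (act q h S)))))
      where open +-*-Solver

    act-sumₚ : ∀ {m} (f : Fin m → Poly N) h S → act (sumₚ f) h S ≡ ∑ᵠ (allFin m) (λ i → act (f i) h S)
    act-sumₚ {m} f h S = go (allFin m)
      where
      sum : List (Fin m) → Poly N
      sum = foldr (λ i p → f i +ₚ p) []

      go : ∀ xs → act (sum xs) h S ≡ ∑ᵠ xs (λ i → act (f i) h S)
      go []       = refl
      go (x ∷ xs) = trans (act-+ₚ (f x) (sum xs) h S) (cong (act (f x) h S ℚ.+_) (go xs))

    act-∏x : ∀ I h S → act (∏x I) h S ≡ h (S ∪ I)
    act-∏x I h S = trans (go (members I) S) (cong (λ T → h (S ∪ T)) (⊆-antisym ⊆₁ ⊆₂))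
      where
      fromList : List (Fin N) → Subset N
      fromList = foldr (λ i T → ⁅ i ⁆ ∪ T) ⊥ₛ

      product : List (Fin N) → Poly N
      product = foldr (λ i p → var i *ₚ p) (const 1ℝ)

      go : ∀ xs S → act (product xs) h S ≡ h (S ∪ fromList xs)
      go []       S = trans (act-const 1ℝ h S) (trans (ℚ.*-identityˡ (h S)) (cong h (sym (∪-identityʳ S))))
      go (x ∷ xs) S = trans (act-*ₚ (var x) (product xs) h S) (trans (act-var x (act (product xs) h) S)
        (trans (go xs (S ∪ ⁅ x ⁆)) (cong h (∪-assoc S ⁅ x ⁆ (fromList xs)))))

      fromList⁻ : ∀ xs {x} → x ∈ fromList xs → x ∈ˡ xs
      fromList⁻ []       x∈ = contradiction x∈ ∉⊥
      fromList⁻ (y ∷ xs) x∈ = [ here ∘ x∈⁅y⁆⇒x≡y y , there ∘ fromList⁻ xs ]′ (x∈p∪q⁻ ⁅ y ⁆ (fromList xs) x∈)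

      fromList⁺ : ∀ {xs x} → x ∈ˡ xs → x ∈ fromList xs
      fromList⁺ {xs = x ∷ xs} (here refl) = p⊆p∪q (fromList xs) (x∈⁅x⁆ x)
      fromList⁺ {xs = x ∷ xs} (there x∈)  = q⊆p∪q ⁅ x ⁆ (fromList xs) (fromList⁺ x∈)

      ⊆₁ : fromList (members I) ⊆ I
      ⊆₁ x∈ = proj₂ (∈-filter⁻ (_∈? I) {xs = allFin N} (fromList⁻ (members I) x∈))

      ⊆₂ : I ⊆ fromList (members I)
      ⊆₂ {x} x∈ = fromList⁺ (∈-filter⁺ (_∈? I) (∈-allFin x) x∈)

  -- Inclusion-exclusion by iterated differences: if `h S` is read as the probability that a random
  -- set contains `S`, this is the probability that it contains `S` and avoids `xs`.
  exclude : List (Fin N) → (Subset N → ℚ) → Subset N → ℚ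
  exclude []       h S = h S
  exclude (i ∷ xs) h S = exclude xs h S ℚ.- exclude xs h (S ∪ ⁅ i ⁆)

  act-∏[1-x] : ∀ n T h S → act n (∏ₚ T (λ i → const 1ℝ -ₚ var i)) h S ≡ exclude (members T) h S
  act-∏[1-x] n T h S = go (members T) S
    where
    product : List (Fin N) → Poly N
    product = foldr (λ i p → (const 1ℝ -ₚ var i) *ₚ p) (const 1ℝ)

    go : ∀ xs S → act n (product xs) h S ≡ exclude xs h S
    go []       S = trans (act-const n 1ℝ h S) (ℚ.*-identityˡ (h S))
    go (x ∷ xs) S = trans (act-*ₚ n (const 1ℝ -ₚ var x) (product xs) h S)
      (trans (act--ₚ n (const 1ℝ) (var x) (act n (product xs) h) S)
      (cong₂ ℚ._-_ (trans (act-const n 1ℝ (act n (product xs) h) S) (trans (ℚ.*-identityˡ _) (go xs S)))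
                   (trans (act-var n x (act n (product xs) h) S) (go xs (S ∪ ⁅ x ⁆)))))

  act-∏x*ₚ : ∀ n I p h → act n (∏x I *ₚ p) h ⊥ₛ ≡ act n p h I
  act-∏x*ₚ n I p h = trans (act-*ₚ n (∏x I) p h ⊥ₛ)
    (trans (act-∏x n I (act n p h) ⊥ₛ) (cong (act n p h) (∪-identityˡ I)))

∣p∣+∣q─p∣≤∣q∣ : ∀ {N} {p q : Subset N} → p ⊆ q → ∣ p ∣ ℕ.+ ∣ q ─ p ∣ ℕ.≤ ∣ q ∣
∣p∣+∣q─p∣≤∣q∣ {p = []}        {[]}        p⊆q = z≤n
∣p∣+∣q─p∣≤∣q∣ {p = true ∷ p}  {true ∷ q}  p⊆q = s≤s (∣p∣+∣q─p∣≤∣q∣ (drop-∷-⊆ p⊆q))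
∣p∣+∣q─p∣≤∣q∣ {p = true ∷ p}  {false ∷ q} p⊆q = contradiction (p⊆q Vec.here) λ ()
∣p∣+∣q─p∣≤∣q∣ {p = false ∷ p} {true ∷ q}  p⊆q = ℕ.≤-trans (ℕ.≤-reflexive (ℕ.+-suc ∣ p ∣ _))
  (s≤s (∣p∣+∣q─p∣≤∣q∣ (drop-∷-⊆ p⊆q)))
∣p∣+∣q─p∣≤∣q∣ {p = false ∷ p} {false ∷ q} p⊆q = ∣p∣+∣q─p∣≤∣q∣ (drop-∷-⊆ p⊆q)

length-members : ∀ {N} (S : Subset N) → length (members S) ≡ ∣ S ∣
length-members {N} S = trans (length-filter≡∑ (_∈? S) (allFin N)) (go S)
  where
  go : ∀ {N} (S : Subset N) → ∑ⁿ (allFin N) (λ i → ι (i ∈? S)) ≡ ∣ S ∣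
  go []      = refl
  go {suc N} (b ∷ S) = trans (cong (ι (zero ∈? (b ∷ S)) ℕ.+_) (begin
    ∑ⁿ (List.tabulate suc) (λ i → ι (i ∈? (b ∷ S)))    ≡⟨ cong (λ xs → ∑ⁿ xs bit) (List.map-tabulate id Fin.suc) ⟨
    ∑ⁿ (map suc (allFin N)) (λ i → ι (i ∈? (b ∷ S)))   ≡⟨ ∑ℕ.∑-map Fin.suc (allFin N) bit ⟩
    ∑ⁿ (allFin N) (λ i → ι (suc i ∈? (b ∷ S)))
      ≡⟨ ∑ℕ.∑-cong (allFin N) (λ i → ι-cong (suc i ∈? (b ∷ S)) (i ∈? S) (λ { (Vec.there p) → p }) Vec.there) ⟩
    ∑ⁿ (allFin N) (λ i → ι (i ∈? S))                   ≡⟨ go S ⟩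
    ∣ S ∣                                              ∎)) (first b)
    where
    open ≡-Reasoning
    bit : Fin (suc N) → ℕ
    bit i = ι (i ∈? (b ∷ S))
    first : ∀ b → ι (zero ∈? (b ∷ S)) ℕ.+ ∣ S ∣ ≡ ∣ b ∷ S ∣
    first true  = refl
    first false = refl

members-p─p : ∀ {N} (p : Subset N) → members (p ─ p) ≡ []
members-p─p {N} p = length-zero (trans (length-members (p ─ p)) (trans (cong ∣_∣ (p─p≡⊥ p)) (∣⊥∣≡0 N)))
  where
  p─p≡⊥ : ∀ {N} (p : Subset N) → p ─ p ≡ ⊥ₛ
  p─p≡⊥ []          = refl
  p─p≡⊥ (true ∷ p)  = cong (false ∷_) (p─p≡⊥ p)
  p─p≡⊥ (false ∷ p) = cong (false ∷_) (p─p≡⊥ p)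
  length-zero : ∀ {xs : List A} → length xs ≡ 0 → xs ≡ []
  length-zero {xs = []} _ = refl

module _ {n : ℕ} (G H : SimpleGraph n) (m : ℕ) (h : Subset (n ℕ.* n) → ℚ) where

  open PolySystem (𝒬System G H) using (eqs)

  act-row : ∀ I u → act m (∏x I *ₚ eqs (row u)) h ⊥ₛ ≡ ∑ᵠ (allFin n) (λ v → h (I ∪ ⁅ u ↦ v ⁆)) ℚ.- h I
  act-row I u = trans (act-∏x*ₚ m I (eqs (row u)) h) (trans (act--ₚ m (sumₚ (entry u)) (const 1ℝ) h I)
    (cong₂ ℚ._-_ (trans (act-sumₚ m (entry u) h I) (∑ℚ.∑-cong (allFin n) λ v → act-var m (u ↦ v) h I))
                 (trans (act-const m 1ℝ h I) (ℚ.*-identityˡ (h I)))))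

  act-col : ∀ I v → act m (∏x I *ₚ eqs (col v)) h ⊥ₛ ≡ ∑ᵠ (allFin n) (λ u → h (I ∪ ⁅ u ↦ v ⁆)) ℚ.- h I
  act-col I v = trans (act-∏x*ₚ m I (eqs (col v)) h) (trans (act--ₚ m (sumₚ (λ u → entry u v)) (const 1ℝ) h I)
    (cong₂ ℚ._-_ (trans (act-sumₚ m (λ u → entry u v) h I) (∑ℚ.∑-cong (allFin n) λ u → act-var m (u ↦ v) h I))
                 (trans (act-const m 1ℝ h I) (ℚ.*-identityˡ (h I)))))

  act-product : ∀ I p q → act m (∏x I *ₚ (var p *ₚ var q)) h ⊥ₛ ≡ h ((I ∪ ⁅ p ⁆) ∪ ⁅ q ⁆)
  act-product I p q = trans (act-∏x*ₚ m I (var p *ₚ var q) h) (trans (act-*ₚ m (var p) (var q) h I)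
    (trans (act-var m p (act m (var q) h) I) (act-var m q h (I ∪ ⁅ p ⁆))))

  act-∏x∏[1-x] : ∀ I J → act m (∏x∏[1-x] I J) h ⊥ₛ ≡ exclude (members (J ─ I)) h I
  act-∏x∏[1-x] I J = trans (act-∏x*ₚ m I (∏ₚ (J ─ I) (λ i → const 1ℝ -ₚ var i)) h) (act-∏[1-x] m (J ─ I) h I)

monomialValue-⊥ : ∀ {N} (y : Subset N → ℝ) → monomialValue y ⊥ₛ ≡ 1ℝ
monomialValue-⊥ {N} y = cong (λ b → if b then y ⊥ₛ else 1ℝ) (dec-false (nonempty? {N} ⊥ₛ) (∉⊥ ∘ proj₂))

monomialValue-⁅⁆ : ∀ {N} (y : Subset N → ℝ) i → monomialValue y ⁅ i ⁆ ≡ y ⁅ i ⁆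
monomialValue-⁅⁆ y i = cong (λ b → if b then y ⁅ i ⁆ else 1ℝ) (dec-true (nonempty? ⁅ i ⁆) (i , x∈⁅x⁆ i))

module _ {n k : ℕ} {G H : SimpleGraph n} where

  difference≈0 : ∀ {x y z} → (∀ m → seq z m ≡ seq x m ℚ.- seq y m) → z ≈ 0ℝ → x ≈ y
  difference≈0 {x} {y} {z} eq z≈0 ε 0<ε = let N , h = z≈0 ε 0<ε in N , λ m N≤m →
    subst (λ d → ℚ.∣ d ∣ ℚ.≤ ε) (trans (cong (ℚ._- 0ℚ) (eq m)) (ℚ.+-identityʳ _)) (h m N≤m)

  lift⇒solution : ∀ {y} → Lift (𝒬System G H) (suc k) y → Solution k G H ℝ-ordered (monomialValue y)
  lift⇒solution {y} lift = record
    -- With `I = J = S` the product over `J ─ I` is empty, so the constraint reads `0 ≤ z S`.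
    { nonneg   = λ S S≤ → ≤-trans {0ℝ} {linearise y (∏x∏[1-x] S S)} {z S}
        (nonnegative S S id S≤)
        (≤-pointwise {linearise y (∏x∏[1-x] S S)} {z S} λ m → ℚ.≤-reflexive (trans
          (linearise-act m y (∏x∏[1-x] S S)) (trans (act-∏x∏[1-x] G H m (zₘ m) S S)
            (cong (λ xs → exclude xs (zₘ m) S) (members-p─p S)))))
    ; row-sum  = λ S u S≤k → difference≈0
        {∑ʳ (allFin n) (λ v → z (S ∪ ⁅ u ↦ v ⁆))} {z S} {linearise y (∏x S *ₚ eqs (row u))}
        (λ m → trans (linearise-act m y (∏x S *ₚ eqs (row u))) (trans (act-row G H m (zₘ m) S u)
          (cong (ℚ._- zₘ m S) (sym (seq-∑ (allFin n) (λ v → z (S ∪ ⁅ u ↦ v ⁆)) m)))))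
        (equality S (row u) (s≤s S≤k))
    ; col-sum  = λ S v S≤k → difference≈0
        {∑ʳ (allFin n) (λ u → z (S ∪ ⁅ u ↦ v ⁆))} {z S} {linearise y (∏x S *ₚ eqs (col v))}
        (λ m → trans (linearise-act m y (∏x S *ₚ eqs (col v))) (trans (act-col G H m (zₘ m) S v)
          (cong (ℚ._- zₘ m S) (sym (seq-∑ (allFin n) (λ u → z (S ∪ ⁅ u ↦ v ⁆)) m)))))
        (equality S (col v) (s≤s S≤k))
    ; edge-nonedge≈0 = λ S {u₁} {u₂} {v₁} {v₂} S≤k e ¬e →
        product≈0 S (u₁ ↦ v₁) (u₂ ↦ v₂) (equality S (edge-nonedge u₁ u₂ v₁ v₂ e ¬e) (s≤s S≤k))
    ; nonedge-edge≈0 = λ S {u₁} {u₂} {v₁} {v₂} S≤k ¬e e →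
        product≈0 S (u₁ ↦ v₁) (u₂ ↦ v₂) (equality S (nonedge-edge u₁ u₂ v₁ v₂ ¬e e) (s≤s S≤k))
    }
    where
    open Lift lift
    open PolySystem (𝒬System G H) using (eqs)
    z : Subset (n ℕ.* n) → ℝ
    z = monomialValue y
    zₘ : ℕ → Subset (n ℕ.* n) → ℚ
    zₘ m S = seq (z S) m

    product≈0 : ∀ S p q → linearise y (∏x S *ₚ (var p *ₚ var q)) ≈ 0ℝ → z ((S ∪ ⁅ p ⁆) ∪ ⁅ q ⁆) ≈ 0ℝ
    product≈0 S p q = ≈-trans {z ((S ∪ ⁅ p ⁆) ∪ ⁅ q ⁆)} {linearise y (∏x S *ₚ (var p *ₚ var q))} {0ℝ}
      (≈-pointwise {z ((S ∪ ⁅ p ⁆) ∪ ⁅ q ⁆)} {linearise y (∏x S *ₚ (var p *ₚ var q))} λ m →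
        sym (trans (linearise-act m y (∏x S *ₚ (var p *ₚ var q))) (act-product G H m (zₘ m) S p q)))

  module _ {η : Subset (n ℕ.* n) → ℚ} (solution : Solution k G H ℚ-ordered η) where

    open Solution solution
    open OrderedSums ℚ-ordered using (≤-∑)

    -- Joining a pair commutes with excluding others, so the row equation passes through the
    -- differences. An excluded pair may get joined to `S`, so `length xs` counts towards the bound.
    exclude-row : ∀ xs S u → ∣ S ∣ ℕ.+ length xs ℕ.≤ k →
                  ∑ᵠ (allFin n) (λ v → exclude xs η (S ∪ ⁅ u ↦ v ⁆)) ≡ exclude xs η S
    exclude-row []       S u S≤k = row-sum S u (ℕ.≤-trans (ℕ.≤-reflexive (sym (ℕ.+-identityʳ ∣ S ∣))) S≤k)
    exclude-row (x ∷ xs) S u S≤k = begin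
      ∑ᵠ (allFin n) (λ v → exclude xs η (S ∪ ⁅ u ↦ v ⁆) ℚ.- exclude xs η ((S ∪ ⁅ u ↦ v ⁆) ∪ ⁅ x ⁆))
        ≡⟨ ∑ℚ.∑-∙ (allFin n) f (λ v → ℚ.- g v) ⟩
      ∑ᵠ (allFin n) (λ v → exclude xs η (S ∪ ⁅ u ↦ v ⁆)) ℚ.+
      ∑ᵠ (allFin n) (λ v → ℚ.- exclude xs η ((S ∪ ⁅ u ↦ v ⁆) ∪ ⁅ x ⁆))
        ≡⟨ cong₂ ℚ._+_ (exclude-row xs S u (ℕ.≤-trans (ℕ.+-monoʳ-≤ ∣ S ∣ (ℕ.n≤1+n _)) S≤k))
             (trans (∑-neg (allFin n) g) (cong ℚ.-_ (trans
               (∑ℚ.∑-cong (allFin n) {g} λ v → cong (exclude xs η) (∪-swap S ⁅ u ↦ v ⁆ ⁅ x ⁆))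
               (exclude-row xs (S ∪ ⁅ x ⁆) u (ℕ.≤-trans (∪-size S x xs) S≤k))))) ⟩
      exclude xs η S ℚ.- exclude xs η (S ∪ ⁅ x ⁆) ∎
      where
      open ≡-Reasoning
      f g : Fin n → ℚ
      f v = exclude xs η (S ∪ ⁅ u ↦ v ⁆)
      g v = exclude xs η ((S ∪ ⁅ u ↦ v ⁆) ∪ ⁅ x ⁆)
      ∑-neg : ∀ (xs : List (Fin n)) f → ∑ᵠ xs (λ i → ℚ.- f i) ≡ ℚ.- ∑ᵠ xs f
      ∑-neg []       f = refl
      ∑-neg (x ∷ xs) f = trans (cong (ℚ.- f x ℚ.+_) (∑-neg xs f)) (sym (ℚ.neg-distrib-+ (f x) _))
      ∪-swap : ∀ {N} (S T U : Subset N) → (S ∪ T) ∪ U ≡ (S ∪ U) ∪ T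
      ∪-swap S T U = trans (∪-assoc S T U) (trans (cong (S ∪_) (∪-comm T U)) (sym (∪-assoc S U T)))
      ∪-size : ∀ {N} (S : Subset N) x (xs : List (Fin N)) → ∣ S ∪ ⁅ x ⁆ ∣ ℕ.+ length xs ℕ.≤ ∣ S ∣ ℕ.+ suc (length xs)
      ∪-size S x xs = ℕ.≤-trans (ℕ.+-monoˡ-≤ (length xs) (∣p∪⁅x⁆∣≤1+∣p∣ S x)) (ℕ.≤-reflexive (sym (ℕ.+-suc ∣ S ∣ _)))

    -- By the row equation of u, the factor 1 - x_{uv} is the sum of the x_{uv′} with v′ ≢ v.
    exclude-≥0 : ∀ xs S → ∣ S ∣ ℕ.+ length xs ℕ.≤ suc k → 0ℚ ℚ.≤ exclude xs η S
    exclude-≥0 []       S S≤ = nonneg S (ℕ.≤-trans (ℕ.≤-reflexive (sym (ℕ.+-identityʳ ∣ S ∣))) S≤)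
    exclude-≥0 (x ∷ xs) S S≤ with Fin.combine-surjective {n} {n} x
    ... | u , v , refl = subst (ℚ._≤ exclude xs η S ℚ.- exclude xs η (S ∪ ⁅ u ↦ v ⁆))
      (ℚ.+-inverseʳ (exclude xs η (S ∪ ⁅ u ↦ v ⁆)))
      (ℚ.+-monoˡ-≤ (ℚ.- exclude xs η (S ∪ ⁅ u ↦ v ⁆)) (subst (exclude xs η (S ∪ ⁅ u ↦ v ⁆) ℚ.≤_)
        (exclude-row xs S u (ℕ.≤-pred S+≤))
        (≤-∑ (λ w → exclude-≥0 xs (S ∪ ⁅ u ↦ w ⁆) (ℕ.≤-trans (ℕ.+-monoˡ-≤ (length xs) (∣p∪⁅x⁆∣≤1+∣p∣ S (u ↦ w))) S+≤))
          (∈-allFin v))))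
      where
      S+≤ : suc (∣ S ∣ ℕ.+ length xs) ℕ.≤ suc k
      S+≤ = ℕ.≤-trans (ℕ.≤-reflexive (sym (ℕ.+-suc ∣ S ∣ (length xs)))) S≤

    solution⇒lift : η ⊥ₛ ≡ 1ℚ → Lift (𝒬System G H) (suc k) (fromℚ ∘ η)
    solution⇒lift η⊥≡1 = record
      { equality    = λ I j I<k → ≈-pointwise {linearise (fromℚ ∘ η) (∏x I *ₚ eqs j)} {0ℝ} λ m →
          trans (linearise≡act m (∏x I *ₚ eqs j)) (equation m I j (ℕ.≤-pred I<k))
      ; inequality  = λ I J ()
      ; nonnegative = λ I J I⊆J J≤ → ≤-pointwise {0ℝ} {linearise (fromℚ ∘ η) (∏x∏[1-x] I J)} λ m →
          subst (0ℚ ℚ.≤_) (sym (trans (linearise≡act m (∏x∏[1-x] I J)) (act-∏x∏[1-x] G H m η I J)))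
            (exclude-≥0 (members (J ─ I)) I (ℕ.≤-trans
              (ℕ.≤-reflexive (cong (∣ I ∣ ℕ.+_) (length-members (J ─ I)))) (ℕ.≤-trans (∣p∣+∣q─p∣≤∣q∣ I⊆J) J≤)))
      }
      where
      open PolySystem (𝒬System G H) using (eqs)

      value : ∀ m S → seq (monomialValue (fromℚ ∘ η) S) m ≡ η S
      value m S with nonempty? S
      ... | yes _ = refl
      ... | no ¬p = trans (sym η⊥≡1) (cong η (sym (Empty-unique ¬p)))

      linearise≡act : ∀ m p → seq (linearise (fromℚ ∘ η) p) m ≡ act m p η ⊥ₛ
      linearise≡act m p = trans (linearise-act m (fromℚ ∘ η) p) (act-cong m p (value m) ⊥ₛ)

      difference-0 : ∀ {p q} → p ≡ q → p ℚ.- q ≡ 0ℚ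
      difference-0 {p} refl = ℚ.+-inverseʳ p

      equation : ∀ m I j → ∣ I ∣ ℕ.≤ k → act m (∏x I *ₚ eqs j) η ⊥ₛ ≡ 0ℚ
      equation m I (row u) I≤k = trans (act-row G H m η I u) (difference-0 (row-sum I u I≤k))
      equation m I (col v) I≤k = trans (act-col G H m η I v) (difference-0 (col-sum I v I≤k))
      equation m I (edge-nonedge u₁ u₂ v₁ v₂ e ¬e) I≤k =
        trans (act-product G H m η I (u₁ ↦ v₁) (u₂ ↦ v₂)) (edge-nonedge≈0 I I≤k e ¬e)
      equation m I (nonedge-edge u₁ u₂ v₁ v₂ ¬e e) I≤k =
        trans (act-product G H m η I (u₁ ↦ v₁) (u₂ ↦ v₂)) (nonedge-edge≈0 I I≤k ¬e e)

-- From matching colours to a point of the relaxation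

∀? : {P : A → Set ℓ} → Enumeration A → Decidable P → Dec (∀ x → P x)
∀? E P? = map′ (λ all x → All.lookup all (complete E x)) (λ f → All.tabulate λ {x} _ → f x) (All.all? P? (elements E))

subsets : ∀ N → Enumeration (Subset N)
subsets = vectors bools

products : Enumeration A → Enumeration B → Enumeration (A × B)
products E F = record
  { elements = cartesianProduct (elements E) (elements F)
  ; unique   = Unique.cartesianProduct⁺ (unique E) (unique F)
  ; complete = λ (x , y) → ∈-cartesianProduct⁺ (complete E x) (complete F y)
  }

-- Count the pairs `(x , y)` with `Q y` and `x ≡ f y` by rows and by columns.
#-bijective : (E : Enumeration A) (F : Enumeration B) {P : A → Set a} {Q : B → Set b}
  (P? : Decidable P) (Q? : Decidable Q) → DecidableEquality A → (f : B → A) →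
  (∀ {y} → Q y → P (f y)) → (∀ {y z} → Q y → Q z → f y ≡ f z → y ≡ z) →
  (∀ {x} → P x → ∃ λ y → Q y × x ≡ f y) → # E P? ≡ # F Q?
#-bijective E F {P} {Q} P? Q? _≟_ f maps injective surjective = begin
  ∑ⁿ (elements E) (λ x → ι (P? x))                                    ≡⟨ ∑ℕ.∑-cong (elements E) fibre ⟩
  ∑ⁿ (elements E) (λ x → ∑ⁿ (elements F) (λ y → ι (related? x y)))    ≡⟨ ∑ℕ.∑-swap (elements E) (elements F) _ ⟩
  ∑ⁿ (elements F) (λ y → ∑ⁿ (elements E) (λ x → ι (related? x y)))    ≡⟨ ∑ℕ.∑-cong (elements F) image ⟩
  ∑ⁿ (elements F) (λ y → ι (Q? y))                                    ∎
  where
  open ≡-Reasoning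
  related? : ∀ x y → Dec (Q y × x ≡ f y)
  related? x y = Q? y ×-dec (x ≟ f y)

  fibre : ∀ x → ι (P? x) ≡ # F (related? x)
  fibre x with P? x
  ... | yes px = let y , qy , x≡ = surjective px in sym (#-unique F (related? x) (qy , x≡)
    λ (qz , x≡′) → injective qz qy (trans (sym x≡′) x≡))
  ... | no ¬px = sym (#-none F (related? x) λ (qy , x≡) → ¬px (subst P (sym x≡) (maps qy)))

  image : ∀ y → # E (λ x → related? x y) ≡ ι (Q? y)
  image y with Q? y
  ... | yes qy = #-unique E (λ x → yes qy ×-dec (x ≟ f y)) (qy , refl) proj₂
  ... | no ¬qy = #-none E (λ x → no ¬qy ×-dec (x ≟ f y)) (¬qy ∘ proj₁)

module _ {N : ℕ} {P : Fin N → Set ℓ} (P? : Decidable P) where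

  comprehension : Subset N
  comprehension = tabulate (does ∘ P?)

  ∈-comprehension⁺ : ∀ {x} → P x → x ∈ comprehension
  ∈-comprehension⁺ {x} px = Vec.lookup⇒[]= x comprehension
    (trans (Vec.lookup∘tabulate (does ∘ P?) x) (dec-true (P? x) px))

  ∈-comprehension⁻ : ∀ {x} → x ∈ comprehension → P x
  ∈-comprehension⁻ {x} x∈ with P? x | trans (sym (Vec.lookup∘tabulate (does ∘ P?) x)) (Vec.[]=⇒lookup x∈)
  ... | yes px | _ = px

-- In `extension` the filler `d` is a pair of the map itself, so padding a list of its pairs to
-- length `K` introduces nothing foreign.
padTo : ∀ K → List A → A → Vec A K
padTo zero    xs       d = []
padTo (suc K) []       d = d ∷ padTo K [] d
padTo (suc K) (x ∷ xs) d = x ∷ padTo K xs d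

padTo-∈ : ∀ K (xs : List A) d i → lookup (padTo K xs d) i ∈ˡ d ∷ xs
padTo-∈ (suc K) []       d zero    = here refl
padTo-∈ (suc K) []       d (suc i) = padTo-∈ K [] d i
padTo-∈ (suc K) (x ∷ xs) d zero    = there (here refl)
padTo-∈ (suc K) (x ∷ xs) d (suc i) with padTo-∈ K xs d i
... | here eq  = here eq
... | there p  = there (there p)

∈-padTo : ∀ K {xs : List A} d {x} → length xs ℕ.≤ K → x ∈ˡ xs → ∃ λ i → lookup (padTo K xs d) i ≡ x
∈-padTo (suc K) d (s≤s le) (here refl) = zero , refl
∈-padTo (suc K) d (s≤s le) (there x∈)  = let i , eq = ∈-padTo K d le x∈ in suc i , eq

module Inverses where

  open OrderedCommutativeMonoid ℚ-ordered using (monoid)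
  open import Algebra.Properties.Monoid.Mult monoid public using (×-assocˡ) renaming (_×_ to _·_)

  ·1-* : ∀ m x → m · x ≡ (m · 1ℚ) ℚ.* x
  ·1-* zero    x = sym (ℚ.*-zeroˡ x)
  ·1-* (suc m) x = trans (cong₂ ℚ._+_ (sym (ℚ.*-identityˡ x)) (·1-* m x)) (sym (ℚ.*-distribʳ-+ x 1ℚ (m · 1ℚ)))

  ·1-nonNeg : ∀ m → ℚ.NonNegative (m · 1ℚ)
  ·1-nonNeg zero    = _
  ·1-nonNeg (suc m) = ℚ.nonNeg+nonNeg⇒nonNeg 1ℚ (m · 1ℚ) {{·1-nonNeg m}}

  ·1-pos : ∀ m → ℚ.Positive (suc m · 1ℚ)
  ·1-pos m = ℚ.pos+nonNeg⇒pos 1ℚ (m · 1ℚ) {{·1-nonNeg m}}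

  -- Total, with the junk value inv 0 = 0.
  inv : ℕ → ℚ
  inv zero    = 0ℚ
  inv (suc m) = (ℚ.1/ (suc m · 1ℚ)) {{ℚ.pos⇒nonZero (suc m · 1ℚ) {{·1-pos m}}}}

  inv-pos : ∀ m → 0ℚ ℚ.< inv (suc m)
  inv-pos m = ℚ.positive⁻¹ (inv (suc m)) {{ℚ.1/pos⇒pos (suc m · 1ℚ) {{·1-pos m}}}}

  inv-≥0 : ∀ m → 0ℚ ℚ.≤ inv m
  inv-≥0 zero    = ℚ.≤-refl
  inv-≥0 (suc m) = ℚ.<⇒≤ (inv-pos m)

  ·-inv : ∀ m → suc m · inv (suc m) ≡ 1ℚ
  ·-inv m = trans (·1-* (suc m) (inv (suc m))) (ℚ.*-inverseʳ (suc m · 1ℚ) {{ℚ.pos⇒nonZero (suc m · 1ℚ) {{·1-pos m}}}})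

  ·-cancelˡ : ∀ m {x y} → suc m · x ≡ suc m · y → x ≡ y
  ·-cancelˡ m {x} {y} eq = trans (sym (recover x)) (trans (cong (inv (suc m) ℚ.*_) eq) (recover y))
    where
    recover : ∀ x → inv (suc m) ℚ.* (suc m · x) ≡ x
    recover x = begin
      inv (suc m) ℚ.* (suc m · x)               ≡⟨ cong (inv (suc m) ℚ.*_) (·1-* (suc m) x) ⟩
      inv (suc m) ℚ.* ((suc m · 1ℚ) ℚ.* x)      ≡⟨ ℚ.*-assoc (inv (suc m)) (suc m · 1ℚ) x ⟨
      inv (suc m) ℚ.* (suc m · 1ℚ) ℚ.* x
        ≡⟨ cong (ℚ._* x) (ℚ.*-inverseˡ (suc m · 1ℚ) {{ℚ.pos⇒nonZero (suc m · 1ℚ) {{·1-pos m}}}}) ⟩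
      1ℚ ℚ.* x                                  ≡⟨ ℚ.*-identityˡ x ⟩
      x                                         ∎
      where open ≡-Reasoning

  ·-inv-* : ∀ a b → 0 ℕ.< a → 0 ℕ.< b → b · inv (a ℕ.* b) ≡ inv a
  ·-inv-* (suc a) (suc b) _ _ = ·-cancelˡ a (begin
    suc a · (suc b · inv (suc a ℕ.* suc b))   ≡⟨ ×-assocˡ (inv (suc a ℕ.* suc b)) (suc a) (suc b) ⟩
    (suc a ℕ.* suc b) · inv (suc a ℕ.* suc b) ≡⟨ ·-inv (b ℕ.+ a ℕ.* suc b) ⟩
    1ℚ                                        ≡⟨ ·-inv a ⟨
    suc a · inv (suc a)                       ∎)
    where open ≡-Reasoning

-- Equiprobable consistent maps

module Weights {n k : ℕ} (G H : SimpleGraph n) (c d : Tuple n (suc (suc k)) → ℕ)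
  (same⇒𝓒 : ∀ u v → c u ≡ d v → 𝓒 G u ≡ 𝓒 H v)
  (extend : ∀ u v → c u ≡ d v → ∃ λ (ψ : Fin n ↔ Fin n) → ∀ i w → c (φ i u w) ≡ d (φ i v (Inverse.to ψ w)))
  (substitute : ∀ u v (f : Fin (suc (suc k)) → Fin (suc (suc k))) → c u ≡ d v → c (u [ f ]) ≡ d (v [ f ]))
  (same-const : ∃ λ (ψ : Fin n ↔ Fin n) →
    ∀ w → c (replicate (suc (suc k)) w) ≡ d (replicate (suc (suc k)) (Inverse.to ψ w))) where

  private
    K : ℕ
    K = suc (suc k)

  open Inverse
  open Inverses

  Pairs : Set
  Pairs = Subset (n ℕ.* n)

  -- S ⊆ V × V stands for a partial map from V to V.
  Consistent : Pairs → Set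
  Consistent S = ∀ u v → (∀ i → lookup u i ↦ lookup v i ∈ S) → c u ≡ d v

  opaque

    consistent? : Decidable Consistent
    consistent? S = ∀? (tuples n K) λ u → ∀? (tuples n K) λ v →
      Fin.all? (λ i → lookup u i ↦ lookup v i ∈? S) →-dec (c u ℕ.≟ d v)

  consistent-⊆ : ∀ {S T} → S ⊆ T → Consistent T → Consistent S
  consistent-⊆ S⊆T con u v in-S = con u v (λ i → S⊆T (in-S i))

  -- Consistency relates tuples of `G` to tuples of `H` only, so a composite goes along `S₁`,
  -- backwards along `S₂` and along `S₃`. The intermediate vertices are chosen position by position
  -- and collected into tuples.
  compose : ∀ {S₁ S₂ S₃ T} → Consistent S₁ → Consistent S₂ → Consistent S₃ →
    (∀ {a b} → a ↦ b ∈ T → ∃₂ λ a′ b′ → a ↦ b′ ∈ S₁ × a′ ↦ b′ ∈ S₂ × a′ ↦ b ∈ S₃) → Consistent T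
  compose {S₁} {S₂} {S₃} con₁ con₂ con₃ path u v in-T = trans
    (con₁ u v′ λ i → subst (λ b → lookup u i ↦ b ∈ S₁) (sym (Vec.lookup∘tabulate b′ i)) (proj₁ (steps i)))
    (trans (sym (con₂ u′ v′ λ i → subst₂ (λ a b → a ↦ b ∈ S₂) (sym (Vec.lookup∘tabulate a′ i))
              (sym (Vec.lookup∘tabulate b′ i)) (proj₁ (proj₂ (steps i)))))
           (con₃ u′ v λ i → subst (λ a → a ↦ lookup v i ∈ S₃) (sym (Vec.lookup∘tabulate a′ i)) (proj₂ (proj₂ (steps i)))))
    where
    a′ b′ : Fin K → Fin n
    a′ i = proj₁ (path (in-T i))
    b′ i = proj₁ (proj₂ (path (in-T i)))
    steps : ∀ i → lookup u i ↦ b′ i ∈ S₁ × a′ i ↦ b′ i ∈ S₂ × a′ i ↦ lookup v i ∈ S₃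
    steps i = proj₂ (proj₂ (path (in-T i)))
    u′ v′ : Tuple n K
    u′ = tabulate a′
    v′ = tabulate b′

  Dom : Pairs → Fin n → Set
  Dom S a = ∃ λ b → a ↦ b ∈ S

  dom? : ∀ S → Decidable (Dom S)
  dom? S a = Fin.any? λ b → a ↦ b ∈? S

  ↦-injective : ∀ (a b a′ b′ : Fin n) → a ↦ b ≡ a′ ↦ b′ → a ≡ a′ × b ≡ b′
  ↦-injective = Fin.combine-injective

  -- On the domain of `T` the path runs forth and back along `S`, then along `T`; the new vertex `a`
  -- goes to `b′`, back to `a′` and on to `b`. In effect `a` and `a′` look alike over `S`, so `T`
  -- may send `a` wherever it may send `a′`.
  zigzag : ∀ S T {a b a′ b′} → (∀ {x} → Dom T x → Dom S x) →
    Consistent (S ∪ ⁅ a ↦ b′ ⁆) → Consistent (S ∪ ⁅ a′ ↦ b′ ⁆) → Consistent (T ∪ ⁅ a′ ↦ b ⁆) →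
    Consistent (T ∪ ⁅ a ↦ b ⁆)
  zigzag S T {a} {b} {a′} {b′} T⊆S con₁ con₂ con₃ = compose con₁ con₂ con₃ path
    where
    path : ∀ {x y} → x ↦ y ∈ T ∪ ⁅ a ↦ b ⁆ → ∃₂ λ x′ y′ →
      x ↦ y′ ∈ S ∪ ⁅ a ↦ b′ ⁆ × x′ ↦ y′ ∈ S ∪ ⁅ a′ ↦ b′ ⁆ × x′ ↦ y ∈ T ∪ ⁅ a′ ↦ b ⁆
    path {x} {y} xy∈ with ∈-∪⁅⁆⁻ T (a ↦ b) xy∈
    ... | inj₁ xy∈T = let y′ , xy′∈S = T⊆S (y , xy∈T) in
      x , y′ , ∈-∪⁅⁆ˡ xy′∈S , ∈-∪⁅⁆ˡ xy′∈S , ∈-∪⁅⁆ˡ xy∈T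
    ... | inj₂ eq with ↦-injective x y a b eq
    ...   | refl , refl = a′ , b′ , ∈-∪⁅⁆ʳ S _ , ∈-∪⁅⁆ʳ S _ , ∈-∪⁅⁆ʳ T _

  module _ {S : Pairs} (con : Consistent S) where

    sameType : ∀ {a b a′ b′} → a ↦ b ∈ S → a′ ↦ b′ ∈ S → atomicType G a a′ ≡ atomicType H b b′
    sameType {a} {b} {a′} {b′} p∈ q∈ =
      𝓒-≡⁻ G H u v (same⇒𝓒 u v (con u v members∈)) zero (suc zero)
      where
      u v : Tuple n K
      -- Dimension at least 2 enters here: an atomic type needs one position for each of its two
      -- vertices.
      u = a ∷ replicate (suc k) a′
      v = b ∷ replicate (suc k) b′
      members∈ : ∀ i → lookup u i ↦ lookup v i ∈ S
      members∈ zero    = p∈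
      members∈ (suc i) = subst₂ (λ x y → x ↦ y ∈ S) (sym (Vec.lookup-replicate i a′)) (sym (Vec.lookup-replicate i b′)) q∈

    functional : ∀ {a b b′} → a ↦ b ∈ S → a ↦ b′ ∈ S → b ≡ b′
    functional {a} {b} {b′} p∈ q∈ = proj₁ (atomicType-≡ G H a a b b′ (sameType p∈ q∈)) refl

  -- A bound on the domain, unlike one on `∣ S ∣`, passes directly to every map with the same
  -- domain, as `choices-sameDom` requires.
  Small : Pairs → Set
  Small S = ∃ λ (l : List (Fin n)) → length l ℕ.≤ K × (∀ {a} → Dom S a → a ∈ˡ l)

  small : ∀ S → ∣ S ∣ ℕ.≤ K → Small S
  small S S≤K = map (λ x → proj₁ (remQuot {n} n x)) (members S)
    , ℕ.≤-trans (ℕ.≤-reflexive (trans (List.length-map _ (members S)) (length-members S))) S≤K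
    , λ {a} (b , ab∈S) → subst (_∈ˡ map (λ x → proj₁ (remQuot {n} n x)) (members S)) (cong proj₁ (Fin.remQuot-combine a b))
        (∈-map⁺ (λ x → proj₁ (remQuot {n} n x)) (∈-filter⁺ (_∈? S) (∈-allFin (a ↦ b)) ab∈S))

  -- The forth property for partial maps.  If S is enumerated by tuples u and v,
  -- then a tuple over S ∪ ⁅ w ↦ ψ w ⁆ that uses w uses at most K - 1 entries of
  -- u, so it is obtained by substitution from some φ m u w.
  extension : ∀ {S} → Consistent S → Small S →
              ∃ λ (ψ : Fin n ↔ Fin n) → ∀ w → Consistent (S ∪ ⁅ w ↦ to ψ w ⁆)
  extension {S} con (l , l≤K , covers) with nonempty? S
  -- Tuples over a single pair are constant, so `same-const` extends the empty map.
  ... | no empty = let ψ , ψ-ok = same-const in ψ , λ w x y in-S →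
    let x≡,y≡ : ∀ i → lookup x i ≡ w × lookup y i ≡ to ψ w
        x≡,y≡ i = [ (λ p∈S → contradiction (_ , p∈S) empty) , ↦-injective (lookup x i) (lookup y i) w (to ψ w) ]′
          (∈-∪⁅⁆⁻ S (w ↦ to ψ w) (in-S i))
    in trans (cong c (lookup-ext λ i → trans (proj₁ (x≡,y≡ i)) (sym (Vec.lookup-replicate i w))))
        (trans (ψ-ok w) (cong d (lookup-ext λ i →
          trans (Vec.lookup-replicate i (to ψ w)) (sym (proj₂ (x≡,y≡ i))))))
  ... | yes (s , s∈S) with Fin.combine-surjective {n} {n} s
  ...   | a₀ , b₀ , refl = ψ , extended
    where
    choose : Fin n → Fin n × Fin n
    choose a with dom? S a
    ... | yes (b , _) = a , b
    ... | no  _       = a₀ , b₀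

    choose-∈ : ∀ a → uncurry _↦_ (choose a) ∈ S
    choose-∈ a with dom? S a
    ... | yes (b , ab∈S) = ab∈S
    ... | no  _          = s∈S

    choose-≡ : ∀ {a b} → a ↦ b ∈ S → choose a ≡ (a , b)
    choose-≡ {a} {b} ab∈S with dom? S a
    ... | yes (b′ , ab′∈S) = cong (a ,_) (functional con ab′∈S ab∈S)
    ... | no  ¬dom         = contradiction (b , ab∈S) ¬dom

    t : Vec (Fin n × Fin n) K
    t = padTo K (map choose l) (a₀ , b₀)

    u v : Tuple n K
    u = Vec.map proj₁ t
    v = Vec.map proj₂ t

    t-∈ : ∀ {p} → p ∈ˡ (a₀ , b₀) ∷ map choose l → uncurry _↦_ p ∈ S
    t-∈ (here refl) = s∈S
    t-∈ (there p∈)  = let a , _ , eq = ∈-map⁻ choose p∈ in subst (λ p → uncurry _↦_ p ∈ S) (sym eq) (choose-∈ a)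

    uv-∈ : ∀ i → lookup u i ↦ lookup v i ∈ S
    uv-∈ i = subst₂ (λ a b → a ↦ b ∈ S) (sym (Vec.lookup-map i proj₁ t)) (sym (Vec.lookup-map i proj₂ t))
      (t-∈ (padTo-∈ K (map choose l) (a₀ , b₀) i))

    uv-covers : ∀ {a b} → a ↦ b ∈ S → ∃ λ i → lookup u i ≡ a × lookup v i ≡ b
    uv-covers {a} {b} ab∈S =
      let i , eq = ∈-padTo K (a₀ , b₀) (ℕ.≤-trans (ℕ.≤-reflexive (List.length-map choose l)) l≤K)
                     (subst (_∈ˡ map choose l) (choose-≡ ab∈S) (∈-map⁺ choose (covers (b , ab∈S))))
      in i , trans (Vec.lookup-map i proj₁ t) (cong proj₁ eq) , trans (Vec.lookup-map i proj₂ t) (cong proj₂ eq)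

    forth : ∃ λ (ψ : Fin n ↔ Fin n) → ∀ i w → c (φ i u w) ≡ d (φ i v (to ψ w))
    forth = extend u v (con u v uv-∈)

    ψ : Fin n ↔ Fin n
    ψ = proj₁ forth

    extended : ∀ w → Consistent (S ∪ ⁅ w ↦ to ψ w ⁆)
    extended w x y in-S with Fin.any? (λ j → lookup x j ↦ lookup y j Fin.≟ w ↦ to ψ w)
    ... | no ¬new = con x y λ j → [ id , (λ eq → contradiction (j , eq) ¬new) ]′ (∈-∪⁅⁆⁻ S (w ↦ to ψ w) (in-S j))
    ... | yes (j₀ , new) = trans (cong c (sym (lookup-ext x-ok)))
      (trans (substitute (φ m u w) (φ m v (to ψ w)) g (proj₂ forth m w)) (cong d (lookup-ext y-ok)))
      where
      Old New : Fin K → Set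
      Old j = ∃ λ i → lookup u i ≡ lookup x j × lookup v i ≡ lookup y j
      New j = lookup x j ≡ w × lookup y j ≡ to ψ w

      source : ∀ j → Old j ⊎ New j
      source j = Sum.map uv-covers (↦-injective (lookup x j) (lookup y j) w (to ψ w)) (∈-∪⁅⁆⁻ S (w ↦ to ψ w) (in-S j))

      -- The value `j₀` for entries that use the new pair is arbitrary, as these will be read from
      -- `m`. What counts is that the positions other than `j₀` leave some entry `m` of `u` free to
      -- be overwritten by `w`.
      position : Fin K → Fin K
      position j = [ proj₁ , (λ _ → j₀) ]′ (source j)

      missed : ∃ λ m → ∀ j → j ≢ j₀ → position j ≢ m
      missed = missedValue position j₀

      m : Fin K
      m = proj₁ missed

      found : ∀ j → ∃ λ i → lookup (φ m u w) i ≡ lookup x j × lookup (φ m v (to ψ w)) i ≡ lookup y j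
      found j = by (source j) refl (j Fin.≟ j₀)
        where
        new-found : New j → ∃ λ i → lookup (φ m u w) i ≡ lookup x j × lookup (φ m v (to ψ w)) i ≡ lookup y j
        new-found (x≡ , y≡) = m , trans (Vec.lookup∘update m u w) (sym x≡) , trans (Vec.lookup∘update m v (to ψ w)) (sym y≡)

        by : ∀ s → source j ≡ s → Dec (j ≡ j₀) →
             ∃ λ i → lookup (φ m u w) i ≡ lookup x j × lookup (φ m v (to ψ w)) i ≡ lookup y j
        by _ _ (yes refl) = new-found (↦-injective (lookup x j) (lookup y j) w (to ψ w) new)
        by (inj₂ p) _ _   = new-found p
        by (inj₁ (i , x≡ , y≡)) eq (no j≢j₀) =
          let i≢m : i ≢ m
              i≢m i≡m = proj₂ missed j j≢j₀ (trans (cong [ proj₁ , (λ _ → j₀) ]′ eq) i≡m)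
          in i , trans (Vec.lookup∘update′ i≢m u w) x≡ , trans (Vec.lookup∘update′ i≢m v (to ψ w)) y≡

      g : Fin K → Fin K
      g j = proj₁ (found j)

      x-ok : ∀ j → lookup (φ m u w [ g ]) j ≡ lookup x j
      x-ok j = trans (Vec.lookup∘tabulate (lookup (φ m u w) ∘ g) j) (proj₁ (proj₂ (found j)))

      y-ok : ∀ j → lookup (φ m v (to ψ w) [ g ]) j ≡ lookup y j
      y-ok j = trans (Vec.lookup∘tabulate (lookup (φ m v (to ψ w)) ∘ g) j) (proj₂ (proj₂ (found j)))

  SameDom : Pairs → Pairs → Set
  SameDom S T = ∀ a → (Dom S a → Dom T a) × (Dom T a → Dom S a)

  sameDom? : ∀ S → Decidable (SameDom S)
  sameDom? S T = Fin.all? λ a → (dom? S a →-dec dom? T a) ×-dec (dom? T a →-dec dom? S a)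

  small-sameDom : ∀ {S T} → SameDom S T → Small S → Small T
  small-sameDom same (l , l≤K , covers) = l , l≤K , λ {a} → covers ∘ proj₂ (same a)

  conjugates? : ∀ S → Decidable (λ T → SameDom S T × Consistent T)
  conjugates? S T = sameDom? S T ×-dec consistent? T

  -- The normalising constant `N(S)`; it depends on the domain of `S` alone.
  conjugates : Pairs → ℕ
  conjugates S = # (subsets (n ℕ.* n)) (conjugates? S)

  choices : Pairs → Fin n → ℕ
  choices S u = # (fins n) (λ v → consistent? (S ∪ ⁅ u ↦ v ⁆))

  -- Let `ψ` and `χ` extend `S` and `T`. By `zigzag`, `u` may go to `ψ w` over `S` exactly if it may
  -- go to `χ w` over `T`: both say that `u` looks like `w` over the common domain.
  choices-sameDom : ∀ {S T} → Consistent S → Consistent T → Small S → SameDom S T → ∀ u → choices S u ≡ choices T u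
  choices-sameDom {S} {T} con-S con-T small-S same u =
    let ψ , ψ-ok = extension con-S small-S
        χ , χ-ok = extension con-T (small-sameDom same small-S)
    in begin
      choices S u
        ≡⟨ ∑ⁿ-reindex (fins n) ψ _ ⟩
      ∑ⁿ (allFin n) (λ w → ι (consistent? (S ∪ ⁅ u ↦ to ψ w ⁆)))
        ≡⟨ ∑ℕ.∑-cong (allFin n) (λ w → ι-cong (consistent? _) (consistent? _)
             (λ con → zigzag S T (proj₂ (same _)) con (ψ-ok w) (χ-ok w))
             (λ con → zigzag T S (proj₁ (same _)) con (χ-ok w) (ψ-ok w))) ⟩
      ∑ⁿ (allFin n) (λ w → ι (consistent? (T ∪ ⁅ u ↦ to χ w ⁆)))
        ≡⟨ ∑ⁿ-reindex (fins n) χ _ ⟨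
      choices T u ∎
    where open ≡-Reasoning

  dom-∪⁅⁆ˡ : ∀ {S x a} → Dom S a → Dom (S ∪ ⁅ x ⁆) a
  dom-∪⁅⁆ˡ (b , ab∈S) = b , ∈-∪⁅⁆ˡ ab∈S

  dom-∪⁅⁆⁻ : ∀ {S u v a} → Dom (S ∪ ⁅ u ↦ v ⁆) a → Dom S a ⊎ a ≡ u
  dom-∪⁅⁆⁻ {S} {u} {v} {a} (b , ab∈) = Sum.map (b ,_) (proj₁ ∘ ↦-injective a b u v) (∈-∪⁅⁆⁻ S (u ↦ v) ab∈)

  sameDom-∪⁅⁆ : ∀ {S T u v w} → SameDom S T → SameDom (S ∪ ⁅ u ↦ v ⁆) (T ∪ ⁅ u ↦ w ⁆)
  sameDom-∪⁅⁆ {S} {T} {u} {v} {w} same a =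
      (λ dom → [ dom-∪⁅⁆ˡ ∘ proj₁ (same a) , (λ { refl → w , ∈-∪⁅⁆ʳ T (u ↦ w) }) ]′ (dom-∪⁅⁆⁻ {S} {u} {v} dom))
    , (λ dom → [ dom-∪⁅⁆ˡ ∘ proj₂ (same a) , (λ { refl → v , ∈-∪⁅⁆ʳ S (u ↦ v) }) ]′ (dom-∪⁅⁆⁻ {T} {u} {w} dom))

  -- A conjugate of S ∪ ⁅ u ↦ v ⁆ amounts to its restriction to the domain of S,
  -- which is a conjugate of S, and the image of u.
  module _ (S : Pairs) (u v : Fin n) where

    extensions? : Decidable (λ ((T , w) : Pairs × Fin n) → SameDom S T × Consistent (T ∪ ⁅ u ↦ w ⁆))
    extensions? (T , w) = sameDom? S T ×-dec consistent? (T ∪ ⁅ u ↦ w ⁆)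

    extensions : ℕ
    extensions = # (products (subsets (n ℕ.* n)) (fins n)) extensions?

    restriction-≡ : ∀ {T U w} → SameDom S T → Consistent U → U ≡ T ∪ ⁅ u ↦ w ⁆ →
                    ∀ a b → (a ↦ b ∈ T → a ↦ b ∈ U × Dom S a) × (a ↦ b ∈ U × Dom S a → a ↦ b ∈ T)
    restriction-≡ {T} {U} {w} same con refl a b =
        (λ ab∈T → ∈-∪⁅⁆ˡ ab∈T , proj₂ (same a) (b , ab∈T))
      , λ (ab∈U , dom) → let b′ , ab′∈T = proj₁ (same a) dom in
          subst (λ b → a ↦ b ∈ T) (functional con (∈-∪⁅⁆ˡ ab′∈T) ab∈U) ab′∈T

    ⊆-pairs : ∀ {T T′ : Pairs} → (∀ a b → a ↦ b ∈ T → a ↦ b ∈ T′) → T ⊆ T′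
    ⊆-pairs sub {x} x∈ with Fin.combine-surjective {n} {n} x
    ... | a , b , refl = sub a b x∈

    conjugates≡extensions : conjugates (S ∪ ⁅ u ↦ v ⁆) ≡ extensions
    conjugates≡extensions = #-bijective (subsets (n ℕ.* n)) (products (subsets (n ℕ.* n)) (fins n))
      (conjugates? (S ∪ ⁅ u ↦ v ⁆)) extensions? (Vec.≡-dec Bool._≟_) (λ (T , w) → T ∪ ⁅ u ↦ w ⁆)
      (λ (same , con) → sameDom-∪⁅⁆ same , con)
      injective surjective
      where
      injective : ∀ {p q : Pairs × Fin n} →
        SameDom S (proj₁ p) × Consistent (proj₁ p ∪ ⁅ u ↦ proj₂ p ⁆) →
        SameDom S (proj₁ q) × Consistent (proj₁ q ∪ ⁅ u ↦ proj₂ q ⁆) →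
        proj₁ p ∪ ⁅ u ↦ proj₂ p ⁆ ≡ proj₁ q ∪ ⁅ u ↦ proj₂ q ⁆ → p ≡ q
      injective {T , w} {T′ , w′} (same , con) (same′ , con′) eq = cong₂ _,_
        (⊆-antisym
          (⊆-pairs λ a b ab∈ → proj₂ (restriction-≡ same′ con eq a b) (proj₁ (restriction-≡ same con refl a b) ab∈))
          (⊆-pairs λ a b ab∈ → proj₂ (restriction-≡ same con refl a b) (proj₁ (restriction-≡ same′ con eq a b) ab∈)))
        (functional con (∈-∪⁅⁆ʳ T (u ↦ w)) (subst (u ↦ w′ ∈_) (sym eq) (∈-∪⁅⁆ʳ T′ (u ↦ w′))))

      surjective : ∀ {U} → SameDom (S ∪ ⁅ u ↦ v ⁆) U × Consistent U →
        ∃ λ ((T , w) : Pairs × Fin n) → (SameDom S T × Consistent (T ∪ ⁅ u ↦ w ⁆)) × U ≡ T ∪ ⁅ u ↦ w ⁆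
      surjective {U} (same , con) = (T , w) , ((λ a → to-T a , from-T a) , subst Consistent U≡ con) , U≡
        where
        image : Dom U u
        image = proj₁ (same u) (v , ∈-∪⁅⁆ʳ S (u ↦ v))

        w : Fin n
        w = proj₁ image

        inT? : Decidable (λ x → x ∈ U × Dom S (proj₁ (remQuot {n} n x)))
        inT? x = (x ∈? U) ×-dec dom? S (proj₁ (remQuot {n} n x))

        T : Pairs
        T = comprehension inT?

        ∈-T⁺ : ∀ {a b} → a ↦ b ∈ U → Dom S a → a ↦ b ∈ T
        ∈-T⁺ {a} {b} ab∈U dom = ∈-comprehension⁺ inT?
          (ab∈U , subst (Dom S) (sym (cong proj₁ (Fin.remQuot-combine a b))) dom)

        ∈-T⁻ : ∀ {a b} → a ↦ b ∈ T → a ↦ b ∈ U × Dom S a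
        ∈-T⁻ {a} {b} ab∈T = let ab∈U , dom = ∈-comprehension⁻ inT? ab∈T in
          ab∈U , subst (Dom S) (cong proj₁ (Fin.remQuot-combine a b)) dom

        to-T : ∀ a → Dom S a → Dom T a
        to-T a dom = let b , ab∈U = proj₁ (same a) (dom-∪⁅⁆ˡ dom) in b , ∈-T⁺ ab∈U dom

        from-T : ∀ a → Dom T a → Dom S a
        from-T a (b , ab∈T) = proj₂ (∈-T⁻ ab∈T)

        U⊆ : ∀ a b → a ↦ b ∈ U → a ↦ b ∈ T ∪ ⁅ u ↦ w ⁆
        U⊆ a b ab∈U with dom-∪⁅⁆⁻ {S} {u} {v} (proj₂ (same a) (b , ab∈U))
        ... | inj₁ dom  = ∈-∪⁅⁆ˡ (∈-T⁺ ab∈U dom)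
        ... | inj₂ refl = subst (λ b → u ↦ b ∈ T ∪ ⁅ u ↦ w ⁆) (functional con (proj₂ image) ab∈U) (∈-∪⁅⁆ʳ T (u ↦ w))

        ⊆U : ∀ a b → a ↦ b ∈ T ∪ ⁅ u ↦ w ⁆ → a ↦ b ∈ U
        ⊆U a b ab∈ = [ proj₁ ∘ ∈-T⁻ , (λ eq → subst (_∈ U) (sym eq) (proj₂ image)) ]′ (∈-∪⁅⁆⁻ T (u ↦ w) ab∈)

        U≡ : U ≡ T ∪ ⁅ u ↦ w ⁆
        U≡ = ⊆-antisym (⊆-pairs U⊆) (⊆-pairs ⊆U)

    -- Consistent `T ∪ ⁅ u ↦ w ⁆` restrict to consistent `T`, and each consistent `T` with the
    -- domain of `S` allows as many `w` as `S` does. A vertex `u` already in the domain is covered,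
    -- with a single choice.
    conjugates-∪⁅⁆ : Consistent S → Small S → conjugates (S ∪ ⁅ u ↦ v ⁆) ≡ conjugates S ℕ.* choices S u
    conjugates-∪⁅⁆ con small-S = begin
      conjugates (S ∪ ⁅ u ↦ v ⁆)
        ≡⟨ conjugates≡extensions ⟩
      extensions
        ≡⟨ ∑ℕ.∑-cartesianProductWith _,_ (elements (subsets (n ℕ.* n))) (allFin n) (λ p → ι (extensions? p)) ⟩
      ∑ⁿ (elements (subsets (n ℕ.* n))) (λ T → ∑ⁿ (allFin n) (λ w → ι (extensions? (T , w))))
        ≡⟨ ∑ℕ.∑-cong (elements (subsets (n ℕ.* n))) over ⟩
      ∑ⁿ (elements (subsets (n ℕ.* n))) (λ T → ι (conjugates? S T) ℕ.* choices S u)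
        ≡⟨ ∑ⁿ-*ʳ (elements (subsets (n ℕ.* n))) (λ T → ι (conjugates? S T)) (choices S u) ⟩
      conjugates S ℕ.* choices S u ∎
      where
      open ≡-Reasoning
      over : ∀ T → ∑ⁿ (allFin n) (λ w → ι (extensions? (T , w))) ≡ ι (conjugates? S T) ℕ.* choices S u
      over T = by (conjugates? S T)
        where
        by : (d : Dec (SameDom S T × Consistent T)) →
             ∑ⁿ (allFin n) (λ w → ι (extensions? (T , w))) ≡ ι d ℕ.* choices S u
        by (yes (same , con-T)) = trans
          (∑ℕ.∑-cong (allFin n) λ w → ι-cong (extensions? (T , w)) (consistent? (T ∪ ⁅ u ↦ w ⁆)) proj₂ (same ,_))
          (trans (sym (choices-sameDom con con-T small-S same u)) (sym (ℕ.+-identityʳ (choices S u))))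
        by (no ¬conj) = ∑ℕ.∑-ε (allFin n) λ w → ι-no (extensions? (T , w)) λ (same , con-∪) →
          ¬conj (same , consistent-⊆ ∈-∪⁅⁆ˡ con-∪)

  open OrderedSums ℚ-ordered using (_?·_; ?·-cong; ∑-?·)

  -- The consistent maps with a given domain are taken to be equiprobable.
  η : Pairs → ℚ
  η S = consistent? S ?· inv (conjugates S)

  conjugates-positive : ∀ {S} → Consistent S → 0 ℕ.< conjugates S
  conjugates-positive {S} con = #-positive (subsets (n ℕ.* n)) (conjugates? S) {S} ((λ a → id , id) , con)

  ?·-no : {P : Set} (P? : Dec P) → ¬ P → ∀ x → (P? ?· x) ≡ 0ℚ
  ?·-no P? ¬p x = cong (λ b → if b then x else 0ℚ) (dec-false P? ¬p)

  ?·-yes : {P : Set} (P? : Dec P) → P → ∀ x → (P? ?· x) ≡ x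
  ?·-yes P? p x = cong (λ b → if b then x else 0ℚ) (dec-true P? p)

  η-inconsistent : ∀ {S} → ¬ Consistent S → η S ≡ 0ℚ
  η-inconsistent {S} ¬con = ?·-no (consistent? S) ¬con (inv (conjugates S))

  η-positive : ∀ {S} → Consistent S → 0ℚ ℚ.< η S
  η-positive {S} con = subst (0ℚ ℚ.<_) (sym (?·-yes (consistent? S) con _)) (positive (conjugates-positive con))
    where
    positive : ∀ {m} → 0 ℕ.< m → 0ℚ ℚ.< inv m
    positive {suc m} _ = inv-pos m

  η-≥0 : ∀ S → 0ℚ ℚ.≤ η S
  η-≥0 S with consistent? S
  ... | yes _ = inv-≥0 (conjugates S)
  ... | no  _ = ℚ.≤-refl

  η-⊥ : η ⊥ₛ ≡ 1ℚ
  η-⊥ = trans (?·-yes (consistent? ⊥ₛ) con-⊥ _) (trans (cong inv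
      (#-unique (subsets (n ℕ.* n)) (conjugates? ⊥ₛ) {⊥ₛ} ((λ a → id , id) , con-⊥) λ (same , _) → unique-⊥ same))
    (trans (sym (ℚ.+-identityʳ (inv 1))) (·-inv 0)))
    where
    con-⊥ : Consistent ⊥ₛ
    con-⊥ u v in-⊥ = contradiction (in-⊥ zero) ∉⊥

    unique-⊥ : ∀ {T} → SameDom ⊥ₛ T → T ≡ ⊥ₛ
    unique-⊥ {T} same = Empty-unique λ (x , x∈T) → let a , b , eq = Fin.combine-surjective {n} {n} x in
      ∉⊥ (proj₂ (proj₂ (same a) (b , subst (_∈ T) (sym eq) x∈T)))

  η-row : ∀ S u → ∣ S ∣ ℕ.≤ K → ∑ᵠ (allFin n) (λ v → η (S ∪ ⁅ u ↦ v ⁆)) ≡ η S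
  η-row S u S≤K with consistent? S
  ... | no ¬con = ∑ℚ.∑-ε (allFin n) λ v → η-inconsistent (¬con ∘ consistent-⊆ ∈-∪⁅⁆ˡ)
  ... | yes con = begin
    ∑ᵠ (allFin n) (λ v → η (S ∪ ⁅ u ↦ v ⁆))
      ≡⟨ ∑ℚ.∑-cong (allFin n) (λ v → cong (λ N → consistent? (S ∪ ⁅ u ↦ v ⁆) ?· inv N)
           (conjugates-∪⁅⁆ S u v con (small S S≤K))) ⟩
    ∑ᵠ (allFin n) (λ v → consistent? (S ∪ ⁅ u ↦ v ⁆) ?· inv (conjugates S ℕ.* choices S u))
      ≡⟨ ∑-?· (λ v → consistent? (S ∪ ⁅ u ↦ v ⁆)) (allFin n) (inv (conjugates S ℕ.* choices S u)) ⟩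
    choices S u · inv (conjugates S ℕ.* choices S u)
      ≡⟨ ·-inv-* (conjugates S) (choices S u) (conjugates-positive con) choices-positive ⟩
    inv (conjugates S) ∎
    where
    open ≡-Reasoning
    -- Cancelling the number of choices requires that one exists, which `extension` provides.
    choices-positive : 0 ℕ.< choices S u
    choices-positive = let ψ , ψ-ok = extension con (small S S≤K) in
      #-positive (fins n) (λ v → consistent? (S ∪ ⁅ u ↦ v ⁆)) (ψ-ok u)

  -- Normalising by domains breaks the symmetry of rows and columns, so the column is compared with
  -- the row of `u₀`, the preimage of `v` under `ψ`. All `u` that may go to `v` have as many choices
  -- as `u₀`, and `u` may go to `v` exactly if `u₀` may go to `ψ u`.
  η-col : ∀ S v → ∣ S ∣ ℕ.≤ K → ∑ᵠ (allFin n) (λ u → η (S ∪ ⁅ u ↦ v ⁆)) ≡ η S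
  η-col S v S≤K with consistent? S
  ... | no ¬con = ∑ℚ.∑-ε (allFin n) λ v → η-inconsistent (¬con ∘ consistent-⊆ ∈-∪⁅⁆ˡ)
  ... | yes con = begin
    ∑ᵠ (allFin n) (λ u → η (S ∪ ⁅ u ↦ v ⁆))
      ≡⟨ ∑ℚ.∑-cong (allFin n) (λ u → ?·-cong (consistent? (S ∪ ⁅ u ↦ v ⁆)) λ con-∪ → cong inv
           (trans (conjugates-∪⁅⁆ S u v con small-S) (cong (conjugates S ℕ.*_) (choices≡ con-∪)))) ⟩
    ∑ᵠ (allFin n) (λ u → consistent? (S ∪ ⁅ u ↦ v ⁆) ?· inv (conjugates S ℕ.* choices S u₀))
      ≡⟨ ∑-?· (λ u → consistent? (S ∪ ⁅ u ↦ v ⁆)) (allFin n) (inv (conjugates S ℕ.* choices S u₀)) ⟩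
    # (fins n) (λ u → consistent? (S ∪ ⁅ u ↦ v ⁆)) · inv (conjugates S ℕ.* choices S u₀)
      ≡⟨ cong (_· inv (conjugates S ℕ.* choices S u₀)) preimages≡choices ⟩
    choices S u₀ · inv (conjugates S ℕ.* choices S u₀)
      ≡⟨ ·-inv-* (conjugates S) (choices S u₀) (conjugates-positive con)
           (#-positive (fins n) (λ v → consistent? (S ∪ ⁅ u₀ ↦ v ⁆)) u₀↦v) ⟩
    inv (conjugates S) ∎
    where
    open ≡-Reasoning
    small-S : Small S
    small-S = small S S≤K

    ψ : Fin n ↔ Fin n
    ψ = proj₁ (extension con small-S)

    ψ-ok : ∀ w → Consistent (S ∪ ⁅ w ↦ to ψ w ⁆)
    ψ-ok = proj₂ (extension con small-S)

    u₀ : Fin n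
    u₀ = from ψ v

    u₀↦v : Consistent (S ∪ ⁅ u₀ ↦ v ⁆)
    u₀↦v = subst (λ v → Consistent (S ∪ ⁅ u₀ ↦ v ⁆)) (strictlyInverseˡ ψ v) (ψ-ok u₀)

    choices≡ : ∀ {u} → Consistent (S ∪ ⁅ u ↦ v ⁆) → choices S u ≡ choices S u₀
    choices≡ con-∪ = ∑ℕ.∑-cong (allFin n) λ v′ → ι-cong (consistent? _) (consistent? _)
      (zigzag S S id u₀↦v con-∪) (zigzag S S id con-∪ u₀↦v)

    preimages≡choices : # (fins n) (λ u → consistent? (S ∪ ⁅ u ↦ v ⁆)) ≡ choices S u₀
    preimages≡choices = trans
      (∑ℕ.∑-cong (allFin n) λ u → ι-cong (consistent? (S ∪ ⁅ u ↦ v ⁆)) (consistent? (S ∪ ⁅ u₀ ↦ to ψ u ⁆))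
        (λ con-∪ → zigzag S S id u₀↦v con-∪ (ψ-ok u))
        (λ con-∪ → zigzag S S id (ψ-ok u) con-∪ u₀↦v))
      (sym (∑ⁿ-reindex (fins n) ψ (λ v → ι (consistent? (S ∪ ⁅ u₀ ↦ v ⁆)))))

  η-solution : Solution K G H ℚ-ordered η
  η-solution = record
    { nonneg         = λ S _ → η-≥0 S
    ; row-sum        = η-row
    ; col-sum        = η-col
    ; edge-nonedge≈0 = λ S {u₁} {u₂} {v₁} {v₂} _ e ¬e → η-inconsistent λ con →
        ¬e (proj₁ (proj₂ (proj₂ (atomicType-≡ G H u₁ u₂ v₁ v₂ (types S con)))) e)
    ; nonedge-edge≈0 = λ S {u₁} {u₂} {v₁} {v₂} _ ¬e e → η-inconsistent λ con →
        ¬e (proj₂ (proj₂ (proj₂ (atomicType-≡ G H u₁ u₂ v₁ v₂ (types S con)))) e)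
    }
    where
    types : ∀ S {u₁ u₂ v₁ v₂} → Consistent ((S ∪ ⁅ u₁ ↦ v₁ ⁆) ∪ ⁅ u₂ ↦ v₂ ⁆) → atomicType G u₁ u₂ ≡ atomicType H v₁ v₂
    types S {u₁} {u₂} {v₁} {v₂} con = sameType con
      (∈-∪⁅⁆ˡ (∈-∪⁅⁆ʳ S (u₁ ↦ v₁))) (∈-∪⁅⁆ʳ (S ∪ ⁅ u₁ ↦ v₁ ⁆) (u₂ ↦ v₂))

  η-lift : Lift (𝒬System G H) (suc K) (fromℚ ∘ η)
  η-lift = solution⇒lift η-solution η-⊥

  -- Tuples over a single pair are constant, hence substitutions of `u` and `v` along a constant
  -- map.
  singleton-consistent : ∀ {u v} → c u ≡ d v → ∀ i → Consistent ⁅ lookup u i ↦ lookup v i ⁆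
  singleton-consistent {u} {v} same i x y in-S = trans
    (cong c (lookup-ext λ j → trans (proj₁ (entries j)) (sym (Vec.lookup∘tabulate (λ _ → lookup u i) j))))
    (trans (substitute u v (λ _ → i) same)
      (cong d (lookup-ext λ j → trans (Vec.lookup∘tabulate (λ _ → lookup v i) j) (sym (proj₂ (entries j))))))
    where
    entries : ∀ j → lookup x j ≡ lookup u i × lookup y j ≡ lookup v i
    entries j = ↦-injective (lookup x j) (lookup y j) (lookup u i) (lookup v i) (x∈⁅y⁆⇒x≡y _ (in-S j))

-- The two equivalences

module _ {n k : ℕ} where

  private
    K : ℕ
    K = suc (suc k)

  open WL {n} {K}

  𝒬-resp-≈ᴹ : ∀ {ℓ G H} (X Y : Matrix n) → Y ≈ᴹ X → 𝒬⟨ ℓ ⟩ G H X → 𝒬⟨ ℓ ⟩ G H Y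
  𝒬-resp-≈ᴹ X Y Y≈X (y , lift , X≈y) = y , lift , λ i →
    ≈-trans {uncurry Y (remQuot n i)} {uncurry X (remQuot n i)} {y ⁅ i ⁆}
      (Y≈X (proj₁ (remQuot {n} n i)) (proj₂ (remQuot {n} n i))) (X≈y i)

  module Point {G H : SimpleGraph n} {X : Matrix n} (X∈𝒬 : 𝒬⟨ suc K ⟩ G H X) where

    y : Subset (n ℕ.* n) → ℝ
    y = proj₁ X∈𝒬

    1≉0 : ¬ monomialValue y ⊥ₛ ≈ 0ℝ
    1≉0 z⊥≈0 = contradiction (fromℚ-injective {1ℚ} {0ℚ} (subst (_≈ 0ℝ) (monomialValue-⊥ y) z⊥≈0)) λ ()

    open FromSolution ℝ-ordered (lift⇒solution (proj₁ (proj₂ X∈𝒬))) 1≉0 public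

    X≈z : ∀ a b → X a b ≈ monomialValue y ⁅ a ↦ b ⁆
    X≈z a b = subst₂ _≈_ (cong (uncurry X) (Fin.remQuot-combine a b)) (sym (monomialValue-⁅⁆ y (a ↦ b)))
      (proj₂ (proj₂ X∈𝒬) (a ↦ b))

  module Construction (G H : SimpleGraph n) (r : ℕ) (stable : Stable H r)
    (γ₀ γ : Tuple n K ↔ Tuple n K)
    (γ₀-ok : ∀ u → 𝓒 G u ≡ 𝓒 H (Inverse.to γ₀ u))
    (γ-ok : ∀ u → D (colour G r) u ≡ D (colour H r) (Inverse.to γ u)) where

    open StableMatch G H r stable γ₀ γ γ₀-ok γ-ok
    open Weights G H (colour G r) (colour H r) ∼⇒𝓒 extend ∼-[] const-∼ public

    point : Matrix n
    point u v = fromℚ (η ⁅ u ↦ v ⁆)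

    point∈𝒬 : 𝒬⟨ suc K ⟩ G H point
    point∈𝒬 = fromℚ ∘ η , η-lift , λ i →
      subst (λ j → point (proj₁ (remQuot {n} n i)) (proj₂ (remQuot {n} n i)) ≈ fromℚ (η ⁅ j ⁆))
        (Fin.combine-remQuot {n} n i) (≈-refl {point (proj₁ (remQuot {n} n i)) (proj₂ (remQuot {n} n i))})

  𝓘-diagonal : ∀ a → 𝓘 n a a ≡ 1ℝ
  𝓘-diagonal a = cong (λ b → if b then 1ℝ else 0ℝ) (dec-true (a Fin.≟ a) refl)

  𝓘-off-diagonal : ∀ {a b} → a ≢ b → 𝓘 n a b ≡ 0ℝ
  𝓘-off-diagonal {a} {b} a≢b = cong (λ b → if b then 1ℝ else 0ℝ) (dec-false (a Fin.≟ b) a≢b)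

  module _ (G : SimpleGraph n) where

    open Automorphism K G using (iterate; Complete)
    open Equivalence using () renaming (to to ⇒; from to ⇐)

    module Self = Construction G G (proj₁ (stabilises G)) (proj₂ (stabilises G))
      (↔-id _) (↔-id _) (λ u → refl) (λ u → refl)

    -- For `a ≢ b` the constant tuples at `a` and `b` lie in different cells, and the set of their
    -- pairs is `⁅ a ↦ b ⁆`, so `y` vanishes there; the row equations then fix the diagonal.
    complete⇒𝓘 : ∀ t → Complete (iterate t) → ∀ X → 𝒬⟨ suc K ⟩ G G X → X ≈ᴹ 𝓘 n
    complete⇒𝓘 t complete X X∈𝒬 a b = by (a Fin.≟ b)
      where
      open Point {G} {G} {X} X∈𝒬

      off-diagonal : ∀ a b → a ≢ b → monomialValue y ⁅ a ↦ b ⁆ ≈ 0ℝ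
      off-diagonal a b a≢b = subst (λ S → monomialValue y S ≈ 0ℝ) (pairs-replicate (suc k) a b)
        (colour-≢⇒≈0 t (replicate K a) (replicate K b) λ same →
          a≢b (cong head (complete _ _ (⇐ (iterate⇔colour G t _ _) same))))

      by : Dec (a ≡ b) → X a b ≈ 𝓘 n a b
      by (yes refl) = ≈-trans {X a a} {monomialValue y ⁅ a ↦ a ⁆} {𝓘 n a a} (X≈z a a)
        (subst (monomialValue y ⁅ a ↦ a ⁆ ≈_) (trans (monomialValue-⊥ y) (sym (𝓘-diagonal a))) (diagonal off-diagonal a))
      by (no a≢b)   = ≈-trans {X a b} {monomialValue y ⁅ a ↦ b ⁆} {𝓘 n a b} (X≈z a b)
        (subst (monomialValue y ⁅ a ↦ b ⁆ ≈_) (sym (𝓘-off-diagonal a≢b)) (off-diagonal a b a≢b))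

    asymmetric : (∀ X → 𝒬⟨ suc K ⟩ G G X ⇔ (X ≈ᴹ 𝓘 n)) ⇔ WLDeterminesAsymmetric K G
    asymmetric = mk⇔
      (λ 𝒬≡𝓘 → t
        , (λ u v → mk⇔
            (λ u∼v → ⇐ (iterate⇔colour G (suc t) u v)
              (trans (stable u) (trans (⇒ (iterate⇔colour G t u v) u∼v) (sym (stable v)))))
            proj₁)
        -- Tuples of equal colour that differ at position `i` give the equiprobable point positive
        -- weight at an off-diagonal entry.
        , λ u v u∼v → lookup-ext λ i → decidable-stable (lookup u i Fin.≟ lookup v i) λ uᵢ≢vᵢ →
            ℚ.<⇒≢ (Self.η-positive (Self.singleton-consistent (⇒ (iterate⇔colour G t u v) u∼v) i))
              (sym (fromℚ-injective (subst (Self.point (lookup u i) (lookup v i) ≈_) (𝓘-off-diagonal uᵢ≢vᵢ)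
                (⇒ (𝒬≡𝓘 Self.point) Self.point∈𝒬 (lookup u i) (lookup v i))))))
      (λ (t , _ , complete) X → mk⇔
        (complete⇒𝓘 t complete X)
        -- The identity lies in the relaxation because the equiprobable point does and, by
        -- completeness, equals it.
        (λ X≈𝓘 → 𝒬-resp-≈ᴹ {suc K} {G} {G} Self.point X
          (λ a b → ≈-trans {X a b} {𝓘 n a b} {Self.point a b} (X≈𝓘 a b)
            (≈-sym {Self.point a b} {𝓘 n a b} (complete⇒𝓘 t complete Self.point Self.point∈𝒬 a b)))
          Self.point∈𝒬))
      where
      t : ℕ
      t = proj₁ (stabilises G)
      stable : Stable G t
      stable = proj₂ (stabilises G)

  nonIsomorphic : ∀ G H → (∀ X → ¬ 𝒬⟨ suc K ⟩ G H X) ⇔ WLDeterminesNonIsomorphic K G H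
  nonIsomorphic G H = mk⇔ only-if if
    where
    only-if : (∀ X → ¬ 𝒬⟨ suc K ⟩ G H X) → WLDeterminesNonIsomorphic K G H
    only-if empty =
      let s , stableG = stabilises G
          t , stableH = stabilises H
          stableH′ : Stable H (t ℕ.+ s)
          stableH′ = subst (Stable H) (ℕ.+-comm s t) (stable-+ H stableH s)
      -- A common round for both graphs, since the construction compares colours of the same round.
      in t ℕ.+ s , t ℕ.+ s
       , Stable⇒IsoStable (stable-+ G stableG t) , Stable⇒IsoStable stableH′
       , λ ((γ₀ , γ₀-ok) , final) →
           let γ , γ-ok = FinalMatch-colour final
               open Construction G H (t ℕ.+ s) stableH′ (⤖⇒↔ γ₀) (⤖⇒↔ γ) γ₀-ok γ-ok
           in empty point point∈𝒬

    if : WLDeterminesNonIsomorphic K G H → ∀ X → ¬ 𝒬⟨ suc K ⟩ G H X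
    if (s , t , isoStableG , isoStableH , ¬match) X X∈𝒬 =
      let γ₀ , γ₀-ok = initialMatching
          -- The match is found at a common round and carried back to the rounds `s` and `t` by
          -- stability.
          γ , γ-ok   = finalMatching (t ℕ.+ s)
      in ¬match ((↔⇒⤖ γ₀ , γ₀-ok) , FinalMatch-iterate (↔⇒⤖ γ , λ u →
           trans (sym (D-cong (colour-+ G (IsoStable⇒Stable isoStableG) t) u)) (trans (γ-ok u)
             (trans (cong (λ r → D (colour H r) (Inverse.to γ u)) (ℕ.+-comm t s))
               (D-cong (colour-+ H (IsoStable⇒Stable isoStableH) s) (Inverse.to γ u))))))
      where open Point {G} {H} {X} X∈𝒬

theorem1p2 : (k n : ℕ) → 1 < k → (G H : SimpleGraph n) →
    ((∀ X → 𝒬⟨ suc k ⟩ G G X ⇔ (X ≈ᴹ 𝓘 n)) ⇔ WLDeterminesAsymmetric k G)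
    × ((∀ X → ¬ 𝒬⟨ suc k ⟩ G H X) ⇔ WLDeterminesNonIsomorphic k G H)
theorem1p2 (suc (suc k)) n _            G H = asymmetric G , nonIsomorphic G H
theorem1p2 (suc zero)    n (s≤s ()) G H
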